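{- Let $G=(V,E)$ be a node-weighted $n$-node graph of maximum degree $\Delta$ and neighborhood independence $\beta$, with node weights $w:V\to\mathbb{N}$ and maximum weight $W$. Let $\mathsf{OPT}$ be the weight of a maximum weight independent set of $G$, and assume that $G$ is equipped with a proper $\xi$-vertex coloring. Then, for every $\varepsilon>0$, there are deterministic $\mathsf{CONGEST}$ algorithms on $G$ that compute independent sets (1) of weight at least $\frac{1-\varepsilon}{\beta}\cdot\mathsf{OPT}$ in $O\big(\log^2(\Delta W)\cdot\log(1/\varepsilon)+\log^*\xi\big)$ rounds; (2) of weight at least $(1-\varepsilon)\cdot\frac{w(V)}{\Delta+1}$ in $O\big(\log^2\Delta\cdot\log(1/\varepsilon)+\log^*\xi\big)$ rounds; (3) of weight at least $\left(\frac12-\varepsilon\right)\cdot\sum_{v\in V}\frac{(w(v))^2}{w(v)+w(N(v))}$ in $O\big(\frac{\log^2(\Delta/\varepsilon)}{\varepsilon}+\log^*\xi\big)$ rounds.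
   Context: The $\mathsf{CONGEST}$ model: the network is the graph $G$; nodes have unique $O(\log n)$-bit identifiers; computation proceeds in synchronous rounds, in each of which every node may send an $O(\log n)$-bit message to each neighbor; at the end each node knows its own output (here: whether it is in the independent set). Nodes know the weights of their neighbors (equivalently, weights fit in $O(\log n)$ bits). For $S\subseteq V$, $w(S)=\sum_{v\in S}w(v)$; $N(v)$ is the set of neighbors of $v$. The neighborhood independence $\beta$ of $G$ is the maximum, over all nodes $v$, of the size of a largest independent set in the subgraph induced by $N(v)$. A proper $\xi$-vertex coloring assigns each node one of $\xi$ colors so that adjacent nodes get different colors; each node knows its color. -}

module Defs where

open import Data.Bool using (Bool; true; false; if_then_else_)
open import Data.Nat using (ℕ; zero; suc; _+_; _*_; _≤_; _<_; _⊔_; _^_; _≤?_)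
open import Data.Nat.DivMod using (_/_)
open import Data.Nat.Logarithm using (⌈log₂_⌉; ⌊log₂_⌋)
open import Data.Fin using (Fin; toℕ)
open import Data.Nat.ListAction using (sum)
open import Data.List using (List; []; _∷_; map; allFin; filterᵇ; length; foldr)
open import Data.Maybe using (Maybe; just)
open import Data.Product using (Σ; _×_; _,_; ∃)
open import Data.Sum using (_⊎_)
open import Data.Integer using (ℤ; ∣_∣)
open import Data.Rational using (ℚ; ↥_; ↧ₙ_; 0ℚ)
import Data.Rational as Q
open import Relation.Binary.PropositionalEquality using (_≡_; _≢_)
open import Relation.Nullary using (yes; no)

record Graph (n : ℕ) : Set where
  field
    adj     : Fin n → Fin n → Bool
    sym     : ∀ u v → adj u v ≡ adj v u
    irrefl  : ∀ v → adj v v ≡ false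
open Graph public

Subset : ℕ → Set
Subset n = Fin n → Bool

size : ∀ {n} → Subset n → ℕ
size {n} S = sum (map (λ v → if S v then 1 else 0) (allFin n))

wt : ∀ {n} → (Fin n → ℕ) → Subset n → ℕ
wt {n} w S = sum (map (λ v → if S v then w v else 0) (allFin n))

Nbr : ∀ {n} → Graph n → Fin n → Subset n
Nbr G v = adj G v

Independent : ∀ {n} → Graph n → Subset n → Set
Independent G S = ∀ u v → S u ≡ true → S v ≡ true → adj G u v ≡ false

_⊆_ : ∀ {n} → Subset n → Subset n → Set
S ⊆ T = ∀ v → S v ≡ true → T v ≡ true

deg : ∀ {n} → Graph n → Fin n → ℕ
deg G v = size (Nbr G v)

maxDeg : ∀ {n} → Graph n → ℕ
maxDeg {n} G = foldr _⊔_ 0 (map (deg G) (allFin n))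

maxWt : ∀ {n} → (Fin n → ℕ) → ℕ
maxWt {n} w = foldr _⊔_ 0 (map w (allFin n))

IsNbhdIndep : ∀ {n} → Graph n → ℕ → Set
IsNbhdIndep {n} G β =
  (∀ v (S : Subset n) → S ⊆ Nbr G v → Independent G S → size S ≤ β) ×
  (β ≡ 0 ⊎ Σ (Fin n) λ v → Σ (Subset n) λ S →
     S ⊆ Nbr G v × Independent G S × size S ≡ β)

IsOPT : ∀ {n} → Graph n → (Fin n → ℕ) → ℕ → Set
IsOPT {n} G w OPT =
  (∀ (S : Subset n) → Independent G S → wt w S ≤ OPT) ×
  (Σ (Subset n) λ S → Independent G S × wt w S ≡ OPT)

-- log x := ⌈log₂ (max x 2)⌉  (so that log x ≥ 1)
lg : ℕ → ℕ
lg x = ⌈log₂ (x ⊔ 2)⌉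

logStarAux : ℕ → ℕ → ℕ
logStarAux zero    x = 0
logStarAux (suc f) x with x ≤? 1
... | yes _ = 0
... | no  _ = suc (logStarAux f ⌊log₂ x ⌋)

logStar : ℕ → ℕ
logStar x = logStarAux x x

ceilDiv : ℕ → ℕ → ℕ
ceilDiv a zero    = 0
ceilDiv a (suc b) = (a + b) / suc b

ceilDivQ : ℕ → ℚ → ℕ
ceilDivQ a ε = ceilDiv (a * ↧ₙ ε) ∣ ↥ ε ∣

ℕtoℚ : ℕ → ℚ
ℕtoℚ k = Data.Integer.+ k Q./ 1

term3 : ∀ {n} → Graph n → (Fin n → ℕ) → Fin n → ℚ
term3 G w v = frac (w v * w v) (w v + wt w (Nbr G v))
  where
  frac : ℕ → ℕ → ℚ
  frac a zero    = 0ℚ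
  frac a (suc d) = Data.Integer.+ a Q./ suc d

sum3 : ∀ {n} → Graph n → (Fin n → ℕ) → ℚ
sum3 {n} G w = foldr Q._+_ 0ℚ (map (term3 G w) (allFin n))

record Instance : Set where
  field
    n      : ℕ
    G      : Graph n
    ident  : Fin n → ℕ
    ident-inj : ∀ u v → ident u ≡ ident v → u ≡ v
    w      : Fin n → ℕ
    ξ      : ℕ
    col    : Fin n → Fin ξ
    proper : ∀ u v → adj G u v ≡ true → col u ≢ col v
open Instance public

record LocalInput : Set where
  field
    netSize   : ℕ
    maxDegree : ℕ
    maxWeight : ℕ
    numColors : ℕ
    myId      : ℕ
    myWeight  : ℕ
    myColor   : ℕ
    neighbors : List (ℕ × ℕ)   -- (identifier, weight) of each neighbor

-- A deterministic CONGEST algorithm (unbounded local computation).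
-- In each round every node sends to the neighbor with identifier i the
-- bit string  send s i, then updates its state with the list of
-- (sender identifier, message) pairs it received.  A node's output is
-- 'just b' once it has decided (b = true: in the independent set).
record Algorithm : Set₁ where
  field
    State  : Set
    init   : LocalInput → State
    send   : State → ℕ → List Bool
    step   : State → List (ℕ × List Bool) → State
    output : State → Maybe Bool
open Algorithm public

module Run (A : Algorithm) (I : Instance) where
  nbrs : Fin (n I) → List (Fin (n I))
  nbrs v = filterᵇ (adj (G I) v) (allFin (n I))

  localInput : Fin (n I) → LocalInput
  localInput v = record
    { netSize = n I ; maxDegree = maxDeg (G I) ; maxWeight = maxWt (w I)
    ; numColors = ξ I ; myId = ident I v ; myWeight = w I v
    ; myColor = toℕ (col I v)
    ; neighbors = map (λ u → ident I u , w I u) (nbrs v) }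

  states : ℕ → Fin (n I) → State A
  states zero    v = init A (localInput v)
  states (suc t) v = step A (states t v)
    (map (λ u → ident I u , send A (states t u) (ident I v)) (nbrs v))

-- A solves instance I (identifiers and weights of ≤ cId·log n bits, messages of at most
-- cMsg·log n bits) within T ≤ bound rounds, producing an independent set
-- satisfying P.  Decisions are irrevocable.
Solves : (cId cMsg : ℕ) → Algorithm → (I : Instance) → ℕ →
         (Subset (n I) → Set) → Set
Solves cId cMsg A I bound P =
  (∀ v → ident I v < (n I ⊔ 2) ^ cId) →
  (maxWt (w I) < (n I ⊔ 2) ^ cId) →
  (∀ t u v → adj (G I) u v ≡ true →
     length (send A (states t u) (ident I v)) ≤ cMsg * lg (n I)) ×
  (∀ t v b → output A (states t v) ≡ just b →
     ∀ t' → t ≤ t' → output A (states t' v) ≡ just b) ×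
  (Σ ℕ λ T → T ≤ bound × Σ (Subset (n I)) λ S →
     (∀ v → output A (states T v) ≡ just (S v)) × Independent (G I) S × P S)
  where open Run A I

{-# OPTIONS --safe #-}
-- A fractional solution x is judged by 2 Σ w(v) x(v) - Σ c(u,v) x(u) x(v), where the second sum runs
-- over ordered pairs of neighbours and c(u,v) = min(w(u), w(v)): for integral x, dropping the lighter
-- end of each conflict leaves an independent set of at least half this weight. The values x(v) are
-- rounded one binary digit at a time. A node that rounds a digit follows the sign of the derivative,
-- which loses only the cost between nodes that round simultaneously; so it suffices to give the nodes
-- O(1/δ) time slots such that a fraction δ of the cost lies inside slots. The slots are found digit by
-- digit: low-agreement codes shrink the palette, then the few colour classes choose greedily.
-- Over K digits the loss (1 + δ)^K is a constant for δ = 1/(2K), in O(K²) rounds.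
--
-- Parts 1 and 2: doubling x(v) while Σ w x over the closed neighbourhood of v is below w(v)/8 gives,
-- after O(log Δ) rounds, a solution of low cost that is rounded to a set I with w(T) ≤ 16 B w(I), for
-- every T that meets each closed neighbourhood at most B times. T is a maximum weight independent
-- set, or T = V. Local ratio with O(log 1/ε) repetitions turns the constant 16 into 1/(1 - ε).
--
-- Part 3: x(v) = w(v) / (w(v) + w(N(v))) costs at most Σ w x by the inequality of the means, and is
-- rounded with δ of order ε/K.
module Submission where

import Data.Bool
open import Data.Bool using (Bool; true; false; if_then_else_)
open import Data.Empty using (⊥; ⊥-elim)
open import Data.Fin using (Fin; toℕ)
open import Data.Fin.Properties using (toℕ-injective; toℕ<n)
open import Data.Integer using (-[1+_]; ∣_∣)
import Data.Integer as Z
import Data.Integer.Properties as ZP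
open import Data.List using (List; []; _∷_; _++_; map; foldr; length; take; drop; filterᵇ; allFin; downFrom)
open import Data.List.Membership.Propositional using (_∈_)
open import Data.List.Membership.Propositional.Properties using (∈-allFin; ∈-downFrom⁻)
open import Data.List.Properties using (map-∘; map-cong; length-++; length-tabulate)
open import Data.List.Relation.Unary.All using (All; []; _∷_; tabulate)
open import Data.List.Relation.Unary.All.Properties using (map⁺; ++⁺)
open import Data.List.Relation.Unary.Any using (here; there)
open import Data.Maybe using (Maybe; just; nothing)
open import Data.Nat
open import Data.Nat.DivMod using (_/_; _%_; m≡m%n+[m/n]*n; m%n<n; m/n*n≤m; /-monoˡ-≤)
open import Data.Nat.Induction using (<-rec)
open import Data.Nat.ListAction using (sum)
open import Data.Nat.Logarithm using (⌈log₂_⌉; ⌊log₂_⌋; ⌊log₂⌋-mono-≤; ⌈log₂⌉-mono-≤; ⌊log₂⌊n/2⌋⌋≡⌊log₂n⌋∸1; ⌈log₂⌈n/2⌉⌉≡⌈log₂n⌉∸1; ⌊log₂[2^n]⌋≡n; ⌈log₂2^n⌉≡n)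
open import Data.Nat.Properties
open import Data.Nat.Tactic.RingSolver using (solve-∀)
open import Data.Product using (Σ; _×_; _,_; proj₁; proj₂)
open import Data.Rational using (ℚ; 0ℚ; 1ℚ; ½; _-_; mkℚ; ↥_; ↧ₙ_; toℚᵘ; *<*; positive; nonNegative)
import Data.Rational as Q
import Data.Rational.Properties as QP
open import Data.Rational.Solver using (module +-*-Solver)
open import Data.Rational.Unnormalised using (mkℚᵘ; *≡*; *≤*)
import Data.Rational.Unnormalised as U
import Data.Rational.Unnormalised.Properties as UP
open import Data.Sum using (_⊎_; inj₁; inj₂)
open import Relation.Binary.Definitions using (tri<; tri≈; tri>)
open import Relation.Binary.PropositionalEquality using (_≡_; _≢_; refl; trans; cong; cong₂; subst; subst₂; module ≡-Reasoning) renaming (sym to ≡-sym)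
open import Relation.Nullary using (¬_; Dec; yes; no; does)
open import Defs hiding (sym)

-- The bottleneck is the number of rounds per binary digit, which has to be linear in D = 1/δ.
-- Choosing one of about D slots in a single greedy pass would need codes of length proportional to
-- D, hence of the order of D² colour classes to be processed one after the other. Therefore a slot
-- has four digits, each of which only has to divide the cost inside slots by e = D^(1/4). Codes of
-- length about e log e leave e² log² e colours, which is O(e⁴), and there are (2e)⁴ = 16 D slots:
-- both numbers are O(D). The second constraint is the message size. Fractions are kept as
-- numerators over a power of two, identifiers replace the colours when ξ is huge, the history of
-- the local ratio recursion stays on a private stack, and in part 3 the accuracy is capped at a
-- polynomial in n. Estimates are carried out in ℕ with denominators cleared; instead of
-- subtracting, a term is added on both sides and cancelled at the end.

-- Indicators, finite sums and averaging

𝟙ᵇ : Bool → ℕ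
𝟙ᵇ b = if b then 1 else 0

𝟙 : ∀ {p} {P : Set p} → Dec P → ℕ
𝟙 d = 𝟙ᵇ (does d)

𝟙-yes : ∀ {p} {P : Set p} (d : Dec P) → P → 𝟙 d ≡ 1
𝟙-yes (yes _) _ = refl
𝟙-yes (no ¬p) p = ⊥-elim (¬p p)

𝟙-no : ∀ {p} {P : Set p} (d : Dec P) → ¬ P → 𝟙 d ≡ 0
𝟙-no (yes p) ¬p = ⊥-elim (¬p p)
𝟙-no (no _)  _  = refl

opaque
  -- Numerical rather than boolean, so that conflict weights are sums and products of them; opaque,
  -- so that they are evaluated only through the lemmas of this block.
  eq lt : ℕ → ℕ → ℕ
  eq x y = 𝟙 (x ≟ y)
  lt x y = 𝟙 (x <? y)

  eq-≡ : ∀ {x y} → x ≡ y → eq x y ≡ 1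
  eq-≡ {x} {y} = 𝟙-yes (x ≟ y)

  eq-≢ : ∀ {x y} → x ≢ y → eq x y ≡ 0
  eq-≢ {x} {y} = 𝟙-no (x ≟ y)

  lt-< : ∀ {x y} → x < y → lt x y ≡ 1
  lt-< {x} {y} = 𝟙-yes (x <? y)

  lt-≮ : ∀ {x y} → x ≮ y → lt x y ≡ 0
  lt-≮ {x} {y} = 𝟙-no (x <? y)

eq-refl : ∀ x → eq x x ≡ 1
eq-refl x = eq-≡ refl

-- Used to charge collisions of refined values (colours, slots) to collisions of their components.
eq-mono : ∀ {x y x′ y′} → (x ≡ y → x′ ≡ y′) → eq x y ≤ eq x′ y′
eq-mono {x} {y} f with x ≟ y
... | yes x≡y = ≤-reflexive (trans (eq-≡ x≡y) (≡-sym (eq-≡ (f x≡y))))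
... | no  x≢y = ≤-trans (≤-reflexive (eq-≢ x≢y)) z≤n

eq-sym : ∀ x y → eq x y ≡ eq y x
eq-sym x y = ≤-antisym (eq-mono ≡-sym) (eq-mono ≡-sym)

eq≤1 : ∀ x y → eq x y ≤ 1
eq≤1 x y = ≤-trans (eq-mono {x} {y} {0} {0} (λ _ → refl)) (≤-reflexive (eq-refl 0))

lt≤1 : ∀ x y → lt x y ≤ 1
lt≤1 x y with x <? y
... | yes h = ≤-reflexive (lt-< h)
... | no ¬h = ≤-trans (≤-reflexive (lt-≮ ¬h)) z≤n

-- Multiplied into a symmetric double sum, it splits off the monochromatic part and leaves two
-- transposes of the same ordered sum.
trichotomy : ∀ x y → eq x y + (lt x y + lt y x) ≡ 1
trichotomy x y with <-cmp x y
... | tri< x<y x≢y y≮x = cong₂ _+_ (eq-≢ x≢y) (cong₂ _+_ (lt-< x<y) (lt-≮ y≮x))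
... | tri≈ x≮y x≡y y≮x = cong₂ _+_ (eq-≡ x≡y) (cong₂ _+_ (lt-≮ x≮y) (lt-≮ y≮x))
... | tri> x≮y x≢y y<x = cong₂ _+_ (eq-≢ x≢y) (cong₂ _+_ (lt-≮ x≮y) (lt-< y<x))

lt-suc : ∀ x y → lt x (suc y) ≡ lt x y + eq x y
lt-suc x y with <-cmp x y
... | tri< x<y x≢y _ = trans (lt-< (m<n⇒m<1+n x<y)) (≡-sym (cong₂ _+_ (lt-< x<y) (eq-≢ x≢y)))
... | tri≈ x≮y x≡y _ = trans (lt-< (s≤s (≤-reflexive x≡y))) (≡-sym (cong₂ _+_ (lt-≮ x≮y) (eq-≡ x≡y)))
... | tri> x≮y x≢y y<x = trans (lt-≮ (λ { (s≤s x≤y) → <⇒≱ y<x x≤y })) (≡-sym (cong₂ _+_ (lt-≮ x≮y) (eq-≢ x≢y)))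

private variable
  Elt Elt′ : Set

∑ : List Elt → (Elt → ℕ) → ℕ
∑ xs f = sum (map f xs)

∑-cong : ∀ (xs : List Elt) {f g : Elt → ℕ} → (∀ x → f x ≡ g x) → ∑ xs f ≡ ∑ xs g
∑-cong []       h = refl
∑-cong (x ∷ xs) h = cong₂ _+_ (h x) (∑-cong xs h)

∑-mono : ∀ (xs : List Elt) {f g : Elt → ℕ} → (∀ x → f x ≤ g x) → ∑ xs f ≤ ∑ xs g
∑-mono []       h = z≤n
∑-mono (x ∷ xs) h = +-mono-≤ (h x) (∑-mono xs h)

∑-mono-∈ : ∀ (xs : List Elt) {f g : Elt → ℕ} → (∀ x → x ∈ xs → f x ≤ g x) → ∑ xs f ≤ ∑ xs g
∑-mono-∈ []       h = z≤n
∑-mono-∈ (x ∷ xs) h = +-mono-≤ (h x (here refl)) (∑-mono-∈ xs (λ y y∈ → h y (there y∈)))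

+-interchange : ∀ a b c d → (a + b) + (c + d) ≡ (a + c) + (b + d)
+-interchange = solve-∀

∑-+ : ∀ (xs : List Elt) (f g : Elt → ℕ) → ∑ xs (λ x → f x + g x) ≡ ∑ xs f + ∑ xs g
∑-+ []       f g = refl
∑-+ (x ∷ xs) f g = trans (cong ((f x + g x) +_) (∑-+ xs f g)) (+-interchange (f x) (g x) (∑ xs f) (∑ xs g))

∑-*ˡ : ∀ (xs : List Elt) k (f : Elt → ℕ) → ∑ xs (λ x → k * f x) ≡ k * ∑ xs f
∑-*ˡ []       k f = ≡-sym (*-zeroʳ k)
∑-*ˡ (x ∷ xs) k f = trans (cong (k * f x +_) (∑-*ˡ xs k f)) (≡-sym (*-distribˡ-+ k (f x) (∑ xs f)))

∑-zero : ∀ (xs : List Elt) → ∑ xs (λ _ → 0) ≡ 0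
∑-zero []       = refl
∑-zero (x ∷ xs) = ∑-zero xs

∑-swap : ∀ (xs : List Elt) (ys : List Elt′) (f : Elt → Elt′ → ℕ) →
  ∑ xs (λ x → ∑ ys (f x)) ≡ ∑ ys (λ y → ∑ xs (λ x → f x y))
∑-swap []       ys f = ≡-sym (∑-zero ys)
∑-swap (x ∷ xs) ys f = trans (cong (∑ ys (f x) +_) (∑-swap xs ys f)) (≡-sym (∑-+ ys (f x) (λ y → ∑ xs (λ z → f z y))))

∑-∈ : ∀ {xs : List Elt} {x} (f : Elt → ℕ) → x ∈ xs → f x ≤ ∑ xs f
∑-∈ f (here refl) = m≤m+n _ _
∑-∈ f (there x∈)  = ≤-trans (∑-∈ f x∈) (m≤n+m _ _)

∑-map : ∀ (g : Elt → Elt′) (xs : List Elt) (f : Elt′ → ℕ) → ∑ (map g xs) f ≡ ∑ xs (λ x → f (g x))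
∑-map g []       f = refl
∑-map g (x ∷ xs) f = cong (f (g x) +_) (∑-map g xs f)

∑-filterᵇ : ∀ (p : Elt → Bool) (xs : List Elt) (f : Elt → ℕ) → ∑ (filterᵇ p xs) f ≡ ∑ xs (λ x → 𝟙ᵇ (p x) * f x)
∑-filterᵇ p []       f = refl
∑-filterᵇ p (x ∷ xs) f with p x
... | true  = cong₂ _+_ (≡-sym (*-identityˡ (f x))) (∑-filterᵇ p xs f)
... | false = ∑-filterᵇ p xs f

∑-downFrom-zero : ∀ q (f : ℕ → ℕ) → (∀ i → i < q → f i ≡ 0) → ∑ (downFrom q) f ≡ 0
∑-downFrom-zero zero    f h = refl
∑-downFrom-zero (suc q) f h rewrite h q (n<1+n q) = ∑-downFrom-zero q f (λ i i<q → h i (m<n⇒m<1+n i<q))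

∑-downFrom-cong : ∀ q {f g : ℕ → ℕ} → (∀ i → i < q → f i ≡ g i) → ∑ (downFrom q) f ≡ ∑ (downFrom q) g
∑-downFrom-cong zero    h = refl
∑-downFrom-cong (suc q) h = cong₂ _+_ (h q (n<1+n q)) (∑-downFrom-cong q (λ i i<q → h i (m<n⇒m<1+n i<q)))

∑-downFrom-mono : ∀ q {f g : ℕ → ℕ} → (∀ i → i < q → f i ≤ g i) → ∑ (downFrom q) f ≤ ∑ (downFrom q) g
∑-downFrom-mono zero    h = z≤n
∑-downFrom-mono (suc q) h = +-mono-≤ (h q (n<1+n q)) (∑-downFrom-mono q (λ i i<q → h i (m<n⇒m<1+n i<q)))

∑-downFrom-const : ∀ q k → ∑ (downFrom q) (λ _ → k) ≡ q * k
∑-downFrom-const zero    k = refl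
∑-downFrom-const (suc q) k = cong (k +_) (∑-downFrom-const q k)

∑-downFrom-bound : ∀ q k (f : ℕ → ℕ) → (∀ i → i < q → f i ≤ k) → ∑ (downFrom q) f ≤ q * k
∑-downFrom-bound q k f h = ≤-trans (∑-downFrom-mono q h) (≤-reflexive (∑-downFrom-const q k))

∑-downFrom-term : ∀ q (f : ℕ → ℕ) {i} → i < q → f i ≤ ∑ (downFrom q) f
∑-downFrom-term (suc q) f {i} (s≤s i≤q) with m≤n⇒m<n∨m≡n i≤q
... | inj₁ i<q  = ≤-trans (∑-downFrom-term q f i<q) (m≤n+m _ _)
... | inj₂ refl = m≤m+n _ _

∑-eq≤1 : ∀ q x → ∑ (downFrom q) (λ i → eq i x) ≤ 1
∑-eq≤1 zero    x = z≤n
∑-eq≤1 (suc q) x with q ≟ x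
... | yes refl = ≤-reflexive (cong₂ _+_ (eq-refl q) (∑-downFrom-zero q _ (λ i i<q → eq-≢ (<⇒≢ i<q))))
... | no q≢x  = ≤-trans (+-monoˡ-≤ _ (≤-reflexive (eq-≢ q≢x))) (∑-eq≤1 q x)

argmin : ℕ → (ℕ → ℕ) → ℕ
argmin zero    f = 0
argmin (suc q) f with f q ≤? f (argmin q f)
... | yes _ = q
... | no  _ = argmin q f

argmin-≤ : ∀ q (f : ℕ → ℕ) {i} → i < q → f (argmin q f) ≤ f i
argmin-≤ (suc q) f {i} (s≤s i≤q) with f q ≤? f (argmin q f) | m≤n⇒m<n∨m≡n i≤q
... | yes p | inj₁ i<q  = ≤-trans p (argmin-≤ q f i<q)
... | yes p | inj₂ refl = ≤-refl
... | no ¬p | inj₁ i<q  = argmin-≤ q f i<q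
... | no ¬p | inj₂ refl = <⇒≤ (≰⇒> ¬p)

argmin-<suc : ∀ q (f : ℕ → ℕ) → argmin (suc q) f < suc q
argmin-<suc zero    f with f 0 ≤? f 0
... | yes _ = s≤s z≤n
... | no  _ = s≤s z≤n
argmin-<suc (suc q) f with f (suc q) ≤? f (argmin (suc q) f)
... | yes _ = ≤-refl
... | no  _ = m<n⇒m<1+n (argmin-<suc q f)

argmin-< : ∀ q (f : ℕ → ℕ) → 0 < q → argmin q f < q
argmin-< (suc q) f _ = argmin-<suc q f

-- The minimum is at most the average. Every greedy choice of the algorithm is the derandomisation
-- of a uniform choice by this inequality.
argmin-avg : ∀ q (f : ℕ → ℕ) → q * f (argmin q f) ≤ ∑ (downFrom q) f
argmin-avg q f = ≤-trans (≤-reflexive (≡-sym (∑-downFrom-const q _))) (∑-downFrom-mono q (λ i → argmin-≤ q f))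

-- Powers of two, logarithms and Bernoulli's inequality

2^-≢0 : ∀ k → NonZero (2 ^ k)
2^-≢0 k = m^n≢0 2 k

0<2^ : ∀ k → 0 < 2 ^ k
0<2^ k = m^n>0 2 k

n<2^n : ∀ n → n < 2 ^ n
n<2^n zero    = s≤s z≤n
n<2^n (suc n) = ≤-trans (s≤s (n<2^n n)) (≤-trans (+-monoˡ-≤ (2 ^ n) (0<2^ n)) (≤-reflexive (cong (2 ^ n +_) (≡-sym (+-identityʳ _)))))

⌊log₂⌋-suc : ∀ n → ⌊log₂ suc (suc n) ⌋ ≡ suc ⌊log₂ suc ⌊ n /2⌋ ⌋
⌊log₂⌋-suc n = lem (⌊log₂⌊n/2⌋⌋≡⌊log₂n⌋∸1 (2 + n)) (⌊log₂⌋-mono-≤ {2} {2 + n} (s≤s (s≤s z≤n)))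
  where
  lem : ∀ {x y} → x ≡ y ∸ 1 → 1 ≤ y → y ≡ suc x
  lem {y = suc y} refl _ = refl

⌈log₂⌉-suc : ∀ n → ⌈log₂ suc (suc n) ⌉ ≡ suc ⌈log₂ suc ⌈ n /2⌉ ⌉
⌈log₂⌉-suc n = lem (⌈log₂⌈n/2⌉⌉≡⌈log₂n⌉∸1 (2 + n)) (⌈log₂⌉-mono-≤ {2} {2 + n} (s≤s (s≤s z≤n)))
  where
  lem : ∀ {x y} → x ≡ y ∸ 1 → 1 ≤ y → y ≡ suc x
  lem {y = suc y} refl _ = refl

2*⌊n/2⌋≤n : ∀ n → 2 * ⌊ n /2⌋ ≤ n
2*⌊n/2⌋≤n zero = z≤n
2*⌊n/2⌋≤n (suc zero) = z≤n
2*⌊n/2⌋≤n (suc (suc n)) = ≤-trans (≤-reflexive (*-suc 2 ⌊ n /2⌋)) (s≤s (s≤s (2*⌊n/2⌋≤n n)))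

n≤1+2*⌊n/2⌋ : ∀ n → n ≤ 1 + 2 * ⌊ n /2⌋
n≤1+2*⌊n/2⌋ zero = z≤n
n≤1+2*⌊n/2⌋ (suc zero) = s≤s z≤n
n≤1+2*⌊n/2⌋ (suc (suc n)) = ≤-trans (s≤s (s≤s (n≤1+2*⌊n/2⌋ n))) (≤-reflexive (cong suc (≡-sym (*-suc 2 ⌊ n /2⌋))))

n≤2*⌈n/2⌉ : ∀ n → n ≤ 2 * ⌈ n /2⌉
n≤2*⌈n/2⌉ zero = z≤n
n≤2*⌈n/2⌉ (suc n) = ≤-trans (s≤s (n≤1+2*⌊n/2⌋ n)) (≤-reflexive (≡-sym (*-suc 2 ⌊ n /2⌋)))

2^⌊log₂⌋≤ : ∀ n → 0 < n → 2 ^ ⌊log₂ n ⌋ ≤ n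
2^⌊log₂⌋≤ = <-rec _ go
  where
  go : ∀ n → (∀ {m} → m < n → 0 < m → 2 ^ ⌊log₂ m ⌋ ≤ m) → 0 < n → 2 ^ ⌊log₂ n ⌋ ≤ n
  go (suc zero)    rec _ = s≤s z≤n
  go (suc (suc n)) rec _ = ≤-trans (≤-reflexive (cong (2 ^_) (⌊log₂⌋-suc n)))
    (≤-trans (*-monoʳ-≤ 2 (rec (s≤s (s≤s (⌊n/2⌋≤n n))) (s≤s z≤n))) (2*⌊n/2⌋≤n (2 + n)))

<2^1+⌊log₂⌋ : ∀ n → n < 2 ^ suc ⌊log₂ n ⌋
<2^1+⌊log₂⌋ = <-rec _ go
  where
  go : ∀ n → (∀ {m} → m < n → m < 2 ^ suc ⌊log₂ m ⌋) → n < 2 ^ suc ⌊log₂ n ⌋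
  go zero          rec = s≤s z≤n
  go (suc zero)    rec = s≤s (s≤s z≤n)
  go (suc (suc n)) rec = <-≤-trans
    (≤-trans (s≤s (n≤1+2*⌊n/2⌋ (2 + n)))
      (≤-trans (≤-reflexive (≡-sym (*-suc 2 (suc ⌊ n /2⌋))))
        (*-monoʳ-≤ 2 (rec (s≤s (s≤s (⌊n/2⌋≤n n)))))))
    (≤-reflexive (cong (λ k → 2 ^ suc k) (≡-sym (⌊log₂⌋-suc n))))

n≤2^⌈log₂n⌉ : ∀ n → n ≤ 2 ^ ⌈log₂ n ⌉
n≤2^⌈log₂n⌉ = <-rec _ go
  where
  go : ∀ n → (∀ {m} → m < n → m ≤ 2 ^ ⌈log₂ m ⌉) → n ≤ 2 ^ ⌈log₂ n ⌉
  go zero          rec = z≤n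
  go (suc zero)    rec = s≤s z≤n
  go (suc (suc n)) rec = ≤-trans
    (≤-trans (n≤2*⌈n/2⌉ (2 + n)) (*-monoʳ-≤ 2 (rec (s≤s (s≤s (⌈n/2⌉≤n n))))))
    (≤-reflexive (cong (2 ^_) (≡-sym (⌈log₂⌉-suc n))))

⌈log₂⌉≤1+⌊log₂⌋ : ∀ n → ⌈log₂ n ⌉ ≤ suc ⌊log₂ n ⌋
⌈log₂⌉≤1+⌊log₂⌋ n = ≤-trans (⌈log₂⌉-mono-≤ (<⇒≤ (<2^1+⌊log₂⌋ n))) (≤-reflexive (⌈log₂2^n⌉≡n (suc ⌊log₂ n ⌋)))

≤2^⇒⌈log₂⌉≤ : ∀ n k → n ≤ 2 ^ k → ⌈log₂ n ⌉ ≤ k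
≤2^⇒⌈log₂⌉≤ n k h = ≤-trans (⌈log₂⌉-mono-≤ h) (≤-reflexive (⌈log₂2^n⌉≡n k))

≤2^⇒⌊log₂⌋≤ : ∀ n k → n ≤ 2 ^ k → ⌊log₂ n ⌋ ≤ k
≤2^⇒⌊log₂⌋≤ n k h = ≤-trans (⌊log₂⌋-mono-≤ h) (≤-reflexive (⌊log₂[2^n]⌋≡n k))

2^⌈log₂⌉≤2* : ∀ n → 0 < n → 2 ^ ⌈log₂ n ⌉ ≤ 2 * n
2^⌈log₂⌉≤2* n 0<n = ≤-trans (^-monoʳ-≤ 2 (⌈log₂⌉≤1+⌊log₂⌋ n)) (*-monoʳ-≤ 2 (2^⌊log₂⌋≤ n 0<n))

⌈log₂*⌉≤ : ∀ m n → ⌈log₂ m * n ⌉ ≤ ⌈log₂ m ⌉ + ⌈log₂ n ⌉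
⌈log₂*⌉≤ m n = ≤2^⇒⌈log₂⌉≤ (m * n) _
  (≤-trans (*-mono-≤ (n≤2^⌈log₂n⌉ m) (n≤2^⌈log₂n⌉ n)) (≤-reflexive (≡-sym (^-distribˡ-+-* 2 ⌈log₂ m ⌉ ⌈log₂ n ⌉))))

⌈log₂⌉≤ : ∀ n → ⌈log₂ n ⌉ ≤ n
⌈log₂⌉≤ n = ≤2^⇒⌈log₂⌉≤ n n (<⇒≤ (n<2^n n))

-- Bernoulli: (1 - 1/(D+1))^k ≥ 1 - k/(D+1), cleared of denominators.
bernoulli : ∀ D k → suc D ^ k * suc D ≤ suc D * D ^ k + k * suc D ^ k
bernoulli D zero = ≤-reflexive (bern0 D)
  where
  bern0 : ∀ D → 1 * suc D ≡ suc D * 1 + 0 * 1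
  bern0 = solve-∀
bernoulli D (suc k) = +-cancelʳ-≤ (k * suc D ^ k) _ _ (begin
  suc D ^ suc k * suc D + k * suc D ^ k
    ≡⟨ e₁ D k (suc D ^ k) ⟩
  D * (suc D ^ k * suc D) + suc D * suc D ^ k + k * suc D ^ k
    ≤⟨ +-monoˡ-≤ (k * suc D ^ k) (+-monoˡ-≤ (suc D * suc D ^ k) (*-monoʳ-≤ D (bernoulli D k))) ⟩
  D * (suc D * D ^ k + k * suc D ^ k) + suc D * suc D ^ k + k * suc D ^ k
    ≡⟨ e₂ D k (suc D ^ k) (D ^ k) ⟩
  (suc D * D ^ suc k + suc k * suc D ^ suc k) + 0 ≤⟨ +-monoʳ-≤ _ z≤n ⟩
  (suc D * D ^ suc k + suc k * suc D ^ suc k) + k * suc D ^ k ∎)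
  where
  open ≤-Reasoning
  e₁ : ∀ D k P → suc D * P * suc D + k * P ≡ D * (P * suc D) + suc D * P + k * P
  e₁ = solve-∀
  e₂ : ∀ D k P Q → D * (suc D * Q + k * P) + suc D * P + k * P ≡ (suc D * (D * Q) + suc k * (suc D * P)) + 0
  e₂ = solve-∀

-- This is (1 + 1/D)^k ≤ 1 + 1/c, obtained from Bernoulli for (1 - 1/(D+1))^k. With c = 1 the
-- accumulated loss is a factor 2, with c = 2E it is 1 + 1/(2E).
[1+1/D]^k≤ : ∀ D k c → k * suc c ≤ D → suc D ^ k * c ≤ D ^ k * suc c
[1+1/D]^k≤ D k c h = *-cancelʳ-≤ _ _ (suc D) (+-cancelʳ-≤ (k * suc c * P) _ _ (begin
  P * c * suc D + k * suc c * P       ≤⟨ +-monoʳ-≤ _ (*-monoˡ-≤ P (≤-trans h (n≤1+n D))) ⟩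
  P * c * suc D + suc D * P           ≡⟨ e₁ P c (suc D) ⟩
  suc c * (P * suc D)                 ≤⟨ *-monoʳ-≤ (suc c) (bernoulli D k) ⟩
  suc c * (suc D * Q + k * P)         ≡⟨ e₂ (suc c) (suc D) Q k P ⟩
  Q * suc c * suc D + k * suc c * P ∎))
  where
  open ≤-Reasoning
  P = suc D ^ k
  Q = D ^ k
  e₁ : ∀ P c d → P * c * d + d * P ≡ (1 + c) * (P * d)
  e₁ = solve-∀
  e₂ : ∀ c d Q k P → c * (d * Q + k * P) ≡ Q * c * d + k * c * P
  e₂ = solve-∀

-- Codes in which any two words agree rarely

-- A column of the code by the method of conditional expectations: in a random column two rows agree
-- with probability 1/q, and each row here does at least as well against the rows before it.
greedy : ℕ → (ℕ → ℕ → ℕ) → ℕ → ℕ → ℕ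
greedy q ω zero    y = 0
greedy q ω (suc M) y with y ≟ M
... | yes _ = argmin q (λ p → ∑ (downFrom M) (λ z → ω M z * eq p (greedy q ω M z)))
... | no  _ = greedy q ω M y

pairs : ℕ → (ℕ → ℕ → ℕ) → ℕ
pairs M f = ∑ (downFrom M) (λ x → ∑ (downFrom x) (f x))

pairs-cong : ∀ M {f g : ℕ → ℕ → ℕ} → (∀ x y → x < M → y < M → f x y ≡ g x y) → pairs M f ≡ pairs M g
pairs-cong M h = ∑-downFrom-cong M (λ x x<M → ∑-downFrom-cong x (λ y y<x → h x y x<M (<-trans y<x x<M)))

greedy-old : ∀ q ω M {y} → y < M → greedy q ω (suc M) y ≡ greedy q ω M y
greedy-old q ω M {y} y<M with y ≟ M
... | yes refl = ⊥-elim (<-irrefl refl y<M)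
... | no  _    = refl

greedy-new : ∀ q ω M → greedy q ω (suc M) M ≡ argmin q (λ p → ∑ (downFrom M) (λ z → ω M z * eq p (greedy q ω M z)))
greedy-new q ω M with M ≟ M
... | yes _  = refl
... | no M≢M = ⊥-elim (M≢M refl)

greedy-< : ∀ q ω M y → 0 < q → greedy q ω M y < q
greedy-< q ω zero    y 0<q = 0<q
greedy-< q ω (suc M) y 0<q with y ≟ M
... | yes _ = argmin-< q _ 0<q
... | no  _ = greedy-< q ω M y 0<q

*-swapˡ : ∀ a b c → a * (b * c) ≡ b * (a * c)
*-swapˡ = solve-∀

-- Each `z` conflicts with at most one letter `p`, so the conflicts of all q letters add up to at
-- most the total weight, and the best letter has at most a q-th of it.
argmin-conflict : ∀ {A : Set} q (xs : List A) (ω k : A → ℕ) →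
  let p = argmin q (λ p → ∑ xs (λ z → ω z * eq p (k z)))
  in q * ∑ xs (λ z → ω z * eq p (k z)) ≤ ∑ xs ω
argmin-conflict q xs ω k = begin
  q * ∑ xs (λ z → ω z * eq _ (k z))                           ≤⟨ argmin-avg q _ ⟩
  ∑ (downFrom q) (λ p → ∑ xs (λ z → ω z * eq p (k z)))        ≡⟨ ∑-swap (downFrom q) xs _ ⟩
  ∑ xs (λ z → ∑ (downFrom q) (λ p → ω z * eq p (k z)))        ≡⟨ ∑-cong xs (λ z → ∑-*ˡ (downFrom q) (ω z) _) ⟩
  ∑ xs (λ z → ω z * ∑ (downFrom q) (λ p → eq p (k z)))        ≤⟨ ∑-mono xs (λ z → *-monoʳ-≤ (ω z) (∑-eq≤1 q (k z))) ⟩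
  ∑ xs (λ z → ω z * 1)                                        ≡⟨ ∑-cong xs (λ z → *-identityʳ (ω z)) ⟩
  ∑ xs ω ∎
  where open ≤-Reasoning

-- Letters once assigned never change, so the bounds for the single rows add up.
greedy-conflict : ∀ q ω M → let g = greedy q ω M in
  q * pairs M (λ x y → ω x y * eq (g x) (g y)) ≤ pairs M ω
greedy-conflict q ω zero    = ≤-reflexive (*-zeroʳ q)
greedy-conflict q ω (suc M) = begin
  q * (∑ (downFrom M) (λ y → ω M y * eq (g′ M) (g′ y)) + pairs M (λ x y → ω x y * eq (g′ x) (g′ y)))
    ≡⟨ cong (q *_) (cong₂ _+_
         (∑-downFrom-cong M (λ y y<M → cong (ω M y *_) (cong₂ eq (greedy-new q ω M) (greedy-old q ω M y<M))))
         (pairs-cong M (λ x y x<M y<M → cong (ω x y *_) (cong₂ eq (greedy-old q ω M x<M) (greedy-old q ω M y<M))))) ⟩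
  q * (∑ (downFrom M) (λ y → ω M y * eq p (g y)) + pairs M (λ x y → ω x y * eq (g x) (g y)))
    ≡⟨ *-distribˡ-+ q _ _ ⟩
  q * ∑ (downFrom M) (λ y → ω M y * eq p (g y)) + q * pairs M (λ x y → ω x y * eq (g x) (g y))
    ≤⟨ +-mono-≤ (argmin-conflict q (downFrom M) (ω M) g) (greedy-conflict q ω M) ⟩
  ∑ (downFrom M) (ω M) + pairs M ω ∎
  where
  open ≤-Reasoning
  g′ = greedy q ω (suc M)
  g  = greedy q ω M
  p  = argmin q (λ p → ∑ (downFrom M) (λ z → ω M z * eq p (g z)))

-- The columns of the code are chosen one after the other; a pair of rows that has agreed a times
-- carries the weight 2 ^ a, and each column is chosen to agree on few pairs by weight.
potential : ℕ → ℕ → ℕ → ℕ → ℕ → ℕ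
potential M q zero    x y = 1
potential M q (suc t) x y =
  potential M q t x y * (1 + eq (greedy q (potential M q t) M x) (greedy q (potential M q t) M y))

column : ℕ → ℕ → ℕ → ℕ → ℕ
column M q t = greedy q (potential M q t) M

agreement : ℕ → ℕ → ℕ → ℕ → ℕ → ℕ
agreement M q T x y = ∑ (downFrom T) (λ t → eq (column M q t x) (column M q t y))

potential-agreement : ∀ M q T x y → potential M q T x y ≡ 2 ^ agreement M q T x y
potential-agreement M q zero    x y = refl
potential-agreement M q (suc T) x y = begin
  potential M q T x y * (1 + e)      ≡⟨ cong₂ _*_ (potential-agreement M q T x y) (lem e (eq≤1 _ _)) ⟩
  2 ^ agreement M q T x y * 2 ^ e    ≡⟨ *-comm (2 ^ agreement M q T x y) (2 ^ e) ⟩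
  2 ^ e * 2 ^ agreement M q T x y    ≡⟨ ^-distribˡ-+-* 2 e _ ⟨
  2 ^ (e + agreement M q T x y) ∎
  where
  open ≡-Reasoning
  e = eq (column M q T x) (column M q T y)
  lem : ∀ e → e ≤ 1 → 1 + e ≡ 2 ^ e
  lem zero          _         = refl
  lem (suc zero)    _         = refl
  lem (suc (suc _)) (s≤s ())

pairs-+ : ∀ M (f g : ℕ → ℕ → ℕ) → pairs M (λ x y → f x y + g x y) ≡ pairs M f + pairs M g
pairs-+ M f g = trans (∑-cong (downFrom M) (λ x → ∑-+ (downFrom x) (f x) (g x))) (∑-+ (downFrom M) _ _)

-- One column multiplies the total weight by at most 1 + 1/q: the pairs that agree in it double
-- their weight, and they carry at most a q-th of the total. The initial weight is the number of
-- pairs, at most M².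
potential-growth : ∀ M q T → q ^ T * pairs M (potential M q T) ≤ suc q ^ T * (M * M)
potential-growth M q zero = +-monoˡ-≤ 0
  (∑-downFrom-bound M M _ (λ x x<M → ≤-trans (∑-downFrom-bound x 1 _ (λ _ _ → ≤-refl)) (≤-trans (≤-reflexive (*-identityʳ x)) (<⇒≤ x<M))))
potential-growth M q (suc T) = begin
  q * q ^ T * pairs M (potential M q (suc T))
    ≡⟨ *-assoc q (q ^ T) _ ⟩
  q * (q ^ T * pairs M (potential M q (suc T)))
    ≡⟨ *-swapˡ q (q ^ T) _ ⟩
  q ^ T * (q * pairs M (potential M q (suc T)))
    ≡⟨ cong (λ z → q ^ T * (q * z)) (trans (pairs-cong M (λ x y _ _ → trans (*-distribˡ-+ (potential M q T x y) 1 _) (cong (_+ potential M q T x y * eq (g x) (g y)) (*-identityʳ _)))) (pairs-+ M _ _)) ⟩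
  q ^ T * (q * (Φ + Ψ))
    ≡⟨ cong (q ^ T *_) (*-distribˡ-+ q Φ Ψ) ⟩
  q ^ T * (q * Φ + q * Ψ)
    ≤⟨ *-monoʳ-≤ (q ^ T) (+-monoʳ-≤ (q * Φ) (greedy-conflict q (potential M q T) M)) ⟩
  q ^ T * (q * Φ + Φ)
    ≡⟨ e₁ q (q ^ T) Φ ⟩
  suc q * (q ^ T * Φ)
    ≤⟨ *-monoʳ-≤ (suc q) (potential-growth M q T) ⟩
  suc q * (suc q ^ T * (M * M))
    ≡⟨ *-assoc (suc q) (suc q ^ T) (M * M) ⟨
  suc q ^ suc T * (M * M) ∎
  where
  open ≤-Reasoning
  g = column M q T
  Φ = pairs M (potential M q T)
  Ψ = pairs M (λ x y → potential M q T x y * eq (g x) (g y))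
  e₁ : ∀ q P F → P * (q * F + F) ≡ suc q * (P * F)
  e₁ = solve-∀

2^-cancel-≤ : ∀ m n → 2 ^ m ≤ 2 ^ n → m ≤ n
2^-cancel-≤ m n h with m ≤? n
... | yes p = p
... | no ¬p = ⊥-elim (<⇒≱ (^-monoʳ-< 2 (s≤s (s≤s z≤n)) (≰⇒> ¬p)) h)

-- A pair that agrees a times weighs 2^a by itself, while all pairs together weigh at most (1 +
-- 1/q)^T M² ≤ 2 M² for q = 2T. Hence a ≤ 1 + 2L.
code-agreement-ordered : ∀ L T {x y} → 0 < T → x < 2 ^ L → y < x → agreement (2 ^ L) (2 * T) T x y ≤ 1 + 2 * L
code-agreement-ordered L T {x} {y} 0<T x<M y<x = 2^-cancel-≤ _ _ (begin
  2 ^ agreement M q T x y   ≡⟨ potential-agreement M q T x y ⟨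
  potential M q T x y       ≤⟨ ∑-downFrom-term x (potential M q T x) y<x ⟩
  ∑ (downFrom x) (potential M q T x) ≤⟨ ∑-downFrom-term M (λ x → ∑ (downFrom x) (potential M q T x)) x<M ⟩
  pairs M (potential M q T) ≤⟨ *-cancelˡ-≤ (q ^ T) {{m^n≢0 q T {{>-nonZero (≤-trans 0<T (m≤m+n T _))}}}} (≤-trans (potential-growth M q T) (begin
      suc q ^ T * (M * M)       ≡⟨ cong (_* (M * M)) (*-identityʳ (suc q ^ T)) ⟨
      suc q ^ T * 1 * (M * M)   ≤⟨ *-monoˡ-≤ (M * M) ([1+1/D]^k≤ q T 1 (≤-reflexive (*-comm T 2))) ⟩
      q ^ T * 2 * (M * M)       ≡⟨ *-assoc (q ^ T) 2 (M * M) ⟩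
      q ^ T * (2 * (M * M)) ∎)) ⟩
  2 * (M * M)               ≡⟨ cong (2 *_) (^-distribˡ-+-* 2 L L) ⟨
  2 ^ suc (L + L)           ≡⟨ cong (λ k → 2 ^ suc (L + k)) (+-identityʳ L) ⟨
  2 ^ (1 + 2 * L) ∎)
  where
  open ≤-Reasoning
  M = 2 ^ L
  q = 2 * T

opaque
  -- There are `2 ^ L` words of length T over 2T letters. The relative agreement is (1 + 2L) / T, so
  -- a longer code is as good as desired, at the price of 2T² pairs of a position and a letter.
  code : (L T : ℕ) → ℕ → ℕ → ℕ
  code L T = column (2 ^ L) (2 * T)

  code-< : ∀ L T t x → 0 < T → code L T t x < 2 * T
  code-< L T t x 0<T = greedy-< (2 * T) (potential (2 ^ L) (2 * T) t) (2 ^ L) x (≤-trans 0<T (m≤m+n T _))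

  code-agreement : ∀ L T x y → 0 < T → x < 2 ^ L → y < 2 ^ L → x ≢ y →
    ∑ (downFrom T) (λ t → eq (code L T t x) (code L T t y)) ≤ 1 + 2 * L
  code-agreement L T x y 0<T x<M y<M x≢y with <-cmp x y
  ... | tri≈ _ x≡y _ = ⊥-elim (x≢y x≡y)
  ... | tri> _ _ y<x = code-agreement-ordered L T 0<T x<M y<x
  ... | tri< x<y _ _ = ≤-trans (≤-reflexive (∑-cong (downFrom T) (λ t → eq-sym (code L T t x) (code L T t y))))
                               (code-agreement-ordered L T 0<T y<M x<y)

-- Programs of broadcast rounds and their compilation to algorithms

isOn : ℕ → Bool
isOn zero    = false
isOn (suc _) = true

-- frc is a fractional value, at a scale known from the round number; clr is a proper colouring, aux a
-- temporary one; slt and nxt are the time slots of a schedule under construction; mem is 1 for the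
-- members of the independent set. Everything but the stack is sent to all neighbours in every round.
record Node : Set where
  field
    wgt   : ℕ
    frc   : ℕ
    clr   : ℕ
    aux   : ℕ
    slt   : ℕ
    nxt   : ℕ
    mem   : ℕ
    stack : List Bool
open Node public

strip : Node → Node
strip d = record d { stack = [] }

words : Node → List ℕ
words d = wgt d ∷ frc d ∷ clr d ∷ aux d ∷ slt d ∷ nxt d ∷ mem d ∷ []

fromWords : List ℕ → Node
fromWords (w ∷ f ∷ c ∷ a ∷ s ∷ x ∷ m ∷ _) =
  record { wgt = w ; frc = f ; clr = c ; aux = a ; slt = s ; nxt = x ; mem = m ; stack = [] }
fromWords _ =
  record { wgt = 0 ; frc = 0 ; clr = 0 ; aux = 0 ; slt = 0 ; nxt = 0 ; mem = 0 ; stack = [] }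

odd : ℕ → Bool
odd zero          = false
odd (suc zero)    = true
odd (suc (suc n)) = odd n

odd+2*⌊n/2⌋ : ∀ n → 𝟙ᵇ (odd n) + 2 * ⌊ n /2⌋ ≡ n
odd+2*⌊n/2⌋ zero          = refl
odd+2*⌊n/2⌋ (suc zero)    = refl
odd+2*⌊n/2⌋ (suc (suc n)) =
  trans (cong (𝟙ᵇ (odd n) +_) (*-suc 2 ⌊ n /2⌋))
    (trans (+-suc _ _) (cong suc (trans (+-suc _ _) (cong suc (odd+2*⌊n/2⌋ n)))))

toBits : ℕ → ℕ → List Bool
toBits zero    x = []
toBits (suc b) x = odd x ∷ toBits b ⌊ x /2⌋

fromBits : List Bool → ℕ
fromBits []       = 0
fromBits (c ∷ cs) = 𝟙ᵇ c + 2 * fromBits cs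

length-toBits : ∀ b x → length (toBits b x) ≡ b
length-toBits zero    x = refl
length-toBits (suc b) x = cong suc (length-toBits b ⌊ x /2⌋)

take-toBits : ∀ b x bs → take b (toBits b x ++ bs) ≡ toBits b x
take-toBits zero    x bs = refl
take-toBits (suc b) x bs = cong (odd x ∷_) (take-toBits b ⌊ x /2⌋ bs)

drop-toBits : ∀ b x bs → drop b (toBits b x ++ bs) ≡ bs
drop-toBits zero    x bs = refl
drop-toBits (suc b) x bs = drop-toBits b ⌊ x /2⌋ bs

fromBits-toBits : ∀ b x → x < 2 ^ b → fromBits (toBits b x) ≡ x
fromBits-toBits zero    zero    _ = refl
fromBits-toBits zero    (suc x) (s≤s ())
fromBits-toBits (suc b) x x<2^ =
  trans (cong (λ y → 𝟙ᵇ (odd x) + 2 * y) (fromBits-toBits b ⌊ x /2⌋ (*-cancelˡ-< 2 _ _ (≤-<-trans (2*⌊n/2⌋≤n x) x<2^))))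
    (odd+2*⌊n/2⌋ x)

encodeWords : ℕ → List ℕ → List Bool
encodeWords b []       = []
encodeWords b (x ∷ xs) = toBits b x ++ encodeWords b xs

decodeWords : ℕ → ℕ → List Bool → List ℕ
decodeWords b zero    bs = []
decodeWords b (suc k) bs = fromBits (take b bs) ∷ decodeWords b k (drop b bs)

length-encodeWords : ∀ b xs → length (encodeWords b xs) ≡ length xs * b
length-encodeWords b []       = refl
length-encodeWords b (x ∷ xs) = trans (length-++ (toBits b x)) (cong₂ _+_ (length-toBits b x) (length-encodeWords b xs))

decode-encodeWords : ∀ b xs → All (_< 2 ^ b) xs → decodeWords b (length xs) (encodeWords b xs) ≡ xs
decode-encodeWords b []       _        = refl
decode-encodeWords b (x ∷ xs) (p ∷ ps) = cong₂ _∷_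
  (trans (cong fromBits (take-toBits b x _)) (fromBits-toBits b x p))
  (trans (cong (decodeWords b (length xs)) (drop-toBits b x _)) (decode-encodeWords b xs ps))

encode : ℕ → Node → List Bool
encode b d = encodeWords (suc b) (words d)

decode : ℕ → List Bool → Node
decode b bs = fromWords (decodeWords (suc b) 7 bs)

-- Not strict, since the fraction 1 at scale `2 ^ b` is the number `2 ^ b` itself; for this reason a
-- word is encoded with `suc b` bits.
Bounded : ℕ → Node → Set
Bounded b d = All (_≤ 2 ^ b) (words d)

decode-encode : ∀ b d → Bounded b d → decode b (encode b d) ≡ strip d
decode-encode b d h = cong fromWords (decode-encodeWords (suc b) (words d) (widen h))
  where
  widen : ∀ {xs} → All (_≤ 2 ^ b) xs → All (_< 2 ^ suc b) xs
  widen []       = []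
  widen (p ∷ ps) = ≤-<-trans p (^-monoʳ-< 2 (s≤s (s≤s z≤n)) (n<1+n b)) ∷ widen ps

-- One communication round.
Instr : Set
Instr = Node → List Node → Node

-- The invariant that makes decoding lossless in every round. It is demanded for arbitrary bounded
-- inboxes, so that programs can be checked instruction by instruction without any knowledge of the
-- run.
Keeps : ℕ → Instr → Set
Keeps b i = ∀ d ds → Bounded b d → All (Bounded b) ds → Bounded b (i d ds)

Config : ℕ → Set
Config n = Fin n → Node

neighbours : ∀ {n} → Graph n → Fin n → List (Fin n)
neighbours {n} G v = filterᵇ (adj G v) (allFin n)

round : ∀ {n} → Graph n → Instr → Config n → Config n
round G i c v = i (c v) (map (λ u → strip (c u)) (neighbours G v))

exec : ∀ {n} → Graph n → List Instr → Config n → Config n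
exec G []      c = c
exec G (i ∷ p) c = exec G p (round G i c)

exec-++ : ∀ {n} (G : Graph n) p q c → exec G (p ++ q) c ≡ exec G q (exec G p c)
exec-++ G []      q c = refl
exec-++ G (i ∷ p) q c = exec-++ G p q (round G i c)

record Machine : Set where
  constructor machine
  field
    width : ℕ
    node  : Node
    todo  : List Instr

decodeAll : ℕ → List (ℕ × List Bool) → List Node
decodeAll b = map (λ m → decode b (proj₂ m))

stepMachine : Machine → List (ℕ × List Bool) → Machine
stepMachine (machine b d [])      ms = machine b d []
stepMachine (machine b d (i ∷ p)) ms = machine b (i d (decodeAll b ms)) p

outputMachine : Machine → Maybe Bool
outputMachine (machine b d [])      = just (isOn (mem d))
outputMachine (machine b d (_ ∷ _)) = nothing

compile : (LocalInput → ℕ) → (LocalInput → Node) → (LocalInput → List Instr) → Algorithm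
compile width start prog = record
  { State  = Machine
  ; init   = λ x → machine (width x) (start x) (prog x)
  ; send   = λ s _ → encode (Machine.width s) (Machine.node s)
  ; step   = stepMachine
  ; output = outputMachine
  }

module Simulation (width : LocalInput → ℕ) (start : LocalInput → Node) (prog : LocalInput → List Instr)
  (I : Instance) (b : ℕ) (p₀ : List Instr) where
  open Run (compile width start prog) I

  c₀ : Config (n I)
  c₀ v = start (localInput v)

  -- The global view of a run: the program depends on global parameters only, so all nodes execute
  -- the same instruction and share one program counter.
  tick : Config (n I) × List Instr → Config (n I) × List Instr
  tick (c , [])    = c , []
  tick (c , i ∷ p) = round (G I) i c , p

  ticks : ℕ → Config (n I) × List Instr → Config (n I) × List Instr
  ticks zero    x = x
  ticks (suc t) x = tick (ticks t x)

  ticks-tick : ∀ t x → ticks t (tick x) ≡ tick (ticks t x)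
  ticks-tick zero    x = refl
  ticks-tick (suc t) x = cong tick (ticks-tick t x)

  ticks-exec : ∀ p c → ticks (length p) (c , p) ≡ (exec (G I) p c , [])
  ticks-exec []      c = refl
  ticks-exec (i ∷ p) c = trans (≡-sym (ticks-tick (length p) (c , i ∷ p))) (ticks-exec p (round (G I) i c))

  ticks-idle : ∀ t c → ticks t (c , []) ≡ (c , [])
  ticks-idle zero    c = refl
  ticks-idle (suc t) c = cong tick (ticks-idle t c)

  OK : Config (n I) × List Instr → Set
  OK (c , p) = (∀ v → Bounded b (c v)) × All (Keeps b) p

  tick-OK : ∀ x → OK x → OK (tick x)
  tick-OK (c , [])    h = h
  tick-OK (c , i ∷ p) (h , k ∷ ks) = (λ v → k (c v) _ (h v) (map⁺ (tabulate (λ {u} _ → h u)))) , ks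

  module _ (prog-global : ∀ v → prog (localInput v) ≡ p₀) (width-global : ∀ v → width (localInput v) ≡ b)
    (start-ok : OK (c₀ , p₀)) where

    ticks-OK : ∀ t → OK (ticks t (c₀ , p₀))
    ticks-OK zero    = start-ok
    ticks-OK (suc t) = tick-OK _ (ticks-OK t)

    inbox : ℕ → Fin (n I) → List (ℕ × List Bool)
    inbox t v = map (λ u → ident I u , encode (Machine.width (states t u)) (Machine.node (states t u))) (nbrs v)

    Follows : ℕ → Config (n I) × List Instr → Set
    Follows t (c , p) = ∀ v → states t v ≡ machine b (c v) p

    -- As the configuration is bounded, the messages decode to exactly the stripped nodes that
    -- `round` hands to the instruction.
    follow-step : ∀ t x → OK x → Follows t x → Follows (suc t) (tick x)
    follow-step t (c , [])    _       f v = cong (λ s → stepMachine s (inbox t v)) (f v)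
    follow-step t (c , i ∷ p) (h , _) f v =
      trans (cong (λ s → stepMachine s (inbox t v)) (f v))
        (cong (λ ds → machine b (i (c v) ds) p)
          (trans (≡-sym (map-∘ (nbrs v))) (map-cong (λ u → trans (cong (λ s → decode b (encode (Machine.width s) (Machine.node s))) (f u)) (decode-encode b (c u) (h u))) (nbrs v))))

    follow : ∀ t → Follows t (ticks t (c₀ , p₀))
    follow zero    v = cong₂ (λ k p → machine k (c₀ v) p) (width-global v) (prog-global v)
    follow (suc t) = follow-step t _ (ticks-OK t) (follow t)

    -- A node has an output only when its program is empty, and then it ignores all messages.
    frozen : ∀ t k x → Follows t x → ∀ v r → output (compile width start prog) (states t v) ≡ just r →
      OK x → Σ (Config (n I) × List Instr) λ y → Follows (k + t) y × OK y × output (compile width start prog) (states (k + t) v) ≡ just r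
    frozen t zero    x f v r e ok = x , f , ok , e
    frozen t (suc k) x f v r e ok with frozen t k x f v r e ok
    ... | (c , [])    , f′ , ok′ , e′ = (c , []) , follow-step (k + t) (c , []) ok′ f′ , ok′ ,
      trans (cong outputMachine (trans (follow-step (k + t) (c , []) ok′ f′ v) (≡-sym (f′ v)))) e′
    ... | (c , i ∷ p) , f′ , ok′ , e′ = ⊥-elim (nope (trans (≡-sym (cong outputMachine (f′ v))) e′))
      where
      nope : nothing ≡ just r → _
      nope ()

    irrevocable : ∀ t v r → output (compile width start prog) (states t v) ≡ just r →
      ∀ t′ → t ≤ t′ → output (compile width start prog) (states t′ v) ≡ just r
    irrevocable t v r e t′ t≤t′ = subst (λ s → output (compile width start prog) (states s v) ≡ just r) (m∸n+n≡m t≤t′)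
      (proj₂ (proj₂ (proj₂ (frozen t (t′ ∸ t) _ (follow t) v r e (ticks-OK t)))))

    message-length : ∀ t u → length (encode (Machine.width (states t u)) (Machine.node (states t u))) ≡ 7 * suc b
    message-length t u = trans (length-encodeWords (suc (Machine.width (states t u))) (words (Machine.node (states t u))))
      (cong (λ s → 7 * suc (Machine.width s)) (follow t u))

    decided : ∀ v → output (compile width start prog) (states (length p₀) v) ≡ just (isOn (mem (exec (G I) p₀ c₀ v)))
    decided v = cong outputMachine (trans (follow (length p₀) v) (cong (λ x → machine b (proj₁ x v) (proj₂ x)) (ticks-exec p₀ c₀)))

  solves : ∀ cId cMsg bound (P : Subset (n I) → Set) →
    (∀ v → prog (localInput v) ≡ p₀) → (∀ v → width (localInput v) ≡ b) → 7 * suc b ≤ cMsg * lg (n I) →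
    ((∀ v → ident I v < (n I ⊔ 2) ^ cId) → maxWt (w I) < (n I ⊔ 2) ^ cId →
      OK (c₀ , p₀) × length p₀ ≤ bound ×
      Independent (G I) (λ v → isOn (mem (exec (G I) p₀ c₀ v))) × P (λ v → isOn (mem (exec (G I) p₀ c₀ v)))) →
    Solves cId cMsg (compile width start prog) I bound P
  solves cId cMsg bound P pg wg short h hid hwt with h hid hwt
  ... | ok , len , ind , good =
    (λ t u v _ → ≤-trans (≤-reflexive (message-length pg wg ok t u)) short) ,
    (λ t v r → irrevocable pg wg ok t v r) ,
    length p₀ , len , _ , decided pg wg ok , ind , good

-- Schedules with little cost inside a time slot

-- Recovers the components of a pair packed into one number: position and letter of a colour, or old
-- slot and new digit of a slot.
*-+-unique : ∀ q {p p′ r r′} → r < q → r′ < q → p * q + r ≡ p′ * q + r′ → p ≡ p′ × r ≡ r′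
*-+-unique q {zero}  {zero}   r<q r′<q e = refl , e
*-+-unique q {zero}  {suc p′} {r} {r′} r<q r′<q e =
  ⊥-elim (<⇒≱ r<q (≤-trans (≤-trans (m≤m+n q (p′ * q)) (m≤m+n (q + p′ * q) r′)) (≤-reflexive (≡-sym e))))
*-+-unique q {suc p} {zero}   {r} {r′} r<q r′<q e =
  ⊥-elim (<⇒≱ r′<q (≤-trans (≤-trans (m≤m+n q (p * q)) (m≤m+n (q + p * q) r)) (≤-reflexive e)))
*-+-unique q {suc p} {suc p′} {r} {r′} r<q r′<q e
  with *-+-unique q {p} {p′} r<q r′<q (+-cancelˡ-≡ q _ _ (trans (≡-sym (+-assoc q (p * q) r)) (trans e (+-assoc q (p′ * q) r′))))
... | p≡p′ , r≡r′ = cong suc p≡p′ , r≡r′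

*-+-< : ∀ q m {p r} → p < m → r < q → p * q + r < m * q
*-+-< q (suc m) {p} {r} (s≤s p≤m) r<q = ≤-trans (≤-reflexive (≡-sym (+-suc (p * q) r)))
  (≤-trans (+-mono-≤ (*-monoˡ-≤ q p≤m) r<q) (≤-reflexive (+-comm (m * q) q)))

_≗_ : ∀ {n} → Config n → Config n → Set
c ≗ c′ = ∀ v → c v ≡ c′ v

loop : ℕ → (ℕ → Instr) → List Instr
loop zero    f = []
loop (suc m) f = loop m f ++ (f m ∷ [])

length-loop : ∀ m f → length (loop m f) ≡ m
length-loop zero    f = refl
length-loop (suc m) f = trans (length-++ (loop m f)) (trans (cong (_+ 1) (length-loop m f)) (+-comm m 1))

opaque
  ifEq : {A : Set} → ℕ → ℕ → A → A → A
  ifEq x y p q with x ≟ y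
  ... | yes _ = p
  ... | no  _ = q

  ifEq-≡ : ∀ {A : Set} {x y} {p q : A} → x ≡ y → ifEq x y p q ≡ p
  ifEq-≡ {x = x} {y} h with x ≟ y
  ... | yes _ = refl
  ... | no ¬h = ⊥-elim (¬h h)

  ifEq-≢ : ∀ {A : Set} {x y} {p q : A} → x ≢ y → ifEq x y p q ≡ q
  ifEq-≢ {x = x} {y} ¬h with x ≟ y
  ... | yes h = ⊥-elim (¬h h)
  ... | no _  = refl

shot : (Node → Node → ℕ) → (Node → ℕ) → ℕ → ℕ → Instr
shot k src L T d ds = record d { aux = t * (2 * T) + code L T t (src d) }
  where
  t = argmin T (λ t → ∑ ds (λ q → k d q * eq (code L T t (src d)) (code L T t (src q))))

-- The cost inside the slots found so far; nodes whose slots already differ can never share a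
-- refined slot.
kernel : Node → Node → ℕ
kernel d q = (wgt d ⊓ wgt q) * (frc d * frc q) * eq (slt d) (slt q)

-- Nodes of colour i react to the lower colours only, whose digits are final. The minimum with `cap`
-- makes the message bound hold in every state; in the runs considered here the slots stay below it.
pick : (e cap i : ℕ) → Instr
pick e cap i d ds = record d { nxt = ifEq (aux d) i
  ((slt d * e + argmin e (λ p → ∑ ds (λ q → kernel d q * lt (aux q) (aux d) * eq (slt d * e + p) (nxt q)))) ⊓ cap)
  (nxt d) }

-- The slots of all nodes change together at the end of a stage, because `kernel` has to compare the
-- slots without the new digit.
commit : Instr
commit d ds = record d { slt = nxt d }

module Local {n : ℕ} (G : Graph n) where

  V : List (Fin n)
  V = allFin n

  received : Config n → Fin n → List Node
  received c v = map (λ u → strip (c u)) (neighbours G v)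

  a : Fin n → Fin n → ℕ
  a v u = 𝟙ᵇ (adj G v u)

  a-sym : ∀ v u → a v u ≡ a u v
  a-sym v u = cong 𝟙ᵇ (Graph.sym G v u)

  round-cong : ∀ i {c c′ : Config n} → c ≗ c′ → round G i c ≗ round G i c′
  round-cong i h v = cong₂ i (h v) (map-cong (λ u → cong strip (h u)) (neighbours G v))

  exec-cong : ∀ p {c c′ : Config n} → c ≗ c′ → exec G p c ≗ exec G p c′
  exec-cong []      h = h
  exec-cong (i ∷ p) h = exec-cong p (round-cong i h)

  exec-then : ∀ p q {c c′ c″ : Config n} → exec G p c ≗ c′ → exec G q c′ ≗ c″ → exec G (p ++ q) c ≗ c″
  exec-then p q {c} h k v = trans (cong (λ x → x v) (exec-++ G p q c)) (trans (exec-cong q h v) (k v))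

  ∑-received : ∀ (c : Config n) (f : Node → ℕ) v →
    ∑ (received c v) f ≡ ∑ V (λ u → a v u * f (strip (c u)))
  ∑-received c f v = trans (∑-map (λ u → strip (c u)) (neighbours G v) f) (∑-filterᵇ (adj G v) V _)

  code-collisions : ∀ L T x y → 0 < T → x < 2 ^ L → y < 2 ^ L →
    ∑ (downFrom T) (λ t → eq (code L T t x) (code L T t y)) ≤ T * eq x y + (1 + 2 * L)
  code-collisions L T x y 0<T x< y< with x ≟ y
  ... | yes x≡y rewrite eq-≡ x≡y = ≤-trans (∑-downFrom-bound T 1 _ (λ t _ → eq≤1 _ _)) (m≤m+n _ _)
  ... | no  x≢y = ≤-trans (code-agreement L T x y 0<T x< y< x≢y) (m≤n+m _ _)

  shot-conflict : ∀ k src L T (c : Config n) → 0 < T → (∀ d → src (strip d) ≡ src d) → (∀ v → src (c v) < 2 ^ L) →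
    let c′ = round G (shot k src L T) c in ∀ v →
    T * ∑ V (λ u → a v u * k (c v) (strip (c u)) * eq (aux (c′ v)) (aux (c′ u))) ≤
    ∑ V (λ u → a v u * k (c v) (strip (c u)) * (T * eq (src (c v)) (src (c u)) + (1 + 2 * L)))
  shot-conflict k src L T c 0<T src-strip src< v = begin
    T * ∑ V (λ u → Ω u * eq (aux (c′ v)) (aux (c′ u)))
      -- Equal new colours force equal positions, so only the position chosen by v remains and the
      -- choices of the neighbours drop out.
      ≤⟨ *-monoʳ-≤ T (∑-mono V (λ u → *-monoʳ-≤ (Ω u) (eq-mono (λ e → proj₂ (agree u e))))) ⟩
    T * ∑ V (λ u → Ω u * eq (κ t v) (κ t u))
      ≡⟨ cong (T *_) (≡-sym (f≡ t)) ⟩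
    T * f t
      ≤⟨ argmin-avg T f ⟩
    ∑ (downFrom T) f
      ≡⟨ ∑-cong (downFrom T) f≡ ⟩
    ∑ (downFrom T) (λ t → ∑ V (λ u → Ω u * eq (κ t v) (κ t u)))
      ≡⟨ ∑-swap (downFrom T) V _ ⟩
    ∑ V (λ u → ∑ (downFrom T) (λ t → Ω u * eq (κ t v) (κ t u)))
      ≡⟨ ∑-cong V (λ u → ∑-*ˡ (downFrom T) (Ω u) _) ⟩
    ∑ V (λ u → Ω u * ∑ (downFrom T) (λ t → eq (κ t v) (κ t u)))
      ≤⟨ ∑-mono V (λ u → *-monoʳ-≤ (Ω u) (code-collisions L T _ _ 0<T (src< v) (src< u))) ⟩
    ∑ V (λ u → Ω u * (T * eq (src (c v)) (src (c u)) + (1 + 2 * L))) ∎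
    where
    open ≤-Reasoning
    c′ = round G (shot k src L T) c
    Ω : Fin n → ℕ
    Ω u = a v u * k (c v) (strip (c u))
    κ : ℕ → Fin n → ℕ
    κ t u = code L T t (src (c u))
    F : Fin n → ℕ → ℕ
    F v t = ∑ (received c v) (λ q → k (c v) q * eq (code L T t (src (c v))) (code L T t (src q)))
    f = F v
    t = argmin T f
    f≡ : ∀ t → f t ≡ ∑ V (λ u → Ω u * eq (κ t v) (κ t u))
    f≡ t = trans (∑-received c _ v) (∑-cong V (λ u → trans (≡-sym (*-assoc (a v u) _ _))
      (cong (λ s → Ω u * eq (κ t v) (code L T t s)) (src-strip (c u)))))
    agree : ∀ u → aux (c′ v) ≡ aux (c′ u) → t ≡ argmin T (F u) × κ t v ≡ κ t u
    agree u e with *-+-unique (2 * T) {t} {argmin T (F u)} (code-< L T _ (src (c v)) 0<T) (code-< L T _ (src (c u)) 0<T) e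
    ... | t≡ , κ≡ = t≡ , trans κ≡ (cong (λ s → κ s u) (≡-sym t≡))

  shot-< : ∀ k src L T d ds → 0 < T → aux (shot k src L T d ds) < T * (2 * T)
  shot-< k src L T d ds 0<T = *-+-< (2 * T) T (argmin-< T _ 0<T) (code-< L T _ (src d) 0<T)

  cost : (Fin n → ℕ) → (Fin n → ℕ) → Fin n → Fin n → ℕ
  cost w X v u = a v u * ((w v ⊓ w u) * (X v * X u))

  cost-sym : ∀ w X v u → cost w X v u ≡ cost w X u v
  cost-sym w X v u = cong₂ _*_ (a-sym v u) (cong₂ _*_ (⊓-comm (w v) (w u)) (*-comm (X v) (X u)))

  ∑∑ : (Fin n → Fin n → ℕ) → ℕ
  ∑∑ f = ∑ V (λ v → ∑ V (f v))

  ∑∑-mono : ∀ {f g : Fin n → Fin n → ℕ} → (∀ v u → f v u ≤ g v u) → ∑∑ f ≤ ∑∑ g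
  ∑∑-mono h = ∑-mono V (λ v → ∑-mono V (h v))

  ∑∑-cong : ∀ {f g : Fin n → Fin n → ℕ} → (∀ v u → f v u ≡ g v u) → ∑∑ f ≡ ∑∑ g
  ∑∑-cong h = ∑-cong V (λ v → ∑-cong V (h v))

  ∑∑-+ : ∀ (f g : Fin n → Fin n → ℕ) → ∑∑ (λ v u → f v u + g v u) ≡ ∑∑ f + ∑∑ g
  ∑∑-+ f g = trans (∑-cong V (λ v → ∑-+ V (f v) (g v))) (∑-+ V _ _)

  ∑∑-*ˡ : ∀ k (f : Fin n → Fin n → ℕ) → ∑∑ (λ v u → k * f v u) ≡ k * ∑∑ f
  ∑∑-*ˡ k f = trans (∑-cong V (λ v → ∑-*ˡ V k (f v))) (∑-*ˡ V k _)

  ∑∑-transpose : ∀ (f : Fin n → Fin n → ℕ) → ∑∑ (λ v u → f u v) ≡ ∑∑ f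
  ∑∑-transpose f = ∑-swap V V (λ v u → f u v)

  mono : (w X s : Fin n → ℕ) → ℕ
  mono w X s = ∑∑ (λ v u → cost w X v u * eq (s v) (s u))

  total : (w X : Fin n → ℕ) → ℕ
  total w X = ∑∑ (cost w X)

  module Pick (e cap : ℕ) (0<e : 0 < e) (c : Config n) (fits : ∀ v → slt (c v) * e + e ≤ cap) where

    Ω : Fin n → Fin n → ℕ
    Ω v u = a v u * (kernel (c v) (c u) * lt (aux (c u)) (aux (c v)))

    withNxt : (Fin n → ℕ) → Config n
    withNxt x v = record (c v) { nxt = x v }

    best : (Fin n → ℕ) → Fin n → ℕ
    best x v = argmin e (λ p → ∑ (received (withNxt x) v)
      (λ q → kernel (c v) q * lt (aux q) (aux (c v)) * eq (slt (c v) * e + p) (nxt q)))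

    Extends : (Fin n → ℕ) → Fin n → Set
    Extends x v = Σ ℕ λ p → p < e × x v ≡ slt (c v) * e + p

    -- The second clause involves v and its neighbours of lower colour only, since `Ω` vanishes on
    -- the others; it is therefore preserved when higher colours choose.
    Good : (Fin n → ℕ) → Fin n → Set
    Good x v = Extends x v × e * ∑ V (λ u → Ω v u * eq (x v) (x u)) ≤ ∑ V (Ω v)

    extends-slt : ∀ x v u → Extends x v → Extends x u → x v ≡ x u → slt (c v) ≡ slt (c u)
    extends-slt x v u (p , p<e , xv) (q , q<e , xu) xv≡xu =
      proj₁ (*-+-unique e {slt (c v)} {slt (c u)} p<e q<e (trans (≡-sym xv) (trans xv≡xu xu)))

    Ω-later : ∀ v u k → aux (c v) ≤ aux (c u) → Ω v u * k ≡ 0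
    Ω-later v u k h rewrite lt-≮ (≤⇒≯ h) | *-zeroʳ (kernel (c v) (c u)) | *-zeroʳ (a v u) = refl

    -- A neighbour that has chosen has one last digit, hence is charged by at most one of the e
    -- candidates.
    best-avg : ∀ x v → (∀ u → aux (c u) < aux (c v) → Extends x u) →
      e * ∑ V (λ u → Ω v u * eq (slt (c v) * e + best x v) (x u)) ≤ ∑ V (Ω v)
    best-avg x v ext = begin
      e * ∑ V (λ u → Ω v u * eq (slt (c v) * e + best x v) (x u)) ≡⟨ cong (e *_) (f≡ (best x v)) ⟨
      e * f (best x v)       ≤⟨ argmin-avg e f ⟩
      ∑ (downFrom e) f       ≡⟨ ∑-cong (downFrom e) f≡ ⟩
      ∑ (downFrom e) (λ p → ∑ V (λ u → Ω v u * eq (slt (c v) * e + p) (x u)))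
        ≡⟨ ∑-swap (downFrom e) V _ ⟩
      ∑ V (λ u → ∑ (downFrom e) (λ p → Ω v u * eq (slt (c v) * e + p) (x u)))
        ≡⟨ ∑-cong V (λ u → ∑-*ˡ (downFrom e) (Ω v u) _) ⟩
      ∑ V (λ u → Ω v u * ∑ (downFrom e) (λ p → eq (slt (c v) * e + p) (x u)))
        ≤⟨ ∑-mono V once ⟩
      ∑ V (λ u → Ω v u) ∎
      where
      open ≤-Reasoning
      f : ℕ → ℕ
      f p = ∑ (received (withNxt x) v)
        (λ q → kernel (c v) q * lt (aux q) (aux (c v)) * eq (slt (c v) * e + p) (nxt q))
      f≡ : ∀ p → f p ≡ ∑ V (λ u → Ω v u * eq (slt (c v) * e + p) (x u))
      f≡ p = trans (∑-received (withNxt x) _ v) (∑-cong V (λ u → ≡-sym (*-assoc (a v u) _ _)))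
      once : ∀ u → Ω v u * ∑ (downFrom e) (λ p → eq (slt (c v) * e + p) (x u)) ≤ Ω v u
      once u with aux (c u) <? aux (c v)
      ... | no ¬h = ≤-trans (≤-reflexive (Ω-later v u _ (≮⇒≥ ¬h))) z≤n
      ... | yes h with ext u h
      ... | q , q<e , xu = ≤-trans (*-monoʳ-≤ (Ω v u) (≤-trans
              (∑-mono-∈ (downFrom e) (λ p p∈ → eq-mono {x′ = p} {y′ = q} (λ eqn →
                 proj₂ (*-+-unique e {slt (c v)} {slt (c u)} (∈-downFrom⁻ p∈) q<e (trans eqn xu)))))
              (∑-eq≤1 e q))) (≤-reflexive (*-identityʳ (Ω v u)))

    picks : ∀ m → Σ (Fin n → ℕ) λ x →
      exec G (loop m (pick e cap)) c ≗ withNxt x × (∀ v → aux (c v) < m → Good x v)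
    picks zero    = (λ v → nxt (c v)) , (λ v → refl) , (λ v ())
    picks (suc m) with picks m
    ... | x , h , good = x′ , exec-then (loop m (pick e cap)) (pick e cap m ∷ []) h shape , good′
      where
      x′ : Fin n → ℕ
      x′ v = ifEq (aux (c v)) m ((slt (c v) * e + best x v) ⊓ cap) (x v)
      shape : round G (pick e cap m) (withNxt x) ≗ withNxt x′
      shape v = refl
      now : ∀ v → aux (c v) ≡ m → x′ v ≡ slt (c v) * e + best x v
      now v h = trans (ifEq-≡ h) (m≤n⇒m⊓n≡m (≤-trans (+-monoʳ-≤ (slt (c v) * e) (<⇒≤ (argmin-< e _ 0<e))) (fits v)))
      old : ∀ v → aux (c v) ≢ m → x′ v ≡ x v
      old v ¬h = ifEq-≢ ¬h
      earlier : ∀ v k → aux (c v) ≤ m → ∑ V (λ u → Ω v u * eq k (x′ u)) ≡ ∑ V (λ u → Ω v u * eq k (x u))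
      earlier v k av = ∑-cong V same
        where
        same : ∀ u → Ω v u * eq k (x′ u) ≡ Ω v u * eq k (x u)
        same u with aux (c u) <? aux (c v)
        ... | no ¬h = trans (Ω-later v u _ (≮⇒≥ ¬h)) (≡-sym (Ω-later v u _ (≮⇒≥ ¬h)))
        ... | yes h = cong (λ y → Ω v u * eq k y) (old u (<⇒≢ (<-≤-trans h av)))
      good′ : ∀ v → aux (c v) < suc m → Good x′ v
      good′ v (s≤s av≤m) with m≤n⇒m<n∨m≡n av≤m
      ... | inj₁ av<m with good v av<m
      ...   | (p , p<e , xv) , bound =
              (p , p<e , trans (old v (<⇒≢ av<m)) xv) ,
              ≤-trans (≤-reflexive (cong (e *_) (trans (earlier v (x′ v) av≤m) (cong (λ y → ∑ V (λ u → Ω v u * eq y (x u))) (old v (<⇒≢ av<m)))))) bound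
      good′ v (s≤s av≤m) | inj₂ av≡m =
        (best x v , argmin-< e _ 0<e , now v av≡m) ,
        ≤-trans (≤-reflexive (cong (e *_) (trans (earlier v (x′ v) av≤m) (cong (λ y → ∑ V (λ u → Ω v u * eq y (x u))) (now v av≡m)))))
          (best-avg x v (λ u h → proj₁ (good u (<-≤-trans h av≤m))))

-- Refines the slots by a factor 2 e: two code shots produce few colours with little monochromatic
-- cost, then the colour classes choose the new digit of their slot one after the other.
stage : (e cap L₀ T₁ L₁ T₂ m : ℕ) → List Instr
stage e cap L₀ T₁ L₁ T₂ m =
  shot kernel clr L₀ T₁ ∷ shot kernel aux L₁ T₂ ∷ loop m (pick (2 * e) cap) ++ (commit ∷ [])

module Stage {n : ℕ} (G : Graph n) where
  open Local G

  record Proper (L : ℕ) (c : Config n) : Set where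
    field
      clr-<  : ∀ v → clr (c v) < 2 ^ L
      clr-≢ : ∀ v u → adj G v u ≡ true → clr (c v) ≢ clr (c u)
  open Proper public

  proper-mono : ∀ {L L′ c} → L ≤ L′ → Proper L c → Proper L′ c
  proper-mono h p = record { clr-< = λ v → <-≤-trans (clr-< p v) (^-monoʳ-≤ 2 h) ; clr-≢ = clr-≢ p }

  proper-clr : ∀ {L c} c′ → (∀ v → clr (c′ v) ≡ clr (c v)) → Proper L c → Proper L c′
  proper-clr {L} c′ h p = record
    { clr-< = λ v → subst (_< 2 ^ L) (≡-sym (h v)) (clr-< p v)
    ; clr-≢ = λ v u vu e → clr-≢ p v u vu (trans (≡-sym (h v)) (trans e (h u))) }

  a*-cong : ∀ v u {x y} → (adj G v u ≡ true → x ≡ y) → a v u * x ≡ a v u * y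
  a*-cong v u h with adj G v u
  ... | true  = cong (1 *_) (h refl)
  ... | false = refl

  -- Let S be the cost inside the old slots. Each of the two shots makes at most S/(4e)
  -- monochromatic, in total S/(2e). A pair of different colours is charged to the end that chooses
  -- later, whose choice among 2e digits keeps at most a share 1/(2e). The sum is at most S/e, which
  -- is why the base is 2e for a gain of e.
  stage-spec : ∀ e cap L₀ T₁ L₁ T₂ m (c : Config n) → 0 < e → 0 < T₁ → 0 < T₂ → Proper L₀ c → (∀ v → slt (c v) * (2 * e) + 2 * e ≤ cap) →
    T₁ * (2 * T₁) ≤ 2 ^ L₁ → T₂ * (2 * T₂) ≤ m →
    4 * e * (1 + 2 * L₀) ≤ T₁ → 4 * e * (1 + 2 * L₁) ≤ T₂ →
    let ω = λ v → wgt (c v) ; X = λ v → frc (c v) in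
    Σ (Fin n → ℕ) λ y → Σ (Fin n → ℕ) λ x →
      exec G (stage e cap L₀ T₁ L₁ T₂ m) c ≗ (λ v → record (c v) { aux = y v ; nxt = x v ; slt = x v }) ×
      (∀ v → Σ ℕ λ p → p < 2 * e × x v ≡ slt (c v) * (2 * e) + p) ×
      e * mono ω X x ≤ mono ω X (λ v → slt (c v))
  stage-spec e cap L₀ T₁ L₁ T₂ m c 0<e 0<T₁ 0<T₂ prop fits m₁ m₂ t₁ t₂ = A₂ , x , shape , (λ v → proj₁ (good v)) , final
    where
    open ≤-Reasoning
    c₁ c₂ : Config n
    c₁ = round G (shot kernel clr L₀ T₁) c
    c₂ = round G (shot kernel aux L₁ T₂) c₁
    A₁ A₂ ω X s : Fin n → ℕ
    A₁ v = aux (c₁ v)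
    A₂ v = aux (c₂ v)
    ω v = wgt (c v)
    X v = frc (c v)
    s v = slt (c v)
    module P = Pick (2 * e) cap (≤-trans 0<e (m≤m+n e _)) c₂ fits
    x : Fin n → ℕ
    x = proj₁ (P.picks m)
    shape : exec G (stage e cap L₀ T₁ L₁ T₂ m) c ≗ (λ v → record (c v) { aux = A₂ v ; nxt = x v ; slt = x v })
    shape = exec-then (loop m (pick (2 * e) cap)) (commit ∷ []) (proj₁ (proj₂ (P.picks m))) (λ v → refl)
    good : ∀ v → P.Good x v
    good v = proj₂ (proj₂ (P.picks m)) v (<-≤-trans (shot-< kernel aux L₁ T₂ (c₁ v) (received c₁ v) 0<T₂) m₂)
    Ω : Fin n → Fin n → ℕ
    Ω v u = a v u * kernel (c v) (c u)
    Ω≡ : ∀ v u → Ω v u ≡ cost ω X v u * eq (s v) (s u)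
    Ω≡ v u = ≡-sym (*-assoc (a v u) _ _)
    Ω-sym : ∀ v u → Ω v u ≡ Ω u v
    Ω-sym v u = trans (Ω≡ v u) (trans (cong₂ _*_ (cost-sym ω X v u) (eq-sym (s v) (s u))) (≡-sym (Ω≡ u v)))
    S M₁ M₂ P Q : ℕ
    S  = ∑∑ Ω
    M₁ = ∑∑ (λ v u → Ω v u * eq (A₁ v) (A₁ u))
    M₂ = ∑∑ (λ v u → Ω v u * eq (A₂ v) (A₂ u))
    P  = ∑∑ (λ v u → Ω v u * lt (A₂ u) (A₂ v))
    Q  = ∑∑ (λ v u → Ω v u * lt (A₂ u) (A₂ v) * eq (x v) (x u))
    r₁ r₂ : ℕ
    r₁ = 1 + 2 * L₀
    r₂ = 1 + 2 * L₁

    shot₁ : T₁ * M₁ ≤ r₁ * S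
    shot₁ = begin
      T₁ * M₁ ≡⟨ ∑-*ˡ V T₁ _ ⟨
      ∑ V (λ v → T₁ * ∑ V (λ u → Ω v u * eq (A₁ v) (A₁ u)))
        ≤⟨ ∑-mono V (shot-conflict kernel clr L₀ T₁ c 0<T₁ (λ _ → refl) (clr-< prop)) ⟩
      ∑∑ (λ v u → Ω v u * (T₁ * eq (clr (c v)) (clr (c u)) + r₁))
        ≡⟨ ∑∑-cong (λ v u → trans (*-assoc (a v u) _ _) (trans (a*-cong v u (λ h →
             trans (cong (λ z → kernel (c v) (c u) * (T₁ * z + r₁)) (eq-≢ (clr-≢ prop v u h)))
               (cong (λ z → kernel (c v) (c u) * (z + r₁)) (*-zeroʳ T₁))))
             (trans (≡-sym (*-assoc (a v u) _ _)) (*-comm (Ω v u) r₁)))) ⟩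
      ∑∑ (λ v u → r₁ * Ω v u) ≡⟨ ∑∑-*ˡ r₁ Ω ⟩
      r₁ * S ∎

    shot₁′ : 4 * e * M₁ ≤ S
    shot₁′ = *-cancelˡ-≤ r₁ (begin
      r₁ * (4 * e * M₁)  ≡⟨ *-assoc r₁ (4 * e) M₁ ⟨
      r₁ * (4 * e) * M₁  ≡⟨ cong (_* M₁) (*-comm r₁ (4 * e)) ⟩
      4 * e * r₁ * M₁    ≤⟨ *-monoˡ-≤ M₁ t₁ ⟩
      T₁ * M₁            ≤⟨ shot₁ ⟩
      r₁ * S ∎)

    shot₂ : T₂ * M₂ ≤ T₂ * M₁ + r₂ * S
    shot₂ = begin
      T₂ * M₂ ≡⟨ ∑-*ˡ V T₂ _ ⟨
      ∑ V (λ v → T₂ * ∑ V (λ u → Ω v u * eq (A₂ v) (A₂ u)))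
        ≤⟨ ∑-mono V (shot-conflict kernel aux L₁ T₂ c₁ 0<T₂ (λ _ → refl)
             (λ v → <-≤-trans (shot-< kernel clr L₀ T₁ (c v) (received c v) 0<T₁) m₁)) ⟩
      ∑∑ (λ v u → Ω v u * (T₂ * eq (A₁ v) (A₁ u) + r₂))
        ≡⟨ ∑∑-cong (λ v u → e₁ (Ω v u) T₂ (eq (A₁ v) (A₁ u)) r₂) ⟩
      ∑∑ (λ v u → T₂ * (Ω v u * eq (A₁ v) (A₁ u)) + r₂ * Ω v u)
        ≡⟨ trans (∑∑-+ _ _) (cong₂ _+_ (∑∑-*ˡ T₂ _) (∑∑-*ˡ r₂ Ω)) ⟩
      T₂ * M₁ + r₂ * S ∎
      where
      e₁ : ∀ o t q r → o * (t * q + r) ≡ t * (o * q) + r * o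
      e₁ = solve-∀

    shot₂′ : 2 * e * M₂ ≤ S
    shot₂′ = *-cancelˡ-≤ (2 * T₂) {{m*n≢0 2 T₂ {{_}} {{>-nonZero 0<T₂}}}} (begin
      2 * T₂ * (2 * e * M₂)             ≡⟨ e₁ T₂ e M₂ ⟩
      4 * e * (T₂ * M₂)                 ≤⟨ *-monoʳ-≤ (4 * e) shot₂ ⟩
      4 * e * (T₂ * M₁ + r₂ * S)        ≡⟨ e₂ (4 * e) T₂ M₁ r₂ S ⟩
      T₂ * (4 * e * M₁) + 4 * e * r₂ * S ≤⟨ +-mono-≤ (*-monoʳ-≤ T₂ shot₁′) (*-monoˡ-≤ S t₂) ⟩
      T₂ * S + T₂ * S                   ≡⟨ e₃ T₂ S ⟩
      2 * T₂ * S ∎)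
      where
      e₁ : ∀ t e m → 2 * t * (2 * e * m) ≡ 4 * e * (t * m)
      e₁ = solve-∀
      e₂ : ∀ q t m r s → q * (t * m + r * s) ≡ t * (q * m) + q * r * s
      e₂ = solve-∀
      e₃ : ∀ t s → t * s + t * s ≡ 2 * t * s
      e₃ = solve-∀

    picked : 2 * e * Q ≤ P
    picked = begin
      2 * e * Q ≡⟨ cong (2 * e *_) (∑∑-cong (λ v u → cong (_* eq (x v) (x u)) (*-assoc (a v u) _ _))) ⟩
      2 * e * ∑∑ (λ v u → P.Ω v u * eq (x v) (x u)) ≡⟨ ∑-*ˡ V (2 * e) _ ⟨
      ∑ V (λ v → 2 * e * ∑ V (λ u → P.Ω v u * eq (x v) (x u))) ≤⟨ ∑-mono V (λ v → proj₂ (good v)) ⟩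
      ∑∑ P.Ω ≡⟨ ∑∑-cong (λ v u → *-assoc (a v u) _ _) ⟨
      P ∎

    split : S ≡ M₂ + (P + P)
    split = begin-equality
      S ≡⟨ ∑∑-cong (λ v u → trans (≡-sym (*-identityʳ (Ω v u))) (cong (Ω v u *_) (≡-sym (trichotomy (A₂ v) (A₂ u))))) ⟩
      ∑∑ (λ v u → Ω v u * (eq (A₂ v) (A₂ u) + (lt (A₂ v) (A₂ u) + lt (A₂ u) (A₂ v))))
        ≡⟨ ∑∑-cong (λ v u → e₁ (Ω v u) _ _ _) ⟩
      ∑∑ (λ v u → Ω v u * eq (A₂ v) (A₂ u) + (Ω v u * lt (A₂ v) (A₂ u) + Ω v u * lt (A₂ u) (A₂ v)))
        ≡⟨ trans (∑∑-+ _ _) (cong (M₂ +_) (∑∑-+ _ _)) ⟩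
      M₂ + (∑∑ (λ v u → Ω v u * lt (A₂ v) (A₂ u)) + P)
        ≡⟨ cong (λ z → M₂ + (z + P)) (trans (∑∑-cong (λ v u → cong (_* lt (A₂ v) (A₂ u)) (Ω-sym v u))) (∑∑-transpose _)) ⟩
      M₂ + (P + P) ∎
      where
      e₁ : ∀ o x y z → o * (x + (y + z)) ≡ o * x + (o * y + o * z)
      e₁ = solve-∀

    eq-x-slot : ∀ v u → eq (x v) (x u) ≤ eq (s v) (s u) * eq (x v) (x u)
    eq-x-slot v u with x v ≟ x u
    ... | no h  = ≤-trans (≤-reflexive (eq-≢ h)) z≤n
    ... | yes h rewrite eq-≡ (P.extends-slt x v u (proj₁ (good v)) (proj₁ (good u)) h) = ≤-reflexive (≡-sym (+-identityʳ _))

    pointwise : ∀ v u → cost ω X v u * eq (x v) (x u) ≤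
      Ω v u * eq (A₂ v) (A₂ u) + (Ω v u * lt (A₂ v) (A₂ u) * eq (x v) (x u) + Ω v u * lt (A₂ u) (A₂ v) * eq (x v) (x u))
    pointwise v u = begin
      cost ω X v u * E                  ≤⟨ *-monoʳ-≤ (cost ω X v u) (eq-x-slot v u) ⟩
      cost ω X v u * (eq (s v) (s u) * E) ≡⟨ trans (≡-sym (*-assoc (cost ω X v u) _ _)) (cong (_* E) (≡-sym (Ω≡ v u))) ⟩
      Ω v u * E                         ≡⟨ trans (≡-sym (*-identityʳ _)) (cong (Ω v u * E *_) (≡-sym (trichotomy (A₂ v) (A₂ u)))) ⟩
      Ω v u * E * (p + (q + r))         ≡⟨ e₁ (Ω v u) E p q r ⟩
      Ω v u * p * E + (Ω v u * q * E + Ω v u * r * E)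
        ≤⟨ +-monoˡ-≤ _ (≤-trans (*-monoʳ-≤ (Ω v u * p) (eq≤1 (x v) (x u))) (≤-reflexive (*-identityʳ (Ω v u * p)))) ⟩
      Ω v u * p + (Ω v u * q * E + Ω v u * r * E) ∎
      where
      E = eq (x v) (x u)
      p = eq (A₂ v) (A₂ u)
      q = lt (A₂ v) (A₂ u)
      r = lt (A₂ u) (A₂ v)
      e₁ : ∀ o e p q r → o * e * (p + (q + r)) ≡ o * p * e + (o * q * e + o * r * e)
      e₁ = solve-∀

    final : e * mono ω X x ≤ mono ω X s
    final = *-cancelˡ-≤ 2 (begin
      2 * (e * mono ω X x)    ≡⟨ *-assoc 2 e _ ⟨
      2 * e * mono ω X x      ≤⟨ *-monoʳ-≤ (2 * e) (∑∑-mono pointwise) ⟩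
      2 * e * ∑∑ _            ≡⟨ cong (2 * e *_) (trans (∑∑-+ _ _) (cong (M₂ +_) (∑∑-+ _ _))) ⟩
      2 * e * (M₂ + (∑∑ (λ v u → Ω v u * lt (A₂ v) (A₂ u) * eq (x v) (x u)) + Q))
        ≡⟨ cong (λ z → 2 * e * (M₂ + (z + Q))) (trans (∑∑-cong (λ v u → cong₂ _*_ (cong (_* lt (A₂ v) (A₂ u)) (Ω-sym v u)) (eq-sym (x v) (x u)))) (∑∑-transpose _)) ⟩
      2 * e * (M₂ + (Q + Q))  ≡⟨ e₁ (2 * e) M₂ Q ⟩
      2 * e * M₂ + (2 * e * Q + 2 * e * Q) ≤⟨ +-mono-≤ shot₂′ (+-mono-≤ picked picked) ⟩
      S + (P + P)             ≤⟨ +-monoʳ-≤ S (≤-trans (m≤n+m (P + P) M₂) (≤-reflexive (≡-sym split))) ⟩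
      S + S                   ≡⟨ e₂ S ⟩
      2 * S                   ≡⟨ cong (2 *_) (∑∑-cong Ω≡) ⟩
      2 * mono ω X s ∎)
      where
      e₁ : ∀ e m q → e * (m + (q + q)) ≡ e * m + (e * q + e * q)
      e₁ = solve-∀
      e₂ : ∀ s → s + s ≡ 2 * s
      e₂ = solve-∀

-- Rounding

opaque
  ifLe : {A : Set} → ℕ → ℕ → A → A → A
  ifLe x y p q with x ≤? y
  ... | yes _ = p
  ... | no  _ = q

  ifLe-yes : ∀ {A : Set} {x y} {p q : A} → x ≤ y → ifLe x y p q ≡ p
  ifLe-yes {x = x} {y} h with x ≤? y
  ... | yes _ = refl
  ... | no ¬h = ⊥-elim (¬h h)

  ifLe-no : ∀ {A : Set} {x y} {p q : A} → x ≰ y → ifLe x y p q ≡ q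
  ifLe-no {x = x} {y} ¬h with x ≤? y
  ... | yes h = ⊥-elim (¬h h)
  ... | no _  = refl

ifLe-cases : ∀ {A : Set} x y (p q : A) → (x ≤ y × ifLe x y p q ≡ p) ⊎ (y < x × ifLe x y p q ≡ q)
ifLe-cases x y p q with x ≤? y
... | yes h = inj₁ (h , ifLe-yes h)
... | no ¬h = inj₂ (≰⇒> ¬h , ifLe-no ¬h)

oddPart : ℕ → ℕ
oddPart x = 𝟙ᵇ (odd x)

2*⌈n/2⌉≡ : ∀ n → 2 * ⌈ n /2⌉ ≡ n + oddPart n
2*⌈n/2⌉≡ zero          = refl
2*⌈n/2⌉≡ (suc zero)    = refl
2*⌈n/2⌉≡ (suc (suc n)) = trans (*-suc 2 ⌈ n /2⌉) (cong (2 +_) (2*⌈n/2⌉≡ n))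

oddPart≤ : ∀ n → oddPart n ≤ n
oddPart≤ zero          = z≤n
oddPart≤ (suc zero)    = s≤s z≤n
oddPart≤ (suc (suc n)) = ≤-trans (oddPart≤ n) (m≤n+m n 2)

⌊2*n/2⌋≡n : ∀ n → ⌊ 2 * n /2⌋ ≡ n
⌊2*n/2⌋≡n zero    = refl
⌊2*n/2⌋≡n (suc n) = trans (cong ⌊_/2⌋ (*-suc 2 n)) (cong suc (⌊2*n/2⌋≡n n))

⌈n/2⌉≤ : ∀ n m → n ≤ 2 * m → ⌈ n /2⌉ ≤ m
⌈n/2⌉≤ n m h = ≤-trans (⌈n/2⌉-mono h) (≤-reflexive (lem m))
  where
  lem : ∀ m → ⌈ 2 * m /2⌉ ≡ m
  lem zero    = refl
  lem (suc m) = trans (cong ⌈_/2⌉ (*-suc 2 m)) (cong suc (lem m))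

-- The rounding decision compares the derivatives of the utility and of the cost at the current point.
turn : (A B i : ℕ) → Instr
turn A B i d ds = record d { frc = ifEq (slt d) i
  (ifLe (B * ∑ ds (λ q → (wgt d ⊓ wgt q) * frc q)) (A * wgt d) (2 * ⌈ frc d /2⌉) (2 * ⌊ frc d /2⌋))
  (frc d) }

module Rounding {n : ℕ} (G : Graph n) where
  open Local G
  open Stage G

  module Quadratic (ω : Fin n → ℕ) where

    κ : Fin n → Fin n → ℕ
    κ v u = a v u * (ω v ⊓ ω u)

    κ-sym : ∀ v u → κ v u ≡ κ u v
    κ-sym v u = cong₂ _*_ (a-sym v u) (⊓-comm (ω v) (ω u))

    U : (Fin n → ℕ) → ℕ
    U f = ∑ V (λ v → ω v * f v)

    -- The symmetric bilinear form of the cost: `b f f` is `total ω f`, so the effect of a move on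
    -- the cost can be expanded exactly.
    b : (Fin n → ℕ) → (Fin n → ℕ) → ℕ
    b f g = ∑ V (λ v → f v * ∑ V (λ u → κ v u * g u))

    b-∑∑ : ∀ f g → b f g ≡ ∑∑ (λ v u → κ v u * (f v * g u))
    b-∑∑ f g = ∑-cong V (λ v → trans (≡-sym (∑-*ˡ V (f v) _)) (∑-cong V (λ u → *-swapˡ (f v) (κ v u) (g u))))

    b-total : ∀ f → b f f ≡ total ω f
    b-total f = trans (b-∑∑ f f) (∑∑-cong (λ v u → *-assoc (a v u) _ _))

    b-sym : ∀ f g → b f g ≡ b g f
    b-sym f g = trans (b-∑∑ f g) (trans (≡-sym (∑∑-transpose _)) (trans
      (∑∑-cong (λ v u → cong₂ _*_ (κ-sym u v) (*-comm (f u) (g v)))) (≡-sym (b-∑∑ g f))))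

    b-+ˡ : ∀ f g h → b (λ v → f v + g v) h ≡ b f h + b g h
    b-+ˡ f g h = trans (∑-cong V (λ v → *-distribʳ-+ _ (f v) (g v))) (∑-+ V _ _)

    b-+ʳ : ∀ f g h → b f (λ v → g v + h v) ≡ b f g + b f h
    b-+ʳ f g h = trans (b-sym f _) (trans (b-+ˡ g h f) (cong₂ _+_ (b-sym g f) (b-sym h f)))

    b-cong : ∀ {f f′ g g′} → (∀ v → f v ≡ f′ v) → (∀ v → g v ≡ g′ v) → b f g ≡ b f′ g′
    b-cong h k = ∑-cong V (λ v → cong₂ _*_ (h v) (∑-cong V (λ u → cong (κ v u *_) (k u))))

    b-square : ∀ f g → b (λ v → f v + g v) (λ v → f v + g v) ≡ b f f + 2 * b f g + b g g
    b-square f g = trans (b-+ˡ f g _) (trans (cong₂ _+_ (b-+ʳ f f g) (b-+ʳ g f g))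
      (trans (cong (λ z → b f f + b f g + (z + b g g)) (b-sym g f)) (lem (b f f) (b f g) (b g g))))
      where
      lem : ∀ x y z → x + y + (y + z) ≡ x + 2 * y + z
      lem = solve-∀

    U-+ : ∀ f g → U (λ v → f v + g v) ≡ U f + U g
    U-+ f g = trans (∑-cong V (λ v → *-distribˡ-+ (ω v) (f v) (g v))) (∑-+ V _ _)

    U-cong : ∀ {f g} → (∀ v → f v ≡ g v) → U f ≡ U g
    U-cong h = ∑-cong V (λ v → cong (ω v *_) (h v))

    -- The second-order expansion of 2A U - B b at `X` along `p - m`. The linear terms have the
    -- right sign by the two assumptions on the derivative, and the quadratic term is at most b(p,p)
    -- + b(m,m) because the mixed term is negative. The move is split into increases `p` and
    -- decreases `m` to remain in ℕ.
    move : ∀ (A B : ℕ) (X X′ p m : Fin n → ℕ) → (∀ v → X′ v + m v ≡ X v + p v) →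
      (∀ v → p v * (B * ∑ V (λ u → κ v u * X u)) ≤ p v * (A * ω v)) →
      (∀ v → m v * (A * ω v) ≤ m v * (B * ∑ V (λ u → κ v u * X u))) →
      2 * A * U X + B * b X′ X′ ≤ 2 * A * U X′ + B * (b X X + (b p p + b m m))
    move A B X X′ p m eqn up down = +-cancelʳ-≤ (2 * (A * U m)) _ _ (begin
      2 * A * U X + B * b X′ X′ + 2 * (A * U m)
        ≤⟨ +-monoʳ-≤ (2 * A * U X + B * b X′ X′) (*-monoʳ-≤ 2 down′) ⟩
      2 * A * U X + B * b X′ X′ + 2 * (B * b m X)
        ≡⟨ e₁ A B (U X) (b X′ X′) (b m X) ⟩
      2 * A * U X + B * (b X′ X′ + 2 * b m X)
        ≤⟨ +-monoʳ-≤ (2 * A * U X) (*-monoʳ-≤ B quad) ⟩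
      2 * A * U X + B * (b X X + 2 * b p X + (b p p + b m m))
        ≡⟨ e₂ A B (U X) (b X X) (b p X) (b p p + b m m) ⟩
      2 * A * U X + 2 * (B * b p X) + B * (b X X + (b p p + b m m))
        ≤⟨ +-monoˡ-≤ _ (+-monoʳ-≤ (2 * A * U X) (*-monoʳ-≤ 2 up′)) ⟩
      2 * A * U X + 2 * (A * U p) + B * (b X X + (b p p + b m m))
        ≡⟨ cong (_+ B * (b X X + (b p p + b m m))) (trans (e₃ A (U X) (U p)) (trans (cong (2 * A *_) (≡-sym lin)) (≡-sym (e₃ A (U X′) (U m))))) ⟩
      2 * A * U X′ + 2 * (A * U m) + B * (b X X + (b p p + b m m))
        ≡⟨ e₄ (2 * A * U X′) (2 * (A * U m)) _ ⟩
      2 * A * U X′ + B * (b X X + (b p p + b m m)) + 2 * (A * U m) ∎)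
      where
      open ≤-Reasoning
      e₁ : ∀ A B u x y → 2 * A * u + B * x + 2 * (B * y) ≡ 2 * A * u + B * (x + 2 * y)
      e₁ = solve-∀
      e₂ : ∀ A B u x y l → 2 * A * u + B * (x + 2 * y + l) ≡ 2 * A * u + 2 * (B * y) + B * (x + l)
      e₂ = solve-∀
      e₃ : ∀ A x y → 2 * A * x + 2 * (A * y) ≡ 2 * A * (x + y)
      e₃ = solve-∀
      e₄ : ∀ x y z → x + y + z ≡ x + z + y
      e₄ = solve-∀
      e₅ : ∀ x y z → x + 2 * (y + z) ≡ x + 2 * y + z + z
      e₅ = solve-∀
      e₆ : ∀ x y z t → x + 2 * y + z + t ≡ x + 2 * y + (z + t)
      e₆ = solve-∀
      e₇ : ∀ x y z → x + 2 * y + 2 * z ≡ x + 2 * (y + z)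
      e₇ = solve-∀
      pull : ∀ (k : ℕ) (f : Fin n → ℕ) → ∑ V (λ v → f v * (k * ω v)) ≡ k * U f
      pull k f = trans (∑-cong V (λ v → trans (*-swapˡ (f v) k (ω v)) (cong (k *_) (*-comm (f v) (ω v))))) (∑-*ˡ V k _)
      pullb : ∀ (k : ℕ) (f g : Fin n → ℕ) → ∑ V (λ v → f v * (k * ∑ V (λ u → κ v u * g u))) ≡ k * b f g
      pullb k f g = trans (∑-cong V (λ v → *-swapˡ (f v) k _)) (∑-*ˡ V k _)
      up′ : B * b p X ≤ A * U p
      up′ = subst₂ _≤_ (pullb B p X) (pull A p) (∑-mono V up)
      down′ : A * U m ≤ B * b m X
      down′ = subst₂ _≤_ (pull A m) (pullb B m X) (∑-mono V down)
      lin : U X′ + U m ≡ U X + U p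
      lin = trans (≡-sym (U-+ X′ m)) (trans (U-cong eqn) (U-+ X p))
      cross : b X′ m + b m m ≡ b X m + b p m
      cross = trans (≡-sym (b-+ˡ X′ m m)) (trans (b-cong eqn (λ _ → refl)) (b-+ˡ X p m))
      square : b X′ X′ + 2 * b X′ m + b m m ≡ b X X + 2 * b X p + b p p
      square = trans (≡-sym (b-square X′ m)) (trans (b-cong eqn eqn) (b-square X p))
      quad : b X′ X′ + 2 * b m X ≤ b X X + 2 * b p X + (b p p + b m m)
      quad = begin
        b X′ X′ + 2 * b m X             ≡⟨ cong (λ z → b X′ X′ + 2 * z) (b-sym m X) ⟩
        b X′ X′ + 2 * b X m             ≤⟨ m≤m+n _ (2 * b p m) ⟩
        b X′ X′ + 2 * b X m + 2 * b p m ≡⟨ e₇ (b X′ X′) (b X m) (b p m) ⟩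
        b X′ X′ + 2 * (b X m + b p m)   ≡⟨ cong (λ z → b X′ X′ + 2 * z) cross ⟨
        b X′ X′ + 2 * (b X′ m + b m m)  ≡⟨ e₅ (b X′ X′) (b X′ m) (b m m) ⟩
        b X′ X′ + 2 * b X′ m + b m m + b m m ≡⟨ cong (_+ b m m) square ⟩
        b X X + 2 * b X p + b p p + b m m ≡⟨ e₆ (b X X) (b X p) (b p p) (b m m) ⟩
        b X X + 2 * b X p + (b p p + b m m) ≡⟨ cong (λ z → b X X + 2 * z + (b p p + b m m)) (b-sym X p) ⟩
        b X X + 2 * b p X + (b p p + b m m) ∎

  module Turns (A B : ℕ) (c : Config n) where
    open ≤-Reasoning

    ω s X₀ : Fin n → ℕ
    ω v = wgt (c v)
    s v = slt (c v)
    X₀ v = frc (c v)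

    open Quadratic ω

    withFrc : (Fin n → ℕ) → Config n
    withFrc X v = record (c v) { frc = X v }

    slope : (Fin n → ℕ) → Fin n → ℕ
    slope X v = B * ∑ (received (withFrc X) v) (λ q → (ω v ⊓ wgt q) * frc q)

    slope≡ : ∀ X v → slope X v ≡ B * ∑ V (λ u → κ v u * X u)
    slope≡ X v = cong (B *_) (trans (∑-received (withFrc X) _ v) (∑-cong V (λ u → ≡-sym (*-assoc (a v u) _ _))))

    Rounded : Fin n → ℕ → Set
    Rounded v x = x ≡ 2 * ⌈ X₀ v /2⌉ ⊎ x ≡ 2 * ⌊ X₀ v /2⌋

    lossBelow : ℕ → ℕ
    lossBelow m = ∑∑ (λ v u → cost ω X₀ v u * eq (s v) (s u) * lt (s v) m)

    lossAt : ℕ → ℕ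
    lossAt i = ∑∑ (λ v u → cost ω X₀ v u * eq (s v) (s u) * eq (s v) i)

    lossBelow-suc : ∀ m → lossBelow (suc m) ≡ lossBelow m + lossAt m
    lossBelow-suc m = trans (∑∑-cong (λ v u → trans (cong (cost ω X₀ v u * eq (s v) (s u) *_) (lt-suc (s v) m))
      (*-distribˡ-+ (cost ω X₀ v u * eq (s v) (s u)) _ _))) (∑∑-+ _ _)

    Balanced : (Fin n → ℕ) → ℕ → Set
    Balanced X loss = 2 * A * U X₀ + B * total ω X ≤ 2 * A * U X + B * (total ω X₀ + loss)

    record Turned (m : ℕ) (X : Fin n → ℕ) : Set where
      field
        shape   : exec G (loop m (turn A B)) c ≗ withFrc X
        waiting : ∀ v → m ≤ s v → X v ≡ X₀ v
        rounded : ∀ v → s v < m → Rounded v (X v)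
        balance : Balanced X (lossBelow m)

    -- A value changes by its last binary digit, which is at most the initial value `X₀ v`, and only
    -- in slot i. Hence the quadratic loss is at most the initial cost inside this slot, however far
    -- the other slots have been rounded.
    turn-step : ∀ i X → (∀ v → s v ≡ i → X v ≡ X₀ v) → Σ (Fin n → ℕ) λ X′ →
      round G (turn A B i) (withFrc X) ≗ withFrc X′ ×
      (∀ v → s v ≢ i → X′ v ≡ X v) × (∀ v → s v ≡ i → Rounded v (X′ v)) ×
      2 * A * U X + B * total ω X′ ≤ 2 * A * U X′ + B * (total ω X + lossAt i)
    turn-step i X same = X′ , (λ v → refl) , (λ v → ifEq-≢) , turned , (begin
      2 * A * U X + B * total ω X′  ≡⟨ cong (λ z → 2 * A * U X + B * z) (b-total X′) ⟨
      2 * A * U X + B * b X′ X′     ≤⟨ move A B X X′ p m balance up down ⟩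
      2 * A * U X′ + B * (b X X + (b p p + b m m))
        ≤⟨ +-monoʳ-≤ (2 * A * U X′) (*-monoʳ-≤ B (+-mono-≤ (≤-reflexive (b-total X)) loss)) ⟩
      2 * A * U X′ + B * (total ω X + lossAt i) ∎)
      where
      go : Fin n → ℕ
      go v = ifLe (slope X v) (A * ω v) (2 * ⌈ X v /2⌉) (2 * ⌊ X v /2⌋)
      X′ p m : Fin n → ℕ
      X′ v = ifEq (s v) i (go v) (X v)
      p v = ifEq (s v) i (ifLe (slope X v) (A * ω v) (oddPart (X v)) 0) 0
      m v = ifEq (s v) i (ifLe (slope X v) (A * ω v) 0 (oddPart (X v))) 0

      turned : ∀ v → s v ≡ i → Rounded v (X′ v)
      turned v h with ifLe-cases (slope X v) (A * ω v) (2 * ⌈ X v /2⌉) (2 * ⌊ X v /2⌋)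
      ... | inj₁ (_ , e) = inj₁ (trans (ifEq-≡ h) (trans e (cong (λ x → 2 * ⌈ x /2⌉) (same v h))))
      ... | inj₂ (_ , e) = inj₂ (trans (ifEq-≡ h) (trans e (cong (λ x → 2 * ⌊ x /2⌋) (same v h))))

      record Facts (v : Fin n) (x y z : ℕ) : Set where
        field
          bal   : x + z ≡ X v + y
          upF   : y * slope X v ≤ y * (A * ω v)
          downF : z * (A * ω v) ≤ z * slope X v
          small : y + z ≤ X₀ v * eq (s v) i

      transport : ∀ {v x y z x′ y′ z′} → x ≡ x′ → y ≡ y′ → z ≡ z′ → Facts v x′ y′ z′ → Facts v x y z
      transport refl refl refl f = f

      odd-small : ∀ v → s v ≡ i → oddPart (X v) ≤ X₀ v * eq (s v) i
      odd-small v h = begin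
        oddPart (X v)       ≤⟨ oddPart≤ (X v) ⟩
        X v                 ≡⟨ same v h ⟩
        X₀ v                ≡⟨ *-identityʳ (X₀ v) ⟨
        X₀ v * 1            ≡⟨ cong (X₀ v *_) (eq-≡ h) ⟨
        X₀ v * eq (s v) i ∎

      facts : ∀ v → Facts v (X′ v) (p v) (m v)
      facts v with s v ≟ i
      ... | no h = transport (ifEq-≢ h) (ifEq-≢ h) (ifEq-≢ h) (record { bal = refl ; upF = z≤n ; downF = z≤n ; small = z≤n })
      ... | yes h with slope X v ≤? A * ω v
      ... | yes le = transport (trans (ifEq-≡ h) (ifLe-yes le)) (trans (ifEq-≡ h) (ifLe-yes le)) (trans (ifEq-≡ h) (ifLe-yes le))
                (record { bal = trans (+-identityʳ _) (2*⌈n/2⌉≡ (X v)) ; upF = *-monoʳ-≤ (oddPart (X v)) le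
                        ; downF = z≤n ; small = ≤-trans (≤-reflexive (+-identityʳ _)) (odd-small v h) })
      ... | no ¬le = transport (trans (ifEq-≡ h) (ifLe-no ¬le)) (trans (ifEq-≡ h) (ifLe-no ¬le)) (trans (ifEq-≡ h) (ifLe-no ¬le))
                (record { bal = trans (+-comm _ (oddPart (X v))) (trans (odd+2*⌊n/2⌋ (X v)) (≡-sym (+-identityʳ _))) ; upF = z≤n
                        ; downF = *-monoʳ-≤ (oddPart (X v)) (<⇒≤ (≰⇒> ¬le)) ; small = odd-small v h })

      balance : ∀ v → X′ v + m v ≡ X v + p v
      balance v = Facts.bal (facts v)
      up : ∀ v → p v * (B * ∑ V (λ u → κ v u * X u)) ≤ p v * (A * ω v)
      up v = subst (λ z → p v * z ≤ p v * (A * ω v)) (slope≡ X v) (Facts.upF (facts v))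
      down : ∀ v → m v * (A * ω v) ≤ m v * (B * ∑ V (λ u → κ v u * X u))
      down v = subst (λ z → m v * (A * ω v) ≤ m v * z) (slope≡ X v) (Facts.downF (facts v))

      loss : b p p + b m m ≤ lossAt i
      loss = begin
        b p p + b m m ≡⟨ cong₂ _+_ (b-∑∑ p p) (b-∑∑ m m) ⟩
        ∑∑ (λ v u → κ v u * (p v * p u)) + ∑∑ (λ v u → κ v u * (m v * m u)) ≡⟨ ∑∑-+ _ _ ⟨
        ∑∑ (λ v u → κ v u * (p v * p u) + κ v u * (m v * m u)) ≤⟨ ∑∑-mono pointwise ⟩
        lossAt i ∎
        where
        e₁ : ∀ k p q m r → k * (p * q) + k * (m * r) + k * (p * r + m * q) ≡ k * ((p + m) * (q + r))
        e₁ = solve-∀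
        e₂ : ∀ a k x y e f → a * k * (x * e * (y * f)) ≡ a * (k * (x * y)) * (e * f)
        e₂ = solve-∀
        pointwise : ∀ v u → κ v u * (p v * p u) + κ v u * (m v * m u) ≤ cost ω X₀ v u * eq (s v) (s u) * eq (s v) i
        pointwise v u = begin
          κ v u * (p v * p u) + κ v u * (m v * m u)
            ≤⟨ m≤m+n _ (κ v u * (p v * m u + m v * p u)) ⟩
          κ v u * (p v * p u) + κ v u * (m v * m u) + κ v u * (p v * m u + m v * p u)
            ≡⟨ e₁ (κ v u) (p v) (p u) (m v) (m u) ⟩
          κ v u * ((p v + m v) * (p u + m u))
            ≤⟨ *-monoʳ-≤ (κ v u) (*-mono-≤ (Facts.small (facts v)) (Facts.small (facts u))) ⟩
          κ v u * (X₀ v * eq (s v) i * (X₀ u * eq (s u) i))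
            ≡⟨ e₂ (a v u) (ω v ⊓ ω u) (X₀ v) (X₀ u) (eq (s v) i) (eq (s u) i) ⟩
          cost ω X₀ v u * (eq (s v) i * eq (s u) i)
            ≤⟨ *-monoʳ-≤ (cost ω X₀ v u) both ⟩
          cost ω X₀ v u * (eq (s v) (s u) * eq (s v) i)
            ≡⟨ *-assoc (cost ω X₀ v u) _ _ ⟨
          cost ω X₀ v u * eq (s v) (s u) * eq (s v) i ∎
          where
          both : eq (s v) i * eq (s u) i ≤ eq (s v) (s u) * eq (s v) i
          both with s v ≟ i
          ... | no h rewrite eq-≢ h = z≤n
          ... | yes refl = ≤-reflexive (trans (*-comm (eq (s v) (s v)) _) (cong (_* eq (s v) (s v)) (eq-sym (s u) (s v))))

    turns-suc : ∀ m X → Turned m X → Σ (Fin n → ℕ) (Turned (suc m))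
    turns-suc m X t = X′ , record
      { shape   = exec-then (loop m (turn A B)) (turn A B m ∷ []) (Turned.shape t) (proj₁ (proj₂ st))
      ; waiting = λ v h → trans (old v (λ e → <⇒≢ h (≡-sym e))) (Turned.waiting t v (<⇒≤ h))
      ; rounded = rounded′
      ; balance = +-cancelʳ-≤ (2 * A * U X + B * total ω X) _ _ (begin
          2 * A * U X₀ + B * total ω X′ + (2 * A * U X + B * total ω X)
            ≡⟨ e₁ (2 * A * U X₀) (B * total ω X′) (2 * A * U X) (B * total ω X) ⟩
          2 * A * U X₀ + B * total ω X + (2 * A * U X + B * total ω X′)
            ≤⟨ +-mono-≤ (Turned.balance t) bal ⟩
          2 * A * U X + B * (total ω X₀ + lossBelow m) + (2 * A * U X′ + B * (total ω X + lossAt m))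
            ≡⟨ e₂ (2 * A * U X) (2 * A * U X′) B (total ω X₀) (lossBelow m) (lossAt m) (total ω X) ⟩
          2 * A * U X′ + B * (total ω X₀ + (lossBelow m + lossAt m)) + (2 * A * U X + B * total ω X)
            ≡⟨ cong (λ z → 2 * A * U X′ + B * (total ω X₀ + z) + (2 * A * U X + B * total ω X)) (lossBelow-suc m) ⟨
          2 * A * U X′ + B * (total ω X₀ + lossBelow (suc m)) + (2 * A * U X + B * total ω X) ∎)
      }
      where
      st = turn-step m X (λ v h → Turned.waiting t v (≤-reflexive (≡-sym h)))
      X′ : Fin n → ℕ
      X′ = proj₁ st
      old : ∀ v → s v ≢ m → X′ v ≡ X v
      old = proj₁ (proj₂ (proj₂ st))
      new : ∀ v → s v ≡ m → Rounded v (X′ v)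
      new = proj₁ (proj₂ (proj₂ (proj₂ st)))
      bal : 2 * A * U X + B * total ω X′ ≤ 2 * A * U X′ + B * (total ω X + lossAt m)
      bal = proj₂ (proj₂ (proj₂ (proj₂ st)))
      e₁ : ∀ x y z t → x + y + (z + t) ≡ x + t + (z + y)
      e₁ = solve-∀
      e₂ : ∀ x y B p q r s → x + B * (p + q) + (y + B * (s + r)) ≡ y + B * (p + (q + r)) + (x + B * s)
      e₂ = solve-∀
      rounded′ : ∀ v → s v < suc m → Rounded v (X′ v)
      rounded′ v (s≤s sv≤m) with m≤n⇒m<n∨m≡n sv≤m
      ... | inj₁ sv<m = subst (Rounded v) (≡-sym (old v (<⇒≢ sv<m))) (Turned.rounded t v sv<m)
      ... | inj₂ sv≡m = new v sv≡m

    turns : ∀ m → Σ (Fin n → ℕ) (Turned m)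
    turns zero = X₀ , record
      { shape = λ v → refl ; waiting = λ v _ → refl ; rounded = λ v ()
      ; balance = +-monoʳ-≤ (2 * A * U X₀) (*-monoʳ-≤ B (m≤m+n _ _)) }
    turns (suc m) = turns-suc m (proj₁ (turns m)) (proj₂ (turns m))

repeat : ℕ → List Instr → List Instr
repeat zero    p = []
repeat (suc k) p = repeat k p ++ p

restart halve : Instr
restart d ds = record d { slt = 0 }
halve   d ds = record d { frc = ⌊ frc d /2⌋ }

-- A slot has q digits, and each of them divides the cost inside slots by e. `T₁`, `T₂` are the
-- lengths of the two codes and `L₀`, `L₁`, `L₂` the bits of a colour before, between and after
-- them; `t₁≤` and `t₂≤` bound the loss of each shot by a share 1/(4e).
record Params : Set where
  field
    q e L₀ T₁ L₁ T₂ L₂ : ℕ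
    0<e  : 0 < e
    0<T₁ : 0 < T₁
    0<T₂ : 0 < T₂
    m₁≤  : T₁ * (2 * T₁) ≤ 2 ^ L₁
    m₂≤  : T₂ * (2 * T₂) ≤ 2 ^ L₂
    t₁≤  : 4 * e * (1 + 2 * L₀) ≤ T₁
    t₂≤  : 4 * e * (1 + 2 * L₁) ≤ T₂

module Phases (par : Params) where
  open Params par

  -- 1/D is the share of the cost that remains inside slots, and Q is the number of slots.
  D Q : ℕ
  D = e ^ q
  Q = (2 * e) ^ q

  stageₚ : List Instr
  stageₚ = stage e Q L₀ T₁ L₁ T₂ (2 ^ L₂)

  -- Rounds from scale 2 ^ (j + 1) to scale 2 ^ j.
  phase : ℕ → List Instr
  phase j = (restart ∷ repeat q stageₚ) ++ (loop Q (turn (D ^ j * 2 ^ suc j) (suc D ^ j)) ++ (halve ∷ []))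

  rounding : ℕ → List Instr
  rounding zero    = []
  rounding (suc j) = phase j ++ rounding j

  module _ {n : ℕ} (G : Graph n) where
    open Local G
    open Stage G
    open Rounding G

    refresh : Config n → (y x s : Fin n → ℕ) → Config n
    refresh c y x s v = record (c v) { aux = y v ; nxt = x v ; slt = s v }

    record Staged (k : ℕ) (c : Config n) : Set where
      field
        y x s : Fin n → ℕ
        shape : exec G (repeat k stageₚ) c ≗ refresh c y x s
        s<    : ∀ v → s v < (2 * e) ^ k
        mono≤ : e ^ k * mono (λ v → wgt (c v)) (λ v → frc (c v)) s ≤ mono (λ v → wgt (c v)) (λ v → frc (c v)) (λ v → slt (c v))

    refresh-proper : ∀ c {y x s} → Proper L₀ c → Proper L₀ (refresh c y x s)
    refresh-proper c p = record { clr-< = clr-< p ; clr-≢ = clr-≢ p }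

    staged : ∀ k c → k ≤ q → Proper L₀ c → (∀ v → slt (c v) ≡ 0) → Staged k c
    staged zero c k≤ p z = record
      { y = λ v → aux (c v) ; x = λ v → nxt (c v) ; s = λ v → slt (c v) ; shape = λ v → refl
      ; s< = λ v → subst (_< 1) (≡-sym (z v)) (s≤s z≤n) ; mono≤ = ≤-reflexive (*-identityˡ (mono (λ v → wgt (c v)) (λ v → frc (c v)) (λ v → slt (c v)))) }
    staged (suc k) c k≤ p z = record
      { y = proj₁ st ; x = x′ ; s = x′
      ; shape = exec-then (repeat k stageₚ) stageₚ S.shape (proj₁ (proj₂ (proj₂ st)))
      ; s< = λ v → <-≤-trans (bound v (proj₁ (proj₂ (proj₂ (proj₂ st))) v)) (≤-reflexive (*-comm ((2 * e) ^ k) (2 * e)))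
      ; mono≤ = begin
          e * e ^ k * mono ω X x′    ≡⟨ trans (cong (_* mono ω X x′) (*-comm e (e ^ k))) (*-assoc (e ^ k) e _) ⟩
          e ^ k * (e * mono ω X x′)  ≤⟨ *-monoʳ-≤ (e ^ k) (proj₂ (proj₂ (proj₂ (proj₂ st)))) ⟩
          e ^ k * mono ω X S.s       ≤⟨ S.mono≤ ⟩
          mono ω X (λ v → slt (c v)) ∎
      }
      where
      open ≤-Reasoning
      module S = Staged (staged k c (<⇒≤ k≤) p z)
      ω X : Fin n → ℕ
      ω v = wgt (c v)
      X v = frc (c v)
      fits : ∀ v → S.s v * (2 * e) + 2 * e ≤ Q
      fits v = ≤-trans (≤-reflexive (+-comm (S.s v * (2 * e)) (2 * e))) (≤-trans (*-monoˡ-≤ (2 * e) (S.s< v))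
        (≤-trans (≤-reflexive (*-comm ((2 * e) ^ k) (2 * e))) (^-monoʳ-≤ (2 * e) {{>-nonZero (≤-trans 0<e (m≤m+n e _))}} k≤)))
      st = stage-spec e Q L₀ T₁ L₁ T₂ (2 ^ L₂) (refresh c S.y S.x S.s) 0<e 0<T₁ 0<T₂ (refresh-proper c p) fits m₁≤ m₂≤ t₁≤ t₂≤
      x′ : Fin n → ℕ
      x′ = proj₁ (proj₂ st)
      bound : ∀ v → (Σ ℕ λ r → r < 2 * e × x′ v ≡ S.s v * (2 * e) + r) → x′ v < (2 * e) ^ k * (2 * e)
      bound v (r , r< , eqn) = subst (_< (2 * e) ^ k * (2 * e)) (≡-sym eqn) (*-+-< (2 * e) ((2 * e) ^ k) (S.s< v) r<)

    utility : (ω X : Fin n → ℕ) → ℕ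
    utility ω X = ∑ V (λ v → ω v * X v)

    double-utility : ∀ ω X → utility ω (λ v → 2 * X v) ≡ 2 * utility ω X
    double-utility ω X = trans (∑-cong V (λ v → *-swapˡ (ω v) 2 (X v))) (∑-*ˡ V 2 _)

    double-total : ∀ ω X → total ω (λ v → 2 * X v) ≡ 4 * total ω X
    double-total ω X = trans (∑∑-cong (λ v u → lem (a v u) (ω v ⊓ ω u) (X v) (X u))) (∑∑-*ˡ 4 _)
      where
      lem : ∀ a m x y → a * (m * (2 * x * (2 * y))) ≡ 4 * (a * (m * (x * y)))
      lem = solve-∀

    utility-cong : ∀ ω {X Y} → (∀ v → X v ≡ Y v) → utility ω X ≡ utility ω Y
    utility-cong ω h = ∑-cong V (λ v → cong (ω v *_) (h v))

    total-cong : ∀ ω {X Y} → (∀ v → X v ≡ Y v) → total ω X ≡ total ω Y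
    total-cong ω h = ∑∑-cong (λ v u → cong (λ z → a v u * ((ω v ⊓ ω u) * z)) (cong₂ _*_ (h v) (h u)))

    mono-const : ∀ ω X s → (∀ v → s v ≡ 0) → mono ω X s ≤ total ω X
    mono-const ω X s h = ∑∑-mono (λ v u → ≤-trans (*-monoʳ-≤ (cost ω X v u) (eq≤1 (s v) (s u))) (≤-reflexive (*-identityʳ _)))

    redo : Config n → (y x s Z : Fin n → ℕ) → Config n
    redo c y x s Z v = record (c v) { aux = y v ; nxt = x v ; slt = s v ; frc = Z v }

    -- In terms of fractions, `gain` compares twice the utility minus (1 + 1/D)^(j+1) times the cost
    -- before the phase with twice the utility minus (1 + 1/D)^j times the cost after it. The weight
    -- of the cost pays in advance for the losses of the digits still to be rounded, so the phases
    -- telescope and end with the true objective at j = 0. The same weights define the derivative in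
    -- `turn`.
    record Phased (j : ℕ) (c : Config n) : Set where
      field
        y x s Z : Fin n → ℕ
        shape : exec G (phase j) c ≗ redo c y x s Z
        Z≤    : (∀ v → frc (c v) ≤ 2 ^ suc j) → ∀ v → Z v ≤ 2 ^ j
        gain  : D ^ suc j * (2 ^ suc (suc j) * utility (λ v → wgt (c v)) (λ v → frc (c v))) + 4 * D * (suc D ^ j * total (λ v → wgt (c v)) Z)
              ≤ 4 * D * (D ^ j * (2 ^ suc j * utility (λ v → wgt (c v)) Z)) + suc D ^ suc j * total (λ v → wgt (c v)) (λ v → frc (c v))

    phased : ∀ j c → Proper L₀ c → Phased j c
    phased j c p = record
      { y = S.y ; x = S.x ; s = S.s ; Z = Z
      ; shape = exec-then (restart ∷ repeat q stageₚ) (loop Q (turn A B) ++ (halve ∷ [])) {c} {c₁} S.shape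
          (exec-then (loop Q (turn A B)) (halve ∷ []) {c₁} {Tn.withFrc X} T.shape (λ v → refl))
      ; Z≤ = λ h v → Z≤ v (h v)
      ; gain = begin
          D ^ suc j * (2 ^ suc (suc j) * utility ω X₀) + 4 * D * (B * total ω Z)
            ≡⟨ e₁ D (D ^ j) (2 ^ suc j) (utility ω X₀) B (total ω Z) ⟩
          D * (2 * A * utility ω X₀ + B * (4 * total ω Z))
            ≡⟨ cong (λ z → D * (2 * A * utility ω X₀ + B * z)) (trans (≡-sym (double-total ω Z)) (total-cong ω 2Z)) ⟩
          D * (2 * A * utility ω X₀ + B * total ω X)
            ≤⟨ *-monoʳ-≤ D T.balance ⟩
          D * (2 * A * utility ω X + B * (total ω X₀ + Tn.lossBelow Q))
            ≡⟨ e₂ D (2 * A * utility ω X) B (total ω X₀) (Tn.lossBelow Q) ⟩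
          D * (2 * A * utility ω X) + B * (D * total ω X₀ + D * Tn.lossBelow Q)
            ≤⟨ +-monoʳ-≤ (D * (2 * A * utility ω X)) (*-monoʳ-≤ B (+-monoʳ-≤ (D * total ω X₀) loss)) ⟩
          D * (2 * A * utility ω X) + B * (D * total ω X₀ + total ω X₀)
            ≡⟨ cong (λ z → D * (2 * A * z) + B * (D * total ω X₀ + total ω X₀)) (trans (utility-cong ω (λ v → ≡-sym (2Z v))) (double-utility ω Z)) ⟩
          D * (2 * A * (2 * utility ω Z)) + B * (D * total ω X₀ + total ω X₀)
            ≡⟨ e₃ D (D ^ j) (2 ^ suc j) (utility ω Z) B (total ω X₀) ⟩
          4 * D * (D ^ j * (2 ^ suc j * utility ω Z)) + suc D ^ suc j * total ω X₀ ∎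
      }
      where
      open ≤-Reasoning
      A B : ℕ
      A = D ^ j * 2 ^ suc j
      B = suc D ^ j
      c₀ : Config n
      c₀ v = record (c v) { slt = 0 }
      module S = Staged (staged q c₀ ≤-refl (proper-clr c₀ (λ _ → refl) p) (λ _ → refl))
      c₁ : Config n
      c₁ = refresh c₀ S.y S.x S.s
      module Tn = Turns A B c₁
      X : Fin n → ℕ
      X = proj₁ (Tn.turns Q)
      module T = Tn.Turned (proj₂ (Tn.turns Q))
      ω X₀ Z : Fin n → ℕ
      ω v = wgt (c v)
      X₀ v = frc (c v)
      Z v = ⌊ X v /2⌋
      half : ∀ v {y} → y ≤ ⌈ X₀ v /2⌉ → X v ≡ 2 * y → (2 * Z v ≡ X v) × (Z v ≤ ⌈ X₀ v /2⌉)
      half v {y} h e = trans (cong (2 *_) Z≡) (≡-sym e) , ≤-trans (≤-reflexive Z≡) h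
        where
        Z≡ : Z v ≡ y
        Z≡ = trans (cong ⌊_/2⌋ e) (⌊2*n/2⌋≡n y)
      halves : ∀ v → Tn.Rounded v (X v) → (2 * Z v ≡ X v) × (Z v ≤ ⌈ X₀ v /2⌉)
      halves v (inj₁ e) = half v ≤-refl e
      halves v (inj₂ e) = half v (⌊n/2⌋≤⌈n/2⌉ (X₀ v)) e
      cases : ∀ v → (2 * Z v ≡ X v) × (Z v ≤ ⌈ X₀ v /2⌉)
      cases v = halves v (T.rounded v (S.s< v))
      2Z : ∀ v → 2 * Z v ≡ X v
      2Z v = proj₁ (cases v)
      Z≤ : ∀ v → X₀ v ≤ 2 ^ suc j → Z v ≤ 2 ^ j
      Z≤ v h = ≤-trans (proj₂ (cases v)) (⌈n/2⌉≤ (X₀ v) (2 ^ j) h)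
      loss : D * Tn.lossBelow Q ≤ total ω X₀
      loss = begin
        D * Tn.lossBelow Q   ≤⟨ *-monoʳ-≤ D (∑∑-mono (λ v u → ≤-trans (*-monoʳ-≤ (cost ω X₀ v u * eq (S.s v) (S.s u)) (lt≤1 (S.s v) Q)) (≤-reflexive (*-identityʳ (cost ω X₀ v u * eq (S.s v) (S.s u)))))) ⟩
        D * mono ω X₀ S.s    ≤⟨ S.mono≤ ⟩
        mono ω X₀ (λ v → 0)  ≤⟨ mono-const ω X₀ (λ v → 0) (λ _ → refl) ⟩
        total ω X₀ ∎
      e₁ : ∀ D P S u B t → D * P * (2 * S * u) + 4 * D * (B * t) ≡ D * (2 * (P * S) * u + B * (4 * t))
      e₁ = solve-∀
      e₂ : ∀ D x B y z → D * (x + B * (y + z)) ≡ D * x + B * (D * y + D * z)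
      e₂ = solve-∀
      e₃ : ∀ D P S u B t → D * (2 * (P * S) * (2 * u)) + B * (D * t + t) ≡ 4 * D * (P * (S * u)) + (1 + D) * B * t
      e₃ = solve-∀

    record Rounded (K : ℕ) (c : Config n) : Set where
      field
        y x s Z : Fin n → ℕ
        shape : exec G (rounding K) c ≗ redo c y x s Z
        Z≤1   : (∀ v → frc (c v) ≤ 2 ^ K) → ∀ v → Z v ≤ 1
        gain  : D ^ K * (2 ^ suc K * utility (λ v → wgt (c v)) (λ v → frc (c v))) + (4 * D) ^ K * total (λ v → wgt (c v)) Z
              ≤ (4 * D) ^ K * (2 * utility (λ v → wgt (c v)) Z) + suc D ^ K * total (λ v → wgt (c v)) (λ v → frc (c v))

    rounded : ∀ K c → Proper L₀ c → Rounded K c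
    rounded zero c p = record
      { y = λ v → aux (c v) ; x = λ v → nxt (c v) ; s = λ v → slt (c v) ; Z = λ v → frc (c v) ; shape = λ v → refl
      ; Z≤1 = λ h → h ; gain = ≤-refl }
    rounded (suc j) c p = record
      { y = R.y ; x = R.x ; s = R.s ; Z = R.Z
      ; shape = exec-then (phase j) (rounding j) {c} {c₁} P.shape R.shape
      ; Z≤1 = λ h → R.Z≤1 (P.Z≤ h)
      ; gain = +-cancelʳ-≤ (4 * D * (E * uY) + 4 * D * (F * tY)) _ _ (begin
          D ^ suc j * (2 ^ suc (suc j) * uX) + 4 * D * H * tZ + (4 * D * (E * uY) + 4 * D * (F * tY))
            ≡⟨ e₁ (D ^ suc j * (2 ^ suc (suc j) * uX)) (4 * D) H tZ (E * uY) (F * tY) ⟩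
          (D ^ suc j * (2 ^ suc (suc j) * uX) + 4 * D * (F * tY)) + 4 * D * (E * uY + H * tZ)
            ≤⟨ +-mono-≤ gain₁ (*-monoʳ-≤ (4 * D) gain₂) ⟩
          (4 * D * (E * uY) + suc D ^ suc j * tX) + 4 * D * (H * (2 * uZ) + F * tY)
            ≡⟨ e₂ (4 * D) (E * uY) (suc D ^ suc j * tX) H uZ (F * tY) ⟩
          4 * D * H * (2 * uZ) + suc D ^ suc j * tX + (4 * D * (E * uY) + 4 * D * (F * tY)) ∎)
      }
      where
      open ≤-Reasoning
      module P = Phased (phased j c p)
      c₁ : Config n
      c₁ = redo c P.y P.x P.s P.Z
      module R = Rounded (rounded j c₁ (proper-clr c₁ (λ _ → refl) p))
      ω : Fin n → ℕ
      ω v = wgt (c v)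
      uX uY uZ tX tY tZ E F H : ℕ
      uX = utility ω (λ v → frc (c v))
      uY = utility ω P.Z
      uZ = utility ω R.Z
      tX = total ω (λ v → frc (c v))
      tY = total ω P.Z
      tZ = total ω R.Z
      E = D ^ j * 2 ^ suc j
      F = suc D ^ j
      H = (4 * D) ^ j
      gain₁ : D ^ suc j * (2 ^ suc (suc j) * uX) + 4 * D * (F * tY) ≤ 4 * D * (E * uY) + suc D ^ suc j * tX
      gain₁ = subst (λ z → D ^ suc j * (2 ^ suc (suc j) * uX) + 4 * D * (F * tY) ≤ 4 * D * z + suc D ^ suc j * tX) (≡-sym (*-assoc (D ^ j) (2 ^ suc j) uY)) P.gain
      gain₂ : E * uY + H * tZ ≤ H * (2 * uZ) + F * tY
      gain₂ = subst (λ z → z + H * tZ ≤ H * (2 * uZ) + F * tY) (≡-sym (*-assoc (D ^ j) (2 ^ suc j) uY)) R.gain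
      e₁ : ∀ x d h t e f → x + d * h * t + (d * e + d * f) ≡ (x + d * f) + d * (e + h * t)
      e₁ = solve-∀
      e₂ : ∀ d e x h u f → (d * e + x) + d * (h * (2 * u) + f) ≡ d * h * (2 * u) + x + (d * e + d * f)
      e₂ = solve-∀

-- From integral values to an independent set

loses : Node → Node → ℕ
loses d q = lt (wgt d) (wgt q) + eq (wgt d) (wgt q) * lt (clr d) (clr q)

-- A node yields to every stronger neighbour of positive value, even to one that yields itself; this
-- is what the estimate of the cost allows, and one round suffices. Nodes of weight zero never join,
-- so that in the local ratio recursion members have positive residual weight.
resolve : Instr
resolve d ds = record d { mem = ifEq (∑ ds (λ q → frc q * loses d q)) 0 (lt 0 (frc d) * lt 0 (wgt d)) 0 }

lt-positive : ∀ {x y} → 0 < lt x y → x < y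
lt-positive {x} {y} h with x <? y
... | yes p = p
... | no ¬p = ⊥-elim (<-irrefl (≡-sym (lt-≮ ¬p)) h)

0<*⇒0<ˡ : ∀ x y → 0 < x * y → 0 < x
0<*⇒0<ˡ zero    y ()
0<*⇒0<ˡ (suc x) y _ = s≤s z≤n

0<*⇒0<ʳ : ∀ x y → 0 < x * y → 0 < y
0<*⇒0<ʳ x y h = 0<*⇒0<ˡ y x (subst (0 <_) (*-comm x y) h)

loses-antisym : ∀ d q → loses d q + loses q d ≤ 1
loses-antisym d q = begin
  l₁ + e * c₁ + (l₂ + eq (wgt q) (wgt d) * c₂) ≡⟨ cong (λ z → l₁ + e * c₁ + (l₂ + z * c₂)) (eq-sym (wgt q) (wgt d)) ⟩
  l₁ + e * c₁ + (l₂ + e * c₂)                  ≡⟨ e₁ l₁ l₂ e c₁ c₂ ⟩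
  e * (c₁ + c₂) + (l₁ + l₂)                    ≤⟨ +-monoˡ-≤ (l₁ + l₂) (*-monoʳ-≤ e (≤-trans (m≤n+m (c₁ + c₂) (eq (clr d) (clr q))) (≤-reflexive (trichotomy (clr d) (clr q))))) ⟩
  e * 1 + (l₁ + l₂)                            ≡⟨ cong (_+ (l₁ + l₂)) (*-identityʳ e) ⟩
  e + (l₁ + l₂)                                ≡⟨ trichotomy (wgt d) (wgt q) ⟩
  1 ∎
  where
  open ≤-Reasoning
  l₁ = lt (wgt d) (wgt q)
  l₂ = lt (wgt q) (wgt d)
  e  = eq (wgt d) (wgt q)
  c₁ = lt (clr d) (clr q)
  c₂ = lt (clr q) (clr d)
  e₁ : ∀ l m e c d → l + e * c + (m + e * d) ≡ e * (c + d) + (l + m)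
  e₁ = solve-∀

loses-total : ∀ d q → clr d ≢ clr q → 0 < loses d q ⊎ 0 < loses q d
loses-total d q ≢ with <-cmp (wgt d) (wgt q)
... | tri< h _ _ = inj₁ (≤-trans (≤-reflexive (≡-sym (lt-< h))) (m≤m+n _ _))
... | tri> _ _ h = inj₂ (≤-trans (≤-reflexive (≡-sym (lt-< h))) (m≤m+n _ _))
... | tri≈ _ e _ with <-cmp (clr d) (clr q)
...   | tri< h _ _ = inj₁ (≤-trans (≤-reflexive (≡-sym (cong₂ _*_ (eq-≡ e) (lt-< h)))) (m≤n+m _ (lt (wgt d) (wgt q))))
...   | tri≈ _ h _ = ⊥-elim (≢ h)
...   | tri> _ _ h = inj₂ (≤-trans (≤-reflexive (≡-sym (cong₂ _*_ (eq-≡ (≡-sym e)) (lt-< h)))) (m≤n+m _ (lt (wgt q) (wgt d))))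

-- The loser is the lighter end, so its weight is the cost coefficient of the edge.
loses-min : ∀ d q → wgt d * loses d q ≤ (wgt d ⊓ wgt q) * loses d q
loses-min d q with wgt d ≤? wgt q
... | yes h = *-monoˡ-≤ (loses d q) (≤-reflexive (≡-sym (m≤n⇒m⊓n≡m h)))
... | no ¬h = ≤-trans (≤-reflexive (trans (cong (wgt d *_) zero′) (*-zeroʳ (wgt d)))) z≤n
  where
  zero′ : loses d q ≡ 0
  zero′ = cong₂ _+_ (lt-≮ (λ h → ¬h (<⇒≤ h))) (cong (_* lt (clr d) (clr q)) (eq-≢ (λ e → ¬h (≤-reflexive e))))

module Resolve {n : ℕ} (G : Graph n) (c : Config n) where
  open Local G
  open Stage G
  open ≤-Reasoning

  ω Z M : Fin n → ℕ
  ω v = wgt (c v)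
  Z v = frc (c v)
  M v = mem (resolve (c v) (received c v))

  pressure : Fin n → ℕ
  pressure v = ∑ V (λ u → a v u * (Z u * loses (c v) (c u)))

  pressure≡ : ∀ v → ∑ (received c v) (λ q → frc q * loses (c v) q) ≡ pressure v
  pressure≡ v = ∑-received c _ v

  M-unpressed : ∀ v → pressure v ≡ 0 → M v ≡ lt 0 (Z v) * lt 0 (ω v)
  M-unpressed v h = ifEq-≡ (trans (pressure≡ v) h)

  M-pressed : ∀ v → pressure v ≢ 0 → M v ≡ 0
  M-pressed v h = ifEq-≢ (λ e → h (trans (≡-sym (pressure≡ v)) e))

  M≤1 : ∀ v → M v ≤ 1
  M≤1 v with pressure v ≟ 0
  ... | yes h = ≤-trans (≤-reflexive (M-unpressed v h)) (*-mono-≤ (lt≤1 0 (Z v)) (lt≤1 0 (ω v)))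
  ... | no ¬h = ≤-trans (≤-reflexive (M-pressed v ¬h)) z≤n

  M-on : ∀ v → 0 < M v → pressure v ≡ 0 × 0 < Z v × 0 < ω v
  M-on v h with pressure v ≟ 0
  ... | yes p = p , lt-positive (0<*⇒0<ˡ _ _ h′) , lt-positive (0<*⇒0<ʳ (lt 0 (Z v)) _ h′)
    where
    h′ : 0 < lt 0 (Z v) * lt 0 (ω v)
    h′ = subst (0 <_) (M-unpressed v p) h
  ... | no ¬p = ⊥-elim (<-irrefl (≡-sym (M-pressed v ¬p)) h)

  unbeaten : ∀ v u → adj G v u ≡ true → pressure v ≡ 0 → 0 < Z u → ¬ 0 < loses (c v) (c u)
  unbeaten v u vu p zu l = <-irrefl refl (begin-strict
    0                                   <⟨ *-mono-≤ zu l ⟩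
    Z u * loses (c v) (c u)             ≡⟨ *-identityˡ _ ⟨
    1 * (Z u * loses (c v) (c u))       ≡⟨ cong (λ b → 𝟙ᵇ b * (Z u * loses (c v) (c u))) vu ⟨
    a v u * (Z u * loses (c v) (c u))   ≤⟨ ∑-∈ (λ u → a v u * (Z u * loses (c v) (c u))) (∈-allFin u) ⟩
    pressure v                          ≡⟨ p ⟩
    0 ∎)

  M-independent : ∀ {L} → Proper L c → ∀ v u → adj G v u ≡ true → 0 < M v → 0 < M u → ⊥
  M-independent p v u vu hv hu with M-on v hv | M-on u hu | loses-total (c v) (c u) (clr-≢ p v u vu)
  ... | pv , zv , _ | pu , zu , _ | inj₁ l = unbeaten v u vu pv zu l
  ... | pv , zv , _ | pu , zu , _ | inj₂ l = unbeaten u v (trans (Graph.sym G u v) vu) pu zv l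

  -- A candidate that drops out has positive pressure, which is an integer and hence at least 1.
  survive : (∀ v → Z v ≤ 1) → ∀ v → ω v * Z v ≤ ω v * M v + ω v * Z v * pressure v
  survive Z≤1 v with pressure v ≟ 0
  ... | no ¬h = ≤-trans (m≤m*n (ω v * Z v) (pressure v) {{≢-nonZero ¬h}}) (m≤n+m _ _)
  ... | yes h with ω v ≟ 0 | Z v ≟ 0
  ...   | yes e | _ rewrite e = z≤n
  ...   | no _ | yes e rewrite e | *-zeroʳ (ω v) = z≤n
  ...   | no ω≢0 | no Z≢0 = ≤-trans (*-monoʳ-≤ (ω v) (≤-trans (Z≤1 v) (≤-reflexive (≡-sym M≡1)))) (m≤m+n _ _)
    where
    M≡1 : M v ≡ 1
    M≡1 = trans (M-unpressed v h) (cong₂ _*_ (lt-< (n≢0⇒n>0 Z≢0)) (lt-< (n≢0⇒n>0 ω≢0)))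

  -- Each edge has one loser but occurs twice, once for each orientation, in `total`.
  conflicts : 2 * ∑ V (λ v → ω v * Z v * pressure v) ≤ total ω Z
  conflicts = begin
    2 * ∑ V (λ v → ω v * Z v * pressure v)
      ≡⟨ cong (2 *_) (∑-cong V (λ v → ≡-sym (∑-*ˡ V (ω v * Z v) _))) ⟩
    2 * ∑∑ (λ v u → ω v * Z v * (a v u * (Z u * loses (c v) (c u))))
      ≤⟨ *-monoʳ-≤ 2 (∑∑-mono charged) ⟩
    2 * ∑∑ F
      ≡⟨ cong (∑∑ F +_) (+-identityʳ (∑∑ F)) ⟩
    ∑∑ F + ∑∑ F
      ≡⟨ cong (∑∑ F +_) (≡-sym (∑∑-transpose F)) ⟩
    ∑∑ F + ∑∑ (λ v u → F u v)
      ≡⟨ ∑∑-+ F _ ⟨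
    ∑∑ (λ v u → F v u + F u v)
      ≡⟨ ∑∑-cong (λ v u → trans (cong (λ z → F v u + z * loses (c u) (c v)) (cost-sym ω Z u v)) (≡-sym (*-distribˡ-+ (cost ω Z v u) _ _))) ⟩
    ∑∑ (λ v u → cost ω Z v u * (loses (c v) (c u) + loses (c u) (c v)))
      ≤⟨ ∑∑-mono (λ v u → ≤-trans (*-monoʳ-≤ (cost ω Z v u) (loses-antisym (c v) (c u))) (≤-reflexive (*-identityʳ (cost ω Z v u)))) ⟩
    total ω Z ∎
    where
    F : Fin n → Fin n → ℕ
    F v u = cost ω Z v u * loses (c v) (c u)
    e₁ : ∀ w z a y l → w * z * (a * (y * l)) ≡ a * (z * y) * (w * l)
    e₁ = solve-∀
    e₂ : ∀ m z a y l → a * (z * y) * (m * l) ≡ a * (m * (z * y)) * l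
    e₂ = solve-∀
    charged : ∀ v u → ω v * Z v * (a v u * (Z u * loses (c v) (c u))) ≤ F v u
    charged v u = begin
      ω v * Z v * (a v u * (Z u * loses (c v) (c u))) ≡⟨ e₁ (ω v) (Z v) (a v u) (Z u) (loses (c v) (c u)) ⟩
      a v u * (Z v * Z u) * (ω v * loses (c v) (c u)) ≤⟨ *-monoʳ-≤ (a v u * (Z v * Z u)) (loses-min (c v) (c u)) ⟩
      a v u * (Z v * Z u) * ((ω v ⊓ ω u) * loses (c v) (c u)) ≡⟨ e₂ (ω v ⊓ ω u) (Z v) (a v u) (Z u) (loses (c v) (c u)) ⟩
      F v u ∎

  M-weight : (∀ v → Z v ≤ 1) → 2 * ∑ V (λ v → ω v * Z v) ≤ 2 * ∑ V (λ v → ω v * M v) + total ω Z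
  M-weight Z≤1 = begin
    2 * ∑ V (λ v → ω v * Z v)
      ≤⟨ *-monoʳ-≤ 2 (∑-mono V (survive Z≤1)) ⟩
    2 * ∑ V (λ v → ω v * M v + ω v * Z v * pressure v)
      ≡⟨ cong (2 *_) (∑-+ V _ _) ⟩
    2 * (∑ V (λ v → ω v * M v) + ∑ V (λ v → ω v * Z v * pressure v))
      ≡⟨ *-distribˡ-+ 2 (∑ V (λ v → ω v * M v)) _ ⟩
    2 * ∑ V (λ v → ω v * M v) + 2 * ∑ V (λ v → ω v * Z v * pressure v)
      ≤⟨ +-monoʳ-≤ (2 * ∑ V (λ v → ω v * M v)) conflicts ⟩
    2 * ∑ V (λ v → ω v * M v) + total ω Z ∎

-- Fractional solutions by doubling, and local ratio

unit : Instr
unit d ds = record d { frc = 1 }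

-- Values are numerators over `S`. The node's own term in the threshold bounds its fraction:
-- doubling requires `8 * frc d < S`.
grow : ℕ → Instr
grow S d ds = record d { frc =
  ifLe (S * wgt d) (8 * (wgt d * frc d + ∑ ds (λ q → wgt q * frc q))) (frc d) (2 * frc d) }

-- While the fractional weight around v is below w(v) / 8, the value at v doubles; a doubling step
-- raises the cost by at most half as much as the utility.
module Grow {n : ℕ} (G : Graph n) (S : ℕ) (c : Config n) where
  open Local G
  open Rounding G
  open ≤-Reasoning

  ω : Fin n → ℕ
  ω v = wgt (c v)

  open Quadratic ω

  withFrc : (Fin n → ℕ) → Config n
  withFrc X v = record (c v) { frc = X v }

  around : (Fin n → ℕ) → Fin n → ℕ
  around X v = ω v * X v + ∑ V (λ u → a v u * (ω u * X u))

  Sat : (Fin n → ℕ) → Fin n → Set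
  Sat X v = S * ω v ≤ 8 * around X v

  record Grown (i : ℕ) (X : Fin n → ℕ) : Set where
    field
      shape : exec G (loop i (λ _ → grow S)) (withFrc (λ _ → 1)) ≗ withFrc X
      state : ∀ v → Sat X v ⊎ X v ≡ 2 ^ i
      cheap : 2 * total ω X ≤ S * U X
      small : ∀ v → X v ≤ S

  -- At the fraction 1/S with S at least twice the degree, the cost around a node is at most half of
  -- its utility.
  grown-zero : 0 < S → (∀ v → 2 * ∑ V (a v) ≤ S) → Grown 0 (λ _ → 1)
  grown-zero 0<S hdeg = record
    { shape = λ v → refl ; state = λ v → inj₂ refl ; small = λ v → 0<S
    ; cheap = begin
        2 * total ω (λ _ → 1)                   ≡⟨ ∑-*ˡ V 2 _ ⟨
        ∑ V (λ v → 2 * ∑ V (λ u → cost ω (λ _ → 1) v u)) ≤⟨ ∑-mono V pointwise ⟩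
        ∑ V (λ v → S * (ω v * 1))               ≡⟨ ∑-*ˡ V S _ ⟩
        S * U (λ _ → 1) ∎
    }
    where
    pointwise : ∀ v → 2 * ∑ V (λ u → cost ω (λ _ → 1) v u) ≤ S * (ω v * 1)
    pointwise v = begin
      2 * ∑ V (λ u → a v u * ((ω v ⊓ ω u) * (1 * 1)))
        ≤⟨ *-monoʳ-≤ 2 (∑-mono V (λ u → ≤-trans (*-monoʳ-≤ (a v u) (*-monoˡ-≤ 1 (m⊓n≤m (ω v) (ω u)))) (≤-reflexive (*-comm (a v u) (ω v * 1))))) ⟩
      2 * ∑ V (λ u → ω v * 1 * a v u)  ≡⟨ cong (2 *_) (∑-*ˡ V (ω v * 1) (a v)) ⟩
      2 * (ω v * 1 * ∑ V (a v))        ≡⟨ *-swapˡ 2 (ω v * 1) _ ⟩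
      ω v * 1 * (2 * ∑ V (a v))        ≤⟨ *-monoʳ-≤ (ω v * 1) (hdeg v) ⟩
      ω v * 1 * S                      ≡⟨ *-comm (ω v * 1) S ⟩
      S * (ω v * 1) ∎

  module Step (i : ℕ) (X : Fin n → ℕ) (g : Grown i X) where
    X′ D : Fin n → ℕ
    X′ v = frc (grow S (withFrc X v) (received (withFrc X) v))
    D v = ifLe (S * ω v) (8 * around X v) 0 (X v)

    X′≡ : ∀ v → X′ v ≡ ifLe (S * ω v) (8 * around X v) (X v) (2 * X v)
    X′≡ v = cong (λ z → ifLe (S * ω v) (8 * (ω v * X v + z)) (X v) (2 * X v)) (∑-received (withFrc X) _ v)

    record Facts (v : Fin n) (x d : ℕ) : Set where
      field
        bal   : x ≡ X v + d
        d≤    : d ≤ X v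
        slack : d * (8 * around X v) ≤ d * (S * ω v)
        sml   : x ≤ S
        sat   : Sat X v ⊎ x ≡ 2 ^ suc i

    transport : ∀ {v x d x₁ d₁} → x ≡ x₁ → d ≡ d₁ → Facts v x₁ d₁ → Facts v x d
    transport refl refl f = f

    facts : ∀ v → Facts v (X′ v) (D v)
    facts v with S * ω v ≤? 8 * around X v
    ... | yes h = transport (trans (X′≡ v) (ifLe-yes h)) (ifLe-yes h) (record
            { bal = ≡-sym (+-identityʳ _) ; d≤ = z≤n ; slack = z≤n ; sml = Grown.small g v ; sat = inj₁ h })
    ... | no ¬h = transport (trans (X′≡ v) (ifLe-no ¬h)) (ifLe-no ¬h) (record
            { bal = cong (X v +_) (+-identityʳ _) ; d≤ = ≤-refl ; slack = *-monoʳ-≤ (X v) (<⇒≤ (≰⇒> ¬h))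
            ; sml = sml ; sat = sat (Grown.state g v) })
      where
      sat : Sat X v ⊎ X v ≡ 2 ^ i → Sat X v ⊎ 2 * X v ≡ 2 ^ suc i
      sat (inj₁ s) = inj₁ s
      sat (inj₂ e) = inj₂ (cong (2 *_) e)
      e₁ : ∀ w x → w * (8 * x) ≡ 8 * (w * x)
      e₁ = solve-∀
      sml : 2 * X v ≤ S
      sml = ≤-trans (*-monoˡ-≤ (X v) {2} {8} (s≤s (s≤s z≤n))) (<⇒≤ (*-cancelˡ-< (ω v) _ _ (begin-strict
        ω v * (8 * X v)  ≡⟨ e₁ (ω v) (X v) ⟩
        8 * (ω v * X v)  ≤⟨ *-monoʳ-≤ 8 (m≤m+n (ω v * X v) _) ⟩
        8 * around X v   <⟨ ≰⇒> ¬h ⟩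
        S * ω v          ≡⟨ *-comm S (ω v) ⟩
        ω v * S ∎)))

    around-mono : ∀ v → around X v ≤ around X′ v
    around-mono v = +-mono-≤ (*-monoʳ-≤ (ω v) (X≤ v)) (∑-mono V (λ u → *-monoʳ-≤ (a v u) (*-monoʳ-≤ (ω u) (X≤ u))))
      where
      X≤ : ∀ v → X v ≤ X′ v
      X≤ v = ≤-trans (m≤m+n (X v) (D v)) (≤-reflexive (≡-sym (Facts.bal (facts v))))

    b-DD : b D D ≤ b D X
    b-DD = ∑-mono V (λ v → *-monoʳ-≤ (D v) (∑-mono V (λ u → *-monoʳ-≤ (κ v u) (Facts.d≤ (facts u)))))

    b-DX : 8 * b D X ≤ S * U D
    b-DX = begin
      8 * b D X ≡⟨ ∑-*ˡ V 8 _ ⟨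
      ∑ V (λ v → 8 * (D v * ∑ V (λ u → κ v u * X u))) ≤⟨ ∑-mono V pointwise ⟩
      ∑ V (λ v → S * (ω v * D v)) ≡⟨ ∑-*ˡ V S _ ⟩
      S * U D ∎
      where
      e₁ : ∀ d s w → d * (s * w) ≡ s * (w * d)
      e₁ = solve-∀
      pointwise : ∀ v → 8 * (D v * ∑ V (λ u → κ v u * X u)) ≤ S * (ω v * D v)
      pointwise v = begin
        8 * (D v * ∑ V (λ u → κ v u * X u)) ≡⟨ *-swapˡ 8 (D v) _ ⟩
        D v * (8 * ∑ V (λ u → κ v u * X u))
          ≤⟨ *-monoʳ-≤ (D v) (*-monoʳ-≤ 8 (≤-trans (∑-mono V (λ u → ≤-trans (≤-reflexive (*-assoc (a v u) _ _)) (*-monoʳ-≤ (a v u) (*-monoˡ-≤ (X u) (m⊓n≤n (ω v) (ω u)))))) (m≤n+m _ (ω v * X v)))) ⟩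
        D v * (8 * around X v) ≤⟨ Facts.slack (facts v) ⟩
        D v * (S * ω v)        ≡⟨ e₁ (D v) S (ω v) ⟩
        S * (ω v * D v) ∎

    next : Grown (suc i) X′
    next = record
      { shape = exec-then (loop i (λ _ → grow S)) (grow S ∷ []) {withFrc (λ _ → 1)} {withFrc X} (Grown.shape g) (λ v → refl)
      ; state = λ v → state v (Facts.sat (facts v))
      ; small = λ v → Facts.sml (facts v)
      ; cheap = begin
          2 * total ω X′                         ≡⟨ cong (2 *_) (≡-sym (b-total X′)) ⟩
          2 * b X′ X′                            ≡⟨ cong (2 *_) (trans (b-cong (λ v → Facts.bal (facts v)) (λ v → Facts.bal (facts v))) (b-square X D)) ⟩
          2 * (b X X + 2 * b X D + b D D)        ≡⟨ cong (λ z → 2 * (b X X + 2 * z + b D D)) (b-sym X D) ⟩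
          2 * (b X X + 2 * b D X + b D D)        ≤⟨ *-monoʳ-≤ 2 (+-monoʳ-≤ (b X X + 2 * b D X) b-DD) ⟩
          -- The increase of twice the cost is at most 6 `b D X`, within the 8 `b D X` that the
          -- threshold of the doubling pays for.
          2 * (b X X + 2 * b D X + b D X)        ≤⟨ m≤m+n _ (2 * b D X) ⟩
          2 * (b X X + 2 * b D X + b D X) + 2 * b D X ≡⟨ e₁ (b X X) (b D X) ⟩
          2 * b X X + 8 * b D X                  ≤⟨ +-mono-≤ (≤-trans (≤-reflexive (cong (2 *_) (b-total X))) (Grown.cheap g)) b-DX ⟩
          S * U X + S * U D                      ≡⟨ *-distribˡ-+ S (U X) (U D) ⟨
          S * (U X + U D)                        ≡⟨ cong (S *_) (trans (≡-sym (U-+ X D)) (U-cong (λ v → ≡-sym (Facts.bal (facts v))))) ⟩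
          S * U X′ ∎
      }
      where
      e₁ : ∀ x d → 2 * (x + 2 * d + d) + 2 * d ≡ 2 * x + 8 * d
      e₁ = solve-∀
      state : ∀ v → Sat X v ⊎ X′ v ≡ 2 ^ suc i → Sat X′ v ⊎ X′ v ≡ 2 ^ suc i
      state v (inj₁ s) = inj₁ (≤-trans s (*-monoʳ-≤ 8 (around-mono v)))
      state v (inj₂ e) = inj₂ e

  grown : 0 < S → (∀ v → 2 * ∑ V (a v) ≤ S) → ∀ i → Σ (Fin n → ℕ) (Grown i)
  grown 0<S hdeg zero    = (λ _ → 1) , grown-zero 0<S hdeg
  grown 0<S hdeg (suc i) = Step.X′ i (proj₁ (grown 0<S hdeg i)) (proj₂ (grown 0<S hdeg i)) , Step.next i (proj₁ (grown 0<S hdeg i)) (proj₂ (grown 0<S hdeg i))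

  -- A node that never became saturated has doubled in all K rounds; its fraction is 1, and its own
  -- weight saturates it.
  grown-sat : ∀ K X → Grown K X → S ≡ 2 ^ K → ∀ v → Sat X v
  grown-sat K X g S≡ v with Grown.state g v
  ... | inj₁ s = s
  ... | inj₂ e = begin
    S * ω v          ≡⟨ cong (_* ω v) (trans S≡ (≡-sym e)) ⟩
    X v * ω v        ≡⟨ *-comm (X v) (ω v) ⟩
    ω v * X v        ≤⟨ m≤m+n (ω v * X v) (∑ V (λ u → a v u * (ω u * X u))) ⟩
    around X v       ≤⟨ m≤n*m (around X v) 8 ⟩
    8 * around X v ∎

^-distribʳ-* : ∀ x y k → (x * y) ^ k ≡ x ^ k * y ^ k
^-distribʳ-* x y zero    = refl
^-distribʳ-* x y (suc k) = trans (cong (x * y *_) (^-distribʳ-* x y k)) (e₁ x y (x ^ k) (y ^ k))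
  where
  e₁ : ∀ x y p q → x * y * (p * q) ≡ x * p * (y * q)
  e₁ = solve-∀

4*D^K : ∀ D K → (4 * D) ^ K ≡ 2 ^ K * 2 ^ K * D ^ K
4*D^K D K = trans (^-distribʳ-* 4 D K) (cong (_* D ^ K) (^-distribʳ-* 2 2 K))

-- The weight of the set just found is subtracted from each closed neighbourhood. A member loses all
-- of its own weight; an exhausted node has weight zero and stays outside all later sets. The stack
-- records who was a member.
residual clear pop : Instr
residual d ds = record d
  { wgt = wgt d ∸ (wgt d * mem d + ∑ ds (λ q → wgt q * mem q)) ; stack = isOn (mem d) ∷ stack d }
clear d ds = record d { mem = 0 }

-- On the way back the sets found later have priority: a recorded member joins if no neighbour has
-- been taken.
popMem : List Bool → ℕ → ℕ → ℕ
popMem (true ∷ _) m s = ifEq s 0 1 m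
popMem _          m s = m

popStack : List Bool → List Bool
popStack []       = []
popStack (_ ∷ bs) = bs

pop d ds = record d { mem = popMem (stack d) (mem d) (∑ ds mem) ; stack = popStack (stack d) }

module Closed {n : ℕ} (G : Graph n) where
  open Local G

  N : (Fin n → ℕ) → Fin n → ℕ
  N f v = f v + ∑ V (λ u → a v u * f u)

  N-sym : ∀ f g → ∑ V (λ v → f v * N g v) ≡ ∑ V (λ v → g v * N f v)
  N-sym f g = begin
    ∑ V (λ v → f v * N g v)                                       ≡⟨ expand f g ⟩
    ∑ V (λ v → f v * g v) + ∑∑ (λ v u → f v * (a v u * g u))
      ≡⟨ cong₂ _+_ (∑-cong V (λ v → *-comm (f v) (g v))) (trans (≡-sym (∑∑-transpose _)) (∑∑-cong (λ v u →
           trans (cong (λ z → f u * (z * g v)) (a-sym u v)) (e₁ (f u) (a v u) (g v))))) ⟩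
    ∑ V (λ v → g v * f v) + ∑∑ (λ v u → g v * (a v u * f u))       ≡⟨ expand g f ⟨
    ∑ V (λ v → g v * N f v) ∎
    where
    open ≡-Reasoning
    e₁ : ∀ x y z → x * (y * z) ≡ z * (y * x)
    e₁ = solve-∀
    expand : ∀ f g → ∑ V (λ v → f v * N g v) ≡ ∑ V (λ v → f v * g v) + ∑∑ (λ v u → f v * (a v u * g u))
    expand f g = trans (∑-cong V (λ v → trans (*-distribˡ-+ (f v) _ _) (cong (f v * g v +_) (≡-sym (∑-*ˡ V (f v) _))))) (∑-+ V _ _)

  weigh : (ω f : Fin n → ℕ) → ℕ
  weigh ω f = ∑ V (λ v → ω v * f v)

  -- The only property of the comparison set T that the analysis uses; the algorithm knows neither T
  -- nor B. With B = β ⊔ 1 it holds for independent sets, with B = Δ + 1 for the set of all nodes.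
  Sparse : (Fin n → ℕ) → ℕ → Set
  Sparse T B = ∀ v → N T v ≤ B

  sparse-bound : ∀ T B g → Sparse T B → ∑ V (λ v → T v * N g v) ≤ B * ∑ V g
  sparse-bound T B g sp = begin
    ∑ V (λ v → T v * N g v) ≡⟨ N-sym T g ⟩
    ∑ V (λ v → g v * N T v) ≤⟨ ∑-mono V (λ v → ≤-trans (*-monoʳ-≤ (g v) (sp v)) (≤-reflexive (*-comm (g v) B))) ⟩
    ∑ V (λ v → B * g v)     ≡⟨ ∑-*ˡ V B g ⟩
    B * ∑ V g ∎
    where open ≤-Reasoning

  record Valid (ω m : Fin n → ℕ) : Set where
    field
      ≤1    : ∀ v → m v ≤ 1
      indep : ∀ v u → adj G v u ≡ true → 0 < m v → 0 < m u → ⊥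
      heavy : ∀ v → 0 < m v → 0 < ω v

  hit : (ω M : Fin n → ℕ) → Fin n → ℕ
  hit ω M = N (λ v → ω v * M v)

module LocalRatio (par : Params) (K : ℕ) where
  open Params par
  open Phases par

  iteration : List Instr
  iteration = (unit ∷ loop K (λ _ → grow (2 ^ K))) ++ (rounding K ++ (resolve ∷ residual ∷ []))

  localRatio : ℕ → List Instr
  localRatio zero    = clear ∷ []
  localRatio (suc k) = iteration ++ (localRatio k ++ (pop ∷ []))

  module _ {n : ℕ} (G : Graph n) where
    open Local G
    open Stage G

    open Closed G

    record Iterated (c : Config n) : Set where
      field
        M y x s Z : Fin n → ℕ
        shape : exec G iteration c ≗ (λ v → record (c v)
          { aux = y v ; nxt = x v ; slt = s v ; frc = Z v ; mem = M v
          ; wgt = wgt (c v) ∸ hit (λ v → wgt (c v)) M v ; stack = isOn (M v) ∷ stack (c v) })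
        valid : Valid (λ v → wgt (c v)) M
        large : ∀ T B → Sparse T B → weigh (λ v → wgt (c v)) T ≤ 16 * (B * weigh (λ v → wgt (c v)) M)

    module Iteration (hdeg : ∀ v → 2 * ∑ V (a v) ≤ 2 ^ K) (hD : K * 2 ≤ D) where

      iterate : ∀ c → Proper L₀ c → Iterated c
      iterate c p = record
        { M = R.M ; y = Rd.y ; x = Rd.x ; s = Rd.s ; Z = Rd.Z
        ; shape = exec-then (unit ∷ loop K (λ _ → grow (2 ^ K))) (rounding K ++ (resolve ∷ residual ∷ [])) {c} {c₁} Gr.shape
            (exec-then (rounding K) (resolve ∷ residual ∷ []) {c₁} {c₂} Rd.shape
              (λ v → cong (λ z → record (c₂ v) { mem = R.M v ; wgt = ω v ∸ (ω v * R.M v + z) ; stack = isOn (R.M v) ∷ stack (c v) })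
                (∑-received (round G resolve c₂) (λ q → wgt q * mem q) v)))
        ; valid = record { ≤1 = R.M≤1 ; indep = R.M-independent {L₀} (proper-clr c₂ (λ _ → refl) p) ; heavy = λ v h → proj₂ (proj₂ (R.M-on v h)) }
        -- 16 = 8 · 2: the saturation threshold contributes 8, and the rounding, as recorded in
        -- `gain`, a factor 2.
        ; large = λ T B sp → *-cancelˡ-≤ (2 ^ K) {{2^-≢0 K}} (begin
            2 ^ K * weigh ω T
              ≡⟨ trans (≡-sym (∑-*ˡ V (2 ^ K) _)) (∑-cong V (λ v → trans (≡-sym (*-assoc (2 ^ K) (ω v) (T v))) (*-comm _ (T v)))) ⟩
            ∑ V (λ v → T v * (2 ^ K * ω v))
              ≤⟨ ∑-mono V (λ v → *-monoʳ-≤ (T v) (Gw.grown-sat K X gr refl v)) ⟩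
            ∑ V (λ v → T v * (8 * N (λ v → ω v * X v) v))
              ≡⟨ trans (∑-cong V (λ v → *-swapˡ (T v) 8 _)) (∑-*ˡ V 8 _) ⟩
            8 * ∑ V (λ v → T v * N (λ v → ω v * X v) v)
              ≤⟨ *-monoʳ-≤ 8 (sparse-bound T B (λ v → ω v * X v) sp) ⟩
            8 * (B * weigh ω X)
              ≤⟨ *-monoʳ-≤ 8 (*-monoʳ-≤ B gain) ⟩
            8 * (B * (2 * (2 ^ K * weigh ω R.M)))
              ≡⟨ e₁ B (2 ^ K) (weigh ω R.M) ⟩
            2 ^ K * (16 * (B * weigh ω R.M)) ∎)
        }
        where
        open ≤-Reasoning
        ω : Fin n → ℕ
        ω v = wgt (c v)
        module Gw = Grow G (2 ^ K) c
        X : Fin n → ℕ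
        X = proj₁ (Gw.grown (0<2^ K) hdeg K)
        gr : Gw.Grown K X
        gr = proj₂ (Gw.grown (0<2^ K) hdeg K)
        module Gr = Gw.Grown gr
        c₁ : Config n
        c₁ = Gw.withFrc X
        module Rd = Rounded (rounded G K c₁ (proper-clr c₁ (λ _ → refl) p))
        c₂ : Config n
        c₂ = redo G c₁ Rd.y Rd.x Rd.s Rd.Z
        module R = Resolve G c₂
        e₁ : ∀ B S w → 8 * (B * (2 * (S * w))) ≡ S * (16 * (B * w))
        e₁ = solve-∀
        e₂ : ∀ P S u t F → P * (S * u) + (F * t + P * (S * u)) ≡ P * (2 * S * u) + F * t
        e₂ = solve-∀
        e₃ : ∀ F w t x → F * (2 * w + t) + x ≡ F * (2 * w) + x + F * t
        e₃ = solve-∀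
        S P F u tX tZ : ℕ
        S = 2 ^ K
        P = D ^ K
        F = (4 * D) ^ K
        u = weigh ω X
        tX = total ω X
        tZ = total ω Rd.Z
        main : P * (2 * S * u) ≤ F * (2 * weigh ω R.M) + suc D ^ K * tX
        main = +-cancelʳ-≤ (F * tZ) _ _ (begin
          P * (2 * S * u) + F * tZ                       ≤⟨ Rd.gain ⟩
          F * (2 * weigh ω Rd.Z) + suc D ^ K * tX        ≤⟨ +-monoˡ-≤ _ (*-monoʳ-≤ F (R.M-weight (Rd.Z≤1 Gr.small))) ⟩
          F * (2 * weigh ω R.M + tZ) + suc D ^ K * tX    ≡⟨ e₃ F (weigh ω R.M) tZ (suc D ^ K * tX) ⟩
          F * (2 * weigh ω R.M) + suc D ^ K * tX + F * tZ ∎)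
        -- Inflated by (1 + 1/D)^K ≤ 2, the cost takes at most one of the two copies of the utility
        -- in `main`; the other one is `half`.
        cheap : suc D ^ K * tX ≤ P * (S * u)
        cheap = begin
          suc D ^ K * tX          ≡⟨ cong (_* tX) (*-identityʳ (suc D ^ K)) ⟨
          suc D ^ K * 1 * tX      ≤⟨ *-monoˡ-≤ tX ([1+1/D]^k≤ D K 1 hD) ⟩
          P * 2 * tX              ≡⟨ *-assoc P 2 tX ⟩
          P * (2 * tX)            ≤⟨ *-monoʳ-≤ P Gr.cheap ⟩
          P * (S * u) ∎
        half : P * (S * u) ≤ F * (2 * weigh ω R.M)
        half = +-cancelʳ-≤ (P * (S * u)) _ _ (begin
          P * (S * u) + P * (S * u) ≡⟨ e₅ P S u ⟩
          P * (2 * S * u)           ≤⟨ main ⟩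
          F * (2 * weigh ω R.M) + suc D ^ K * tX ≤⟨ +-monoʳ-≤ (F * (2 * weigh ω R.M)) cheap ⟩
          F * (2 * weigh ω R.M) + P * (S * u) ∎)
          where
          e₅ : ∀ P S u → P * (S * u) + P * (S * u) ≡ P * (2 * S * u)
          e₅ = solve-∀
        gain : u ≤ 2 * (S * weigh ω R.M)
        gain = *-cancelˡ-≤ (P * S) {{m*n≢0 P S {{m^n≢0 D K {{m^n≢0 e q {{>-nonZero 0<e}}}}}} {{2^-≢0 K}}}} (begin
          P * S * u                     ≡⟨ *-assoc P S u ⟩
          P * (S * u)                   ≤⟨ half ⟩
          F * (2 * weigh ω R.M)         ≡⟨ cong (_* (2 * weigh ω R.M)) (4*D^K D K) ⟩
          S * S * P * (2 * weigh ω R.M) ≡⟨ e₆ P S (weigh ω R.M) ⟩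
          P * S * (2 * (S * weigh ω R.M)) ∎)
          where
          e₆ : ∀ P S w → S * S * P * (2 * w) ≡ P * S * (2 * (S * w))
          e₆ = solve-∀

isOn-positive : ∀ {m} → isOn m ≡ true → 0 < m
isOn-positive {suc m} _ = s≤s z≤n

-- One level of the local ratio recursion, with P = 16 ^ k and R = 15 ^ k:
-- t, t₁ are the weights of T before and after, q and r count B times the two parts of the gain.
ratio-step : ∀ P R t t₁ q r → R ≤ P → t ≤ 16 * q → t ≤ t₁ + q → P * t₁ ≤ P * r + R * t₁ →
  16 * P * t ≤ 16 * P * (q + r) + 15 * R * t
ratio-step P R t t₁ q r R≤P t≤16q t≤t₁+q ih = begin
  16 * P * t                                  ≡⟨ cong (λ z → 16 * z * t) P≡ ⟩
  16 * (R + E) * t                            ≡⟨ e₁ R E t ⟩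
  -- A share R of t is covered by q directly, through `t≤16q`; the remaining share E passes through
  -- the residual weight `t₁` and the recursion.
  15 * R * t + (R * t + 16 * (E * t))         ≤⟨ +-monoʳ-≤ (15 * R * t) (+-mono-≤ (*-monoʳ-≤ R t≤16q) (*-monoʳ-≤ 16 Et)) ⟩
  15 * R * t + (R * (16 * q) + 16 * (P * r + E * q)) ≡⟨ e₂ R E P t q r ⟩
  16 * (R + E) * q + 16 * (P * r) + 15 * R * t ≡⟨ cong (λ z → 16 * z * q + 16 * (P * r) + 15 * R * t) P≡ ⟨
  16 * P * q + 16 * (P * r) + 15 * R * t       ≡⟨ e₃ P q r (15 * R * t) ⟩
  16 * P * (q + r) + 15 * R * t ∎
  where
  open ≤-Reasoning
  E : ℕ
  E = P ∸ R
  P≡ : P ≡ R + E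
  P≡ = ≡-sym (m+[n∸m]≡n R≤P)
  e₁ : ∀ R E t → 16 * (R + E) * t ≡ 15 * R * t + (R * t + 16 * (E * t))
  e₁ = solve-∀
  e₂ : ∀ R E P t q r → 15 * R * t + (R * (16 * q) + 16 * (P * r + E * q)) ≡ 16 * (R + E) * q + 16 * (P * r) + 15 * R * t
  e₂ = solve-∀
  e₃ : ∀ P q r x → 16 * P * q + 16 * (P * r) + x ≡ 16 * P * (q + r) + x
  e₃ = solve-∀
  Et₁ : E * t₁ ≤ P * r
  Et₁ = +-cancelˡ-≤ (R * t₁) _ _ (begin
    R * t₁ + E * t₁ ≡⟨ *-distribʳ-+ t₁ R E ⟨
    (R + E) * t₁    ≡⟨ cong (_* t₁) P≡ ⟨
    P * t₁          ≤⟨ ih ⟩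
    P * r + R * t₁  ≡⟨ +-comm (P * r) (R * t₁) ⟩
    R * t₁ + P * r ∎)
  Et : E * t ≤ P * r + E * q
  Et = begin
    E * t            ≤⟨ *-monoʳ-≤ E t≤t₁+q ⟩
    E * (t₁ + q)     ≡⟨ *-distribˡ-+ E t₁ q ⟩
    E * t₁ + E * q   ≤⟨ +-monoˡ-≤ (E * q) Et₁ ⟩
    P * r + E * q ∎

module LocalRatioSpec (par : Params) (K : ℕ) {n : ℕ} (G : Graph n) where
  open Params par
  open Phases par
  open LocalRatio par K
  open Local G
  open Stage G
  open Closed G
  open Valid

  module Pop (ω M m : Fin n → ℕ) (valid-M : Valid ω M) (valid-m : Valid (λ v → ω v ∸ hit ω M v) m) (st : Fin n → List Bool) where
    open ≤-Reasoning

    near new ω₁ : Fin n → ℕ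
    near v = ∑ V (λ u → a v u * m u)
    new v = popMem (isOn (M v) ∷ st v) (m v) (near v)
    ω₁ v = ω v ∸ hit ω M v

    new-cases : ∀ v → (M v ≡ 0 × new v ≡ m v) ⊎ (M v ≡ 1 × near v ≡ 0 × new v ≡ 1) ⊎ (M v ≡ 1 × 0 < near v × new v ≡ m v)
    new-cases v with M v | ≤1 valid-M v
    ... | zero        | _ = inj₁ (refl , refl)
    ... | suc (suc _) | s≤s ()
    ... | suc zero    | _ with near v ≟ 0
    ...   | yes h = inj₂ (inj₁ (refl , h , ifEq-≡ h))
    ...   | no ¬h = inj₂ (inj₂ (refl , n≢0⇒n>0 ¬h , ifEq-≢ ¬h))

    heavy-m : ∀ v → 0 < m v → 0 < ω v
    heavy-m v h = ≤-trans (heavy valid-m v h) (m∸n≤m (ω v) (hit ω M v))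

    near-positive : ∀ v u → adj G v u ≡ true → 0 < m u → 0 < near v
    near-positive v u vu h = ≤-trans (≤-trans h (≤-reflexive (≡-sym (trans (cong (λ b → 𝟙ᵇ b * m u) vu) (*-identityˡ (m u))))))
      (∑-∈ (λ u → a v u * m u) (∈-allFin u))

    new-on : ∀ v → 0 < new v → 0 < m v ⊎ (0 < M v × near v ≡ 0)
    new-on v h with new-cases v
    ... | inj₁ (_ , e) = inj₁ (subst (0 <_) e h)
    ... | inj₂ (inj₁ (e , z , _)) = inj₂ (subst (0 <_) (≡-sym e) (s≤s z≤n) , z)
    ... | inj₂ (inj₂ (_ , _ , e)) = inj₁ (subst (0 <_) e h)

    valid : Valid ω new
    valid = record { ≤1 = new≤1 ; indep = new-indep ; heavy = new-heavy }
      where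
      new≤1 : ∀ v → new v ≤ 1
      new≤1 v with new-cases v
      ... | inj₁ (_ , e) = ≤-trans (≤-reflexive e) (≤1 valid-m v)
      ... | inj₂ (inj₁ (_ , _ , e)) = ≤-reflexive e
      ... | inj₂ (inj₂ (_ , _ , e)) = ≤-trans (≤-reflexive e) (≤1 valid-m v)
      new-heavy : ∀ v → 0 < new v → 0 < ω v
      new-heavy v h with new-on v h
      ... | inj₁ hm = heavy-m v hm
      ... | inj₂ (hM , _) = heavy valid-M v hM
      new-indep : ∀ v u → adj G v u ≡ true → 0 < new v → 0 < new u → ⊥
      new-indep v u vu hv hu with new-on v hv | new-on u hu
      ... | inj₁ mv | inj₁ mu = indep valid-m v u vu mv mu
      ... | inj₁ mv | inj₂ (_ , z) = <-irrefl (≡-sym z) (near-positive u v (trans (Graph.sym G u v) vu) mv)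
      ... | inj₂ (_ , z) | inj₁ mu = <-irrefl (≡-sym z) (near-positive v u vu mu)
      ... | inj₂ (Mv , _) | inj₂ (Mu , _) = indep valid-M v u vu Mv Mu

    -- A member of `M` either joins or has a later member among its neighbours, and that one is
    -- counted in `N m v`. If it is a later member already, `N m v` counts the node itself.
    pointwise : ∀ v → ω v * M v + ω v * m v ≤ ω v * new v + ω v * M v * N m v
    pointwise v with new-cases v
    ... | inj₁ (e , h) rewrite e | h | *-zeroʳ (ω v) = ≤-reflexive (≡-sym (+-identityʳ _))
    ... | inj₂ (inj₁ (e , z , h)) rewrite e | h | z | *-identityʳ (ω v) | +-identityʳ (m v) = ≤-refl
    ... | inj₂ (inj₂ (e , z , h)) rewrite e | h | *-identityʳ (ω v) =
          ≤-trans (≤-reflexive (+-comm (ω v) _)) (+-monoʳ-≤ (ω v * m v) (m≤m*n (ω v) (m v + near v) {{>-nonZero (≤-trans z (m≤n+m (near v) (m v)))}}))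

    -- Later members have positive residual weight, so the truncated subtraction was exact there.
    restored : ∀ v → ω v * m v ≡ ω₁ v * m v + m v * hit ω M v
    restored v with m v ≟ 0
    ... | yes e rewrite e | *-zeroʳ (ω v) | *-zeroʳ (ω₁ v) = refl
    ... | no ¬e = begin-equality
      ω v * m v                             ≡⟨ cong (_* m v) (m∸n+n≡m {ω v} {hit ω M v} (<⇒≤ (m∸n≢0⇒n<m (λ e → <-irrefl (≡-sym e) (heavy valid-m v (n≢0⇒n>0 ¬e)))))) ⟨
      (ω₁ v + hit ω M v) * m v            ≡⟨ *-distribʳ-+ (m v) (ω₁ v) _ ⟩
      ω₁ v * m v + hit ω M v * m v        ≡⟨ cong (ω₁ v * m v +_) (*-comm (hit ω M v) (m v)) ⟩
      ω₁ v * m v + m v * hit ω M v ∎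

    -- The weight that the subtraction took from the members of `m` is, by symmetry of the
    -- neighbourhoods, the weight of the members of `M` counted once for each later member nearby.
    -- This pays for all members of `M` that fail to join.
    gain : weigh ω M + weigh ω₁ m ≤ weigh ω new
    gain = +-cancelʳ-≤ (∑ V (λ v → ω v * M v * N m v)) _ _ (begin
      weigh ω M + weigh ω₁ m + ∑ V (λ v → ω v * M v * N m v)
        ≡⟨ cong (weigh ω M + weigh ω₁ m +_) (N-sym (λ v → ω v * M v) m) ⟩
      weigh ω M + weigh ω₁ m + ∑ V (λ v → m v * hit ω M v)
        ≡⟨ +-assoc (weigh ω M) _ _ ⟩
      weigh ω M + (weigh ω₁ m + ∑ V (λ v → m v * hit ω M v))
        ≡⟨ cong (weigh ω M +_) (trans (≡-sym (∑-+ V _ _)) (∑-cong V (λ v → ≡-sym (restored v)))) ⟩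
      weigh ω M + weigh ω m
        ≡⟨ ∑-+ V _ _ ⟨
      ∑ V (λ v → ω v * M v + ω v * m v)
        ≤⟨ ∑-mono V pointwise ⟩
      ∑ V (λ v → ω v * new v + ω v * M v * N m v)
        ≡⟨ ∑-+ V _ _ ⟩
      weigh ω new + ∑ V (λ v → ω v * M v * N m v) ∎)

  -- Each level multiplies the uncovered share of w(T) by 15/16. That the stack is `kept` guarantees
  -- that each level pops its own entry.
  record Solved (k : ℕ) (c : Config n) : Set where
    field
      kept  : ∀ v → stack (exec G (localRatio k) c v) ≡ stack (c v)
      valid : Valid (λ v → wgt (c v)) (λ v → mem (exec G (localRatio k) c v))
      large : ∀ T B → Sparse T B → 16 ^ k * weigh (λ v → wgt (c v)) T ≤
        16 ^ k * (B * weigh (λ v → wgt (c v)) (λ v → mem (exec G (localRatio k) c v))) + 15 ^ k * weigh (λ v → wgt (c v)) T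

  module _ (hdeg : ∀ v → 2 * ∑ V (a v) ≤ 2 ^ K) (hD : K * 2 ≤ D) where
    open Iteration G hdeg hD

    solved : ∀ k c → Proper L₀ c → Solved k c
    solved zero c p = record
      { kept = λ v → refl
      ; valid = record { ≤1 = λ v → z≤n ; indep = λ v u _ () ; heavy = λ v () }
      ; large = λ T B _ → m≤n+m _ (1 * (B * weigh (λ v → wgt (c v)) (λ v → 0))) }
    solved (suc k) c p = record
      { kept  = λ v → cong stack (final v)
      ; valid = record
          { ≤1    = λ v → subst (_≤ 1) (≡-sym (mem≡ v)) (≤1 Pp.valid v)
          ; indep = λ v u vu hv hu → indep Pp.valid v u vu (subst (0 <_) (mem≡ v) hv) (subst (0 <_) (mem≡ u) hu)
          ; heavy = λ v h → heavy Pp.valid v (subst (0 <_) (mem≡ v) h) }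
      ; large = λ T B sp → begin
          16 ^ suc k * weigh ω T
            ≤⟨ ratio-step (16 ^ k) (15 ^ k) (weigh ω T) (weigh Pp.ω₁ T) (B * weigh ω It.M) (B * weigh Pp.ω₁ m)
                 (^-monoˡ-≤ k (n≤1+n 15))
                 (It.large T B sp) (shrink T B sp) (IH.large T B sp) ⟩
          16 ^ suc k * (B * weigh ω It.M + B * weigh Pp.ω₁ m) + 15 ^ suc k * weigh ω T
            ≤⟨ +-monoˡ-≤ _ (*-monoʳ-≤ (16 ^ suc k) (≤-trans (≤-reflexive (≡-sym (*-distribˡ-+ B _ _))) (*-monoʳ-≤ B Pp.gain))) ⟩
          16 ^ suc k * (B * weigh ω Pp.new) + 15 ^ suc k * weigh ω T
            ≡⟨ cong (λ z → 16 ^ suc k * (B * z) + 15 ^ suc k * weigh ω T) (∑-cong V (λ v → cong (ω v *_) (mem≡ v))) ⟨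
          16 ^ suc k * (B * weigh ω (λ v → mem (exec G (localRatio (suc k)) c v))) + 15 ^ suc k * weigh ω T ∎
      }
      where
      open ≤-Reasoning
      ω : Fin n → ℕ
      ω v = wgt (c v)
      module It = Iterated (iterate c p)
      c₁ c₂ : Config n
      c₁ v = record (c v)
          { aux = It.y v ; nxt = It.x v ; slt = It.s v ; frc = It.Z v ; mem = It.M v
          ; wgt = wgt (c v) ∸ hit (λ v → wgt (c v)) It.M v ; stack = isOn (It.M v) ∷ stack (c v) }
      c₂ = exec G (localRatio k) c₁
      module IH = Solved (solved k c₁ (proper-clr c₁ (λ _ → refl) p))
      m : Fin n → ℕ
      m v = mem (c₂ v)
      module Pp = Pop ω It.M m It.valid IH.valid (λ v → stack (c v))
      final : exec G (localRatio (suc k)) c ≗ (λ v → record (c₂ v) { mem = Pp.new v ; stack = stack (c v) })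
      final = exec-then iteration (localRatio k ++ (pop ∷ [])) {c} {c₁} It.shape
        (exec-then (localRatio k) (pop ∷ []) {c₁} {c₂} (λ v → refl)
          (λ v → cong₂ (λ st z → record (c₂ v) { mem = popMem st (m v) z ; stack = popStack st }) (IH.kept v) (∑-received c₂ mem v)))
      mem≡ : ∀ v → mem (exec G (localRatio (suc k)) c v) ≡ Pp.new v
      mem≡ v = cong mem (final v)
      shrink : ∀ T B → Sparse T B → weigh ω T ≤ weigh Pp.ω₁ T + B * weigh ω It.M
      shrink T B sp = begin
        weigh ω T ≤⟨ ∑-mono V (λ v → ≤-trans (*-monoˡ-≤ (T v) (≤-trans (m≤n+m∸n (ω v) (hit ω It.M v)) (≤-reflexive (+-comm (hit ω It.M v) _)))) (≤-reflexive (trans (*-distribʳ-+ (T v) (Pp.ω₁ v) _) (cong (Pp.ω₁ v * T v +_) (*-comm (hit ω It.M v) (T v)))))) ⟩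
        ∑ V (λ v → Pp.ω₁ v * T v + T v * hit ω It.M v) ≡⟨ ∑-+ V _ _ ⟩
        weigh Pp.ω₁ T + ∑ V (λ v → T v * hit ω It.M v) ≤⟨ +-monoʳ-≤ (weigh Pp.ω₁ T) (sparse-bound T B (λ v → ω v * It.M v) sp) ⟩
        weigh Pp.ω₁ T + B * weigh ω It.M ∎

-- Colour reduction

copy : Instr
copy d ds = record d { clr = aux d }

plain : Node → Node → ℕ
plain _ _ = 1

recolourBits : ℕ → ℕ → ℕ
recolourBits Δ L = ⌈log₂ (Δ * (1 + 2 * L) + 1) ⌉

nextBits : ℕ → ℕ → ℕ
nextBits Δ L = 2 * recolourBits Δ L + 1

recolour : ℕ → ℕ → ℕ → List Instr
recolour Δ L zero    = []
recolour Δ L (suc j) = shot plain clr L (2 ^ recolourBits Δ L) ∷ copy ∷ recolour Δ (nextBits Δ L) j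

finalBits : ℕ → ℕ → ℕ → ℕ
finalBits Δ L zero    = L
finalBits Δ L (suc j) = finalBits Δ (nextBits Δ L) j

length-recolour : ∀ Δ L j → length (recolour Δ L j) ≡ 2 * j
length-recolour Δ L zero    = refl
length-recolour Δ L (suc j) = trans (cong (2 +_) (length-recolour Δ (nextBits Δ L) j)) (≡-sym (*-suc 2 j))

T*2T : ∀ τ → 2 ^ τ * (2 * 2 ^ τ) ≡ 2 ^ (2 * τ + 1)
T*2T τ = trans (≡-sym (^-distribˡ-+-* 2 τ (suc τ))) (cong (2 ^_) (lem τ))
  where
  lem : ∀ τ → τ + suc τ ≡ 2 * τ + 1
  lem = solve-∀

module Recolour {n : ℕ} (G : Graph n) (Δ : ℕ) where
  open Local G
  open Stage G

  module _ (hdeg : ∀ v → ∑ V (a v) ≤ Δ) where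

    recoloured : Config n → (y x : Fin n → ℕ) → Config n
    recoloured c y x v = record (c v) { aux = y v ; clr = x v }

    -- Linial's colour reduction from the same codes: with unit weights the best position has at
    -- most Δ(1 + 2L) / T conflicts. The code length exceeds Δ(1 + 2L), owing to the `+ 1` in
    -- `recolourBits`, so this is below 1 and the number of conflicts is 0.
    recolour-step : ∀ L c → Proper L c → let c′ = round G (shot plain clr L (2 ^ recolourBits Δ L)) c in
      Proper (nextBits Δ L) (recoloured c (λ v → aux (c′ v)) (λ v → aux (c′ v)))
    recolour-step L c p = record
      { clr-< = λ v → <-≤-trans (shot-< plain clr L T (c v) (received c v) 0<T) (≤-reflexive (T*2T (recolourBits Δ L)))
      ; clr-≢ = λ v u vu e → <-irrefl refl (begin-strict
          T                         ≡⟨ *-identityʳ T ⟨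
          T * 1                     ≤⟨ *-monoʳ-≤ T (begin
            1                                     ≡⟨ cong₂ (λ b z → 𝟙ᵇ b * 1 * z) vu (eq-≡ e) ⟨
            a v u * 1 * eq (A v) (A u)            ≤⟨ ∑-∈ (λ u → a v u * 1 * eq (A v) (A u)) (∈-allFin u) ⟩
            ∑ V (λ u → a v u * 1 * eq (A v) (A u)) ∎) ⟩
          T * ∑ V (λ u → a v u * 1 * eq (A v) (A u))
            ≤⟨ shot-conflict plain clr L T c 0<T (λ _ → refl) (clr-< p) v ⟩
          ∑ V (λ u → a v u * 1 * (T * eq (clr (c v)) (clr (c u)) + (1 + 2 * L)))
            ≡⟨ ∑-cong V (λ u → trans (*-assoc (a v u) 1 _) (trans (a*-cong v u (λ h →
                 trans (*-identityˡ _) (trans (cong (λ z → T * z + (1 + 2 * L)) (eq-≢ (clr-≢ p v u h))) (cong (_+ (1 + 2 * L)) (*-zeroʳ T)))))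
                 (*-comm (a v u) (1 + 2 * L)))) ⟩
          ∑ V (λ u → (1 + 2 * L) * a v u) ≡⟨ ∑-*ˡ V (1 + 2 * L) (a v) ⟩
          (1 + 2 * L) * ∑ V (a v)         ≤⟨ *-monoʳ-≤ (1 + 2 * L) (hdeg v) ⟩
          (1 + 2 * L) * Δ                 ≡⟨ *-comm (1 + 2 * L) Δ ⟩
          Δ * (1 + 2 * L)                 <⟨ m<m+n _ (s≤s z≤n) ⟩
          Δ * (1 + 2 * L) + 1             ≤⟨ n≤2^⌈log₂n⌉ (Δ * (1 + 2 * L) + 1) ⟩
          T ∎)
      }
      where
      open ≤-Reasoning
      T : ℕ
      T = 2 ^ recolourBits Δ L
      0<T : 0 < T
      0<T = 0<2^ (recolourBits Δ L)
      A : Fin n → ℕ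
      A v = aux (round G (shot plain clr L T) c v)

    recolour-spec : ∀ j L c → Proper L c → Σ (Fin n → ℕ) λ y → Σ (Fin n → ℕ) λ x →
      exec G (recolour Δ L j) c ≗ recoloured c y x × Proper (finalBits Δ L j) (recoloured c y x)
    recolour-spec zero    L c p = (λ v → aux (c v)) , (λ v → clr (c v)) , (λ v → refl) , p
    recolour-spec (suc j) L c p =
      proj₁ rec , proj₁ (proj₂ rec) , proj₁ (proj₂ (proj₂ rec)) , record { clr-< = clr-< q ; clr-≢ = clr-≢ q }
      where
      A : Fin n → ℕ
      A v = aux (round G (shot plain clr L (2 ^ recolourBits Δ L)) c v)
      rec = recolour-spec j (nextBits Δ L) (recoloured c A A) (recolour-step L c p)
      q = proj₂ (proj₂ (proj₂ rec))

4*[2+k]≤2^[2+k]+8 : ∀ k → 4 * (2 + k) ≤ 2 ^ (2 + k) + 8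
4*[2+k]≤2^[2+k]+8 zero    = m≤n+m 8 4
4*[2+k]≤2^[2+k]+8 (suc k) = begin
  4 * suc (2 + k)            ≡⟨ *-suc 4 (2 + k) ⟩
  4 + 4 * (2 + k)            ≤⟨ +-mono-≤ (*-monoʳ-≤ 4 (0<2^ k)) (4*[2+k]≤2^[2+k]+8 k) ⟩
  4 * 2 ^ k + (2 ^ (2 + k) + 8) ≡⟨ e₁ (2 ^ k) ⟩
  2 ^ suc (2 + k) + 8 ∎
  where
  open ≤-Reasoning
  e₁ : ∀ x → 4 * x + (2 * (2 * x) + 8) ≡ 2 * (2 * (2 * x)) + 8
  e₁ = solve-∀

4*k≤2^k+8 : ∀ k → 4 * k ≤ 2 ^ k + 8
4*k≤2^k+8 0 = z≤n
4*k≤2^k+8 1 = m≤n+m 4 6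
4*k≤2^k+8 (suc (suc k)) = 4*[2+k]≤2^[2+k]+8 k

4*⌊log₂⌋≤ : ∀ a → 4 * ⌊log₂ a ⌋ ≤ a + 8
4*⌊log₂⌋≤ zero    = z≤n
4*⌊log₂⌋≤ (suc a) = ≤-trans (4*k≤2^k+8 ⌊log₂ suc a ⌋) (+-monoˡ-≤ 8 (2^⌊log₂⌋≤ (suc a) (s≤s z≤n)))

1≤lg : ∀ x → 1 ≤ lg x
1≤lg x = ⌈log₂⌉-mono-≤ {2} (m≤n⊔m x 2)

≤2^lg : ∀ x → x ≤ 2 ^ lg x
≤2^lg x = ≤-trans (m≤m⊔n x 2) (n≤2^⌈log₂n⌉ (x ⊔ 2))

lg-mono : ∀ {x y} → x ≤ y → lg x ≤ lg y
lg-mono h = ⌈log₂⌉-mono-≤ (⊔-monoˡ-≤ 2 h)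

recolourBits≤ : ∀ Δ L → recolourBits Δ L ≤ 2 + lg Δ + ⌊log₂ L ⌋
recolourBits≤ Δ L = ≤2^⇒⌈log₂⌉≤ _ _ (begin
  Δ * (1 + 2 * L) + 1            ≤⟨ +-mono-≤ (*-monoˡ-≤ (1 + 2 * L) (≤2^lg Δ)) (0<2^ (lg Δ)) ⟩
  P * (1 + 2 * L) + P            ≡⟨ e₁ P L ⟩
  2 * P * (1 + L)                ≤⟨ *-monoʳ-≤ (2 * P) (<2^1+⌊log₂⌋ L) ⟩
  2 * P * (2 * 2 ^ ⌊log₂ L ⌋)    ≡⟨ e₂ P (2 ^ ⌊log₂ L ⌋) ⟩
  2 * (2 * (P * 2 ^ ⌊log₂ L ⌋))  ≡⟨ cong (λ z → 2 * (2 * z)) (^-distribˡ-+-* 2 (lg Δ) ⌊log₂ L ⌋) ⟨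
  2 ^ (2 + lg Δ + ⌊log₂ L ⌋) ∎)
  where
  open ≤-Reasoning
  P : ℕ
  P = 2 ^ lg Δ
  e₁ : ∀ P L → P * (1 + 2 * L) + P ≡ 2 * P * (1 + L)
  e₁ = solve-∀
  e₂ : ∀ P x → 2 * P * (2 * x) ≡ 2 * (2 * (P * x))
  e₂ = solve-∀

-- Bits of a palette of Δ^O(1) colours, where the reduction settles: a step gives at most 5 + 2
-- `lg Δ` + 2 log₂ L bits, and the constant 26 is large enough for both estimates below.
colourBits : ℕ → ℕ
colourBits Δ = 26 + 4 * lg Δ

nextBits≤ : ∀ Δ L → nextBits Δ L ≤ 5 + 2 * lg Δ + 2 * ⌊log₂ L ⌋
nextBits≤ Δ L = ≤-trans (+-monoˡ-≤ 1 (*-monoʳ-≤ 2 (recolourBits≤ Δ L))) (≤-reflexive (lem (lg Δ) ⌊log₂ L ⌋))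
  where
  lem : ∀ l x → 2 * (2 + l + x) + 1 ≡ 5 + 2 * l + 2 * x
  lem = solve-∀

nextBits-stable : ∀ Δ L A → colourBits Δ ≤ A → L ≤ A → nextBits Δ L ≤ A
nextBits-stable Δ L A hA hL = *-cancelˡ-≤ 2 (begin
  2 * nextBits Δ L                    ≤⟨ *-monoʳ-≤ 2 (≤-trans (nextBits≤ Δ L) (+-monoʳ-≤ (5 + 2 * lg Δ) (*-monoʳ-≤ 2 (⌊log₂⌋-mono-≤ hL)))) ⟩
  2 * (5 + 2 * lg Δ + 2 * ⌊log₂ A ⌋)  ≡⟨ e₁ (lg Δ) ⌊log₂ A ⌋ ⟩
  10 + 4 * lg Δ + 4 * ⌊log₂ A ⌋       ≤⟨ +-monoʳ-≤ (10 + 4 * lg Δ) (4*⌊log₂⌋≤ A) ⟩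
  10 + 4 * lg Δ + (A + 8)             ≤⟨ m≤m+n _ 8 ⟩
  10 + 4 * lg Δ + (A + 8) + 8         ≡⟨ e₂ (lg Δ) A ⟩
  colourBits Δ + A                    ≤⟨ +-monoˡ-≤ A hA ⟩
  A + A                               ≡⟨ cong (A +_) (+-identityʳ A) ⟨
  2 * A ∎)
  where
  open ≤-Reasoning
  e₁ : ∀ l x → 2 * (5 + 2 * l + 2 * x) ≡ 10 + 4 * l + 4 * x
  e₁ = solve-∀
  e₂ : ∀ l A → 10 + 4 * l + (A + 8) + 8 ≡ (26 + 4 * l) + A
  e₂ = solve-∀

finalBits-stable : ∀ Δ j L A → colourBits Δ ≤ A → L ≤ A → finalBits Δ L j ≤ A
finalBits-stable Δ zero    L A hA hL = hL
finalBits-stable Δ (suc j) L A hA hL = finalBits-stable Δ j (nextBits Δ L) A hA (nextBits-stable Δ L A hA hL)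

-- The bound has one summand from Δ and one from `⌊log₂ x ⌋`; doubling the larger gives the maximum.
-- The factor 4 reproduces itself from step to step, so the number of steps is log* with no constant
-- factor.
nextBits-shrinks : ∀ Δ L x → L ≤ 4 * x → nextBits Δ L ≤ colourBits Δ ⊔ 4 * ⌊log₂ x ⌋
nextBits-shrinks Δ L x hL = ≤-trans bound (split (≤-total (11 + 2 * lg Δ) (2 * ⌊log₂ x ⌋)))
  where
  open ≤-Reasoning
  e₁ : ∀ l f → 5 + 2 * l + 2 * (3 + f) ≡ 11 + 2 * l + 2 * f
  e₁ = solve-∀
  e₂ : ∀ f → 2 * f + 2 * f ≡ 4 * f
  e₂ = solve-∀
  e₃ : ∀ l → 11 + 2 * l + (11 + 2 * l) + 4 ≡ 26 + 4 * l
  e₃ = solve-∀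
  fl4 : ⌊log₂ 4 * x ⌋ ≤ 3 + ⌊log₂ x ⌋
  fl4 = ≤2^⇒⌊log₂⌋≤ (4 * x) _ (≤-trans (*-monoʳ-≤ 4 (<⇒≤ (<2^1+⌊log₂⌋ x))) (≤-reflexive (e₄ (2 ^ ⌊log₂ x ⌋))))
    where
    e₄ : ∀ p → 4 * (2 * p) ≡ 2 * (2 * (2 * p))
    e₄ = solve-∀
  bound : nextBits Δ L ≤ 11 + 2 * lg Δ + 2 * ⌊log₂ x ⌋
  bound = begin
    nextBits Δ L                          ≤⟨ nextBits≤ Δ L ⟩
    5 + 2 * lg Δ + 2 * ⌊log₂ L ⌋          ≤⟨ +-monoʳ-≤ (5 + 2 * lg Δ) (*-monoʳ-≤ 2 (≤-trans (⌊log₂⌋-mono-≤ hL) fl4)) ⟩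
    5 + 2 * lg Δ + 2 * (3 + ⌊log₂ x ⌋)    ≡⟨ e₁ (lg Δ) ⌊log₂ x ⌋ ⟩
    11 + 2 * lg Δ + 2 * ⌊log₂ x ⌋ ∎
  split : 11 + 2 * lg Δ ≤ 2 * ⌊log₂ x ⌋ ⊎ 2 * ⌊log₂ x ⌋ ≤ 11 + 2 * lg Δ →
    11 + 2 * lg Δ + 2 * ⌊log₂ x ⌋ ≤ colourBits Δ ⊔ 4 * ⌊log₂ x ⌋
  split (inj₁ h) = begin
    11 + 2 * lg Δ + 2 * ⌊log₂ x ⌋     ≤⟨ +-monoˡ-≤ _ h ⟩
    2 * ⌊log₂ x ⌋ + 2 * ⌊log₂ x ⌋     ≡⟨ e₂ ⌊log₂ x ⌋ ⟩
    4 * ⌊log₂ x ⌋                     ≤⟨ m≤n⊔m (colourBits Δ) _ ⟩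
    colourBits Δ ⊔ 4 * ⌊log₂ x ⌋ ∎
  split (inj₂ h) = begin
    11 + 2 * lg Δ + 2 * ⌊log₂ x ⌋     ≤⟨ +-monoʳ-≤ (11 + 2 * lg Δ) h ⟩
    11 + 2 * lg Δ + (11 + 2 * lg Δ)   ≤⟨ m≤m+n _ 4 ⟩
    11 + 2 * lg Δ + (11 + 2 * lg Δ) + 4 ≡⟨ e₃ (lg Δ) ⟩
    colourBits Δ                      ≤⟨ m≤m⊔n (colourBits Δ) (4 * ⌊log₂ x ⌋) ⟩
    colourBits Δ ⊔ 4 * ⌊log₂ x ⌋ ∎

iterLog : ℕ → ℕ → ℕ
iterLog zero    x = x
iterLog (suc k) x = iterLog k ⌊log₂ x ⌋

⌊log₂⌋< : ∀ x → 0 < x → ⌊log₂ x ⌋ < x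
⌊log₂⌋< x 0<x = <-≤-trans (n<2^n ⌊log₂ x ⌋) (2^⌊log₂⌋≤ x 0<x)

iterLog-logStarAux : ∀ f x → x ≤ f → iterLog (logStarAux f x) x ≤ 1
iterLog-logStarAux zero    x h = ≤-trans h z≤n
iterLog-logStarAux (suc f) x h with x ≤? 1
... | yes x≤1 = x≤1
... | no  x≰1 = iterLog-logStarAux f ⌊log₂ x ⌋
  (≤-pred (<-≤-trans (⌊log₂⌋< x (<-trans (s≤s z≤n) (≰⇒> x≰1))) h))

finalBits-iterLog : ∀ Δ j L x → L ≤ colourBits Δ ⊔ 4 * ⌊log₂ x ⌋ → finalBits Δ L j ≤ colourBits Δ ⊔ 4 * ⌊log₂ iterLog j x ⌋
finalBits-iterLog Δ zero    L x h = h
finalBits-iterLog Δ (suc j) L x h = finalBits-iterLog Δ j (nextBits Δ L) ⌊log₂ x ⌋ (next (≤-total (colourBits Δ) (4 * ⌊log₂ x ⌋)))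
  where
  next : colourBits Δ ≤ 4 * ⌊log₂ x ⌋ ⊎ 4 * ⌊log₂ x ⌋ ≤ colourBits Δ → nextBits Δ L ≤ colourBits Δ ⊔ 4 * ⌊log₂ ⌊log₂ x ⌋ ⌋
  next (inj₁ g) = nextBits-shrinks Δ L ⌊log₂ x ⌋ (≤-trans h (≤-reflexive (m≤n⇒m⊔n≡n g)))
  next (inj₂ g) = ≤-trans (nextBits-stable Δ L (colourBits Δ) ≤-refl (≤-trans h (≤-reflexive (m≥n⇒m⊔n≡m g)))) (m≤m⊔n (colourBits Δ) (4 * ⌊log₂ ⌊log₂ x ⌋ ⌋))

-- After `logStar ξ` steps the iterated logarithm is at most 1, its own logarithm vanishes, and only
-- `colourBits Δ` remains of the maximum.
finalBits-logStar : ∀ Δ ξ L → L ≤ ⌈log₂ ξ ⌉ → finalBits Δ L (logStar ξ) ≤ colourBits Δ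
finalBits-logStar Δ ξ L hL = ≤-trans (finalBits-iterLog Δ (logStar ξ) L ξ start)
  (⊔-lub ≤-refl (≤-trans (*-monoʳ-≤ 4 (⌊log₂⌋-mono-≤ (iterLog-logStarAux ξ ξ ≤-refl))) z≤n))
  where
  start : L ≤ colourBits Δ ⊔ 4 * ⌊log₂ ξ ⌋
  start with ⌊log₂ ξ ⌋ | ≤-trans hL (⌈log₂⌉≤1+⌊log₂⌋ ξ)
  ... | zero  | h = ≤-trans h (≤-trans (s≤s z≤n) (m≤m⊔n (colourBits Δ) 0))
  ... | suc f | h = ≤-trans h (≤-trans (≤-trans (m≤m+n _ (3 * f + 2)) (≤-reflexive (e₁ f))) (m≤n⊔m (colourBits Δ) _))
    where
    e₁ : ∀ f → 2 + f + (3 * f + 2) ≡ 4 * suc f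
    e₁ = solve-∀

-- Message sizes and numbers of rounds

∸-≤ : ∀ {x y} z → x ≤ y → x ∸ z ≤ y
∸-≤ {x} z h = ≤-trans (m∸n≤m x z) h

ifEq-≤ : ∀ x y {p q b} → p ≤ b → q ≤ b → ifEq x y p q ≤ b
ifEq-≤ x y hp hq with x ≟ y
... | yes h = ≤-trans (≤-reflexive (ifEq-≡ h)) hp
... | no ¬h = ≤-trans (≤-reflexive (ifEq-≢ ¬h)) hq

2*⌈/2⌉≤ : ∀ b x → x ≤ 2 ^ suc b → 2 * ⌈ x /2⌉ ≤ 2 ^ suc b
2*⌈/2⌉≤ b x h = *-monoʳ-≤ 2 (⌈n/2⌉≤ x (2 ^ b) h)

module Keeping (b : ℕ) where

  keeps-wgt : ∀ (f : Node → List Node → ℕ) (g : Node → List Bool) → (∀ d ds → Bounded b d → f d ds ≤ 2 ^ b) →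
    Keeps b (λ d ds → record d { wgt = f d ds ; stack = g d })
  keeps-wgt f g h d ds hd@(_ ∷ x ∷ c ∷ a ∷ s ∷ n ∷ m ∷ []) _ = h d ds hd ∷ x ∷ c ∷ a ∷ s ∷ n ∷ m ∷ []

  keeps-frc : ∀ (f : Node → List Node → ℕ) → (∀ d ds → Bounded b d → f d ds ≤ 2 ^ b) → Keeps b (λ d ds → record d { frc = f d ds })
  keeps-frc f h d ds hd@(w ∷ _ ∷ c ∷ a ∷ s ∷ n ∷ m ∷ []) _ = w ∷ h d ds hd ∷ c ∷ a ∷ s ∷ n ∷ m ∷ []

  keeps-aux : ∀ (f : Node → List Node → ℕ) → (∀ d ds → f d ds ≤ 2 ^ b) → Keeps b (λ d ds → record d { aux = f d ds })
  keeps-aux f h d ds (w ∷ x ∷ c ∷ _ ∷ s ∷ n ∷ m ∷ []) _ = w ∷ x ∷ c ∷ h d ds ∷ s ∷ n ∷ m ∷ []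

  keeps-nxt : ∀ (f : Node → List Node → ℕ) → (∀ d ds → nxt d ≤ 2 ^ b → f d ds ≤ 2 ^ b) → Keeps b (λ d ds → record d { nxt = f d ds })
  keeps-nxt f h d ds (w ∷ x ∷ c ∷ a ∷ s ∷ n ∷ m ∷ []) _ = w ∷ x ∷ c ∷ a ∷ s ∷ h d ds n ∷ m ∷ []

  keeps-mem : ∀ (f : Node → List Node → ℕ) (g : Node → List Bool) → (∀ d ds → mem d ≤ 2 ^ b → f d ds ≤ 2 ^ b) →
    Keeps b (λ d ds → record d { mem = f d ds ; stack = g d })
  keeps-mem f g h d ds (w ∷ x ∷ c ∷ a ∷ s ∷ n ∷ m ∷ []) _ = w ∷ x ∷ c ∷ a ∷ s ∷ n ∷ h d ds m ∷ []

  keeps-shot : ∀ k src L τ → 2 * τ + 1 ≤ b → Keeps b (shot k src L (2 ^ τ))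
  keeps-shot k src L τ h = keeps-aux _ (λ d ds → ≤-trans (<⇒≤ (shot-<′ d ds)) (≤-trans (≤-reflexive (T*2T τ)) (^-monoʳ-≤ 2 h)))
    where
    shot-<′ : ∀ d ds → aux (shot k src L (2 ^ τ) d ds) < 2 ^ τ * (2 * 2 ^ τ)
    shot-<′ d ds = *-+-< (2 * 2 ^ τ) (2 ^ τ) (argmin-< (2 ^ τ) _ (0<2^ τ)) (code-< L (2 ^ τ) _ (src d) (0<2^ τ))

  keeps-pick : ∀ e cap i → cap ≤ 2 ^ b → Keeps b (pick e cap i)
  keeps-pick e cap i h = keeps-nxt _ (λ d ds n → ifEq-≤ (aux d) i (≤-trans (m⊓n≤n _ cap) h) n)

  keeps-commit : Keeps b commit
  keeps-commit d ds (w ∷ x ∷ c ∷ a ∷ s ∷ n ∷ m ∷ []) _ = w ∷ x ∷ c ∷ a ∷ n ∷ n ∷ m ∷ []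

  keeps-restart : Keeps b restart
  keeps-restart d ds (w ∷ x ∷ c ∷ a ∷ s ∷ n ∷ m ∷ []) _ = w ∷ x ∷ c ∷ a ∷ z≤n ∷ n ∷ m ∷ []

  keeps-copy : Keeps b copy
  keeps-copy d ds (w ∷ x ∷ c ∷ a ∷ s ∷ n ∷ m ∷ []) _ = w ∷ x ∷ a ∷ a ∷ s ∷ n ∷ m ∷ []

  keeps-clear : Keeps b clear
  keeps-clear = keeps-mem (λ _ _ → 0) stack (λ _ _ _ → z≤n)

  keeps-halve : Keeps b halve
  keeps-halve = keeps-frc _ (λ { d ds (_ ∷ x ∷ _) → ≤-trans (⌊n/2⌋≤n (frc d)) x })

  keeps-unit : Keeps b unit
  keeps-unit = keeps-frc _ (λ _ _ _ → 0<2^ b)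

  keeps-resolve : Keeps b resolve
  keeps-resolve = keeps-mem _ stack (λ d ds _ → ifEq-≤ (∑ ds (λ q → frc q * loses d q)) 0
    (≤-trans (*-mono-≤ (lt≤1 0 (frc d)) (lt≤1 0 (wgt d))) (0<2^ b)) z≤n)

  keeps-residual : Keeps b residual
  keeps-residual = keeps-wgt _ (λ d → isOn (mem d) ∷ stack d) (λ { d ds (w ∷ _) → ∸-≤ (wgt d * mem d + ∑ ds (λ q → wgt q * mem q)) w })

  keeps-pop : Keeps b pop
  keeps-pop = keeps-mem (λ d ds → popMem (stack d) (mem d) (∑ ds mem)) (λ d → popStack (stack d)) (λ d ds h → bound (stack d) (mem d) (∑ ds mem) h)
    where
    bound : ∀ bs m s → m ≤ 2 ^ b → popMem bs m s ≤ 2 ^ b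
    bound []           m s h = h
    bound (false ∷ bs) m s h = h
    bound (true ∷ bs)  m s h = ifEq-≤ s 0 (0<2^ b) h

  keeps-grow : ∀ K → K ≤ b → Keeps b (grow (2 ^ K))
  keeps-grow K h = keeps-frc _ (λ { d ds (_ ∷ x ∷ _) → bound d ds x })
    where
    open ≤-Reasoning
    e₁ : ∀ w x → w * (8 * x) ≡ 8 * (w * x)
    e₁ = solve-∀
    bound : ∀ d ds → frc d ≤ 2 ^ b → frc (grow (2 ^ K) d ds) ≤ 2 ^ b
    bound d ds x with ifLe-cases (2 ^ K * wgt d) (8 * (wgt d * frc d + ∑ ds (λ q → wgt q * frc q))) (frc d) (2 * frc d)
    ... | inj₁ (_ , e) = ≤-trans (≤-reflexive e) x
    ... | inj₂ (l , e) = ≤-trans (≤-reflexive e) (≤-trans (*-monoˡ-≤ (frc d) {2} {8} (s≤s (s≤s z≤n)))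
      (≤-trans (<⇒≤ (*-cancelˡ-< (wgt d) _ _ (begin-strict
        wgt d * (8 * frc d) ≡⟨ e₁ (wgt d) (frc d) ⟩
        8 * (wgt d * frc d) ≤⟨ *-monoʳ-≤ 8 (m≤m+n (wgt d * frc d) _) ⟩
        8 * (wgt d * frc d + ∑ ds (λ q → wgt q * frc q)) <⟨ l ⟩
        2 ^ K * wgt d       ≡⟨ *-comm (2 ^ K) (wgt d) ⟩
        wgt d * 2 ^ K ∎))) (^-monoʳ-≤ 2 h)))

  -- Rounding up to an even number cannot pass `2 ^ b`, which is even because `1 ≤ b`.
  keeps-turn : ∀ A B i → 1 ≤ b → Keeps b (turn A B i)
  keeps-turn A B i 1≤b = keeps-frc _ (λ { d ds (_ ∷ x ∷ _) → ifEq-≤ (slt d) i (bound d ds x) x })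
    where
    bound : ∀ d ds → frc d ≤ 2 ^ b → ifLe (B * ∑ ds (λ q → (wgt d ⊓ wgt q) * frc q)) (A * wgt d) (2 * ⌈ frc d /2⌉) (2 * ⌊ frc d /2⌋) ≤ 2 ^ b
    bound d ds x with ifLe-cases (B * ∑ ds (λ q → (wgt d ⊓ wgt q) * frc q)) (A * wgt d) (2 * ⌈ frc d /2⌉) (2 * ⌊ frc d /2⌋)
    ... | inj₁ (_ , e) = ≤-trans (≤-reflexive e) (subst (λ k → 2 * ⌈ frc d /2⌉ ≤ 2 ^ k) (m∸n+n≡m′ 1≤b)
            (2*⌈/2⌉≤ (b ∸ 1) (frc d) (subst (λ k → frc d ≤ 2 ^ k) (≡-sym (m∸n+n≡m′ 1≤b)) x)))
      where
      m∸n+n≡m′ : 1 ≤ b → suc (b ∸ 1) ≡ b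
      m∸n+n≡m′ h = m+[n∸m]≡n h
    ... | inj₂ (_ , e) = ≤-trans (≤-reflexive e) (≤-trans (2*⌊n/2⌋≤n (frc d)) x)

  keeps-loop : ∀ m {f} → (∀ i → Keeps b (f i)) → All (Keeps b) (loop m f)
  keeps-loop zero    h = []
  keeps-loop (suc m) h = ++⁺ (keeps-loop m h) (h m ∷ [])

  keeps-repeat : ∀ k {p} → All (Keeps b) p → All (Keeps b) (repeat k p)
  keeps-repeat zero    h = []
  keeps-repeat (suc k) h = ++⁺ (keeps-repeat k h) h

  keeps-recolour : ∀ Δ L j → colourBits Δ ≤ b → L ≤ b → All (Keeps b) (recolour Δ L j)
  keeps-recolour Δ L zero    hΔ hL = []
  keeps-recolour Δ L (suc j) hΔ hL =
    keeps-shot plain clr L (recolourBits Δ L) (nextBits-stable Δ L b hΔ hL) ∷ keeps-copy ∷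
    keeps-recolour Δ (nextBits Δ L) j hΔ (nextBits-stable Δ L b hΔ hL)

-- Code lengths are rounded up to powers of two, so that the palette `T * (2 * T)` is a power of two
-- again.
shotBits : ℕ → ℕ → ℕ
shotBits η L = ⌈log₂ 4 * 2 ^ η * (1 + 2 * L) ⌉

L₁-of L₂-of : ℕ → ℕ → ℕ
L₁-of η L₀ = 2 * shotBits η L₀ + 1
L₂-of η L₀ = 2 * shotBits η (L₁-of η L₀) + 1

params : ℕ → ℕ → ℕ → Params
params q η L₀ = record
  { q = q ; e = 2 ^ η ; L₀ = L₀ ; T₁ = 2 ^ shotBits η L₀ ; L₁ = L₁-of η L₀
  ; T₂ = 2 ^ shotBits η (L₁-of η L₀) ; L₂ = L₂-of η L₀
  ; 0<e = 0<2^ η ; 0<T₁ = 0<2^ (shotBits η L₀) ; 0<T₂ = 0<2^ (shotBits η (L₁-of η L₀))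
  ; m₁≤ = ≤-reflexive (T*2T (shotBits η L₀)) ; m₂≤ = ≤-reflexive (T*2T (shotBits η (L₁-of η L₀)))
  ; t₁≤ = n≤2^⌈log₂n⌉ (4 * 2 ^ η * (1 + 2 * L₀)) ; t₂≤ = n≤2^⌈log₂n⌉ (4 * 2 ^ η * (1 + 2 * L₁-of η L₀)) }

module KeepingRounding (q η L₀ b : ℕ) (1≤b : 1 ≤ b) (h₁ : L₁-of η L₀ ≤ b) (h₂ : L₂-of η L₀ ≤ b) (hQ : (1 + η) * q ≤ b) where
  open Keeping b
  open Phases (params q η L₀)

  Q≤ : Q ≤ 2 ^ b
  Q≤ = ≤-trans (≤-reflexive (^-*-assoc 2 (1 + η) q)) (^-monoʳ-≤ 2 hQ)

  keeps-stage : All (Keeps b) stageₚ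
  keeps-stage = keeps-shot kernel clr L₀ (shotBits η L₀) h₁ ∷ keeps-shot kernel aux (L₁-of η L₀) (shotBits η (L₁-of η L₀)) h₂ ∷
    ++⁺ (keeps-loop (2 ^ L₂-of η L₀) (λ i → keeps-pick (2 * 2 ^ η) Q i Q≤)) (keeps-commit ∷ [])

  keeps-phase : ∀ j → All (Keeps b) (phase j)
  keeps-phase j = ++⁺ (keeps-restart ∷ keeps-repeat q keeps-stage)
    (++⁺ (keeps-loop Q (λ i → keeps-turn (D ^ j * 2 ^ suc j) (suc D ^ j) i 1≤b)) (keeps-halve ∷ []))

  keeps-rounding : ∀ K → All (Keeps b) (rounding K)
  keeps-rounding zero    = []
  keeps-rounding (suc j) = ++⁺ (keeps-phase j) (keeps-rounding j)

  module _ (K : ℕ) (hK : K ≤ b) where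
    open LocalRatio (params q η L₀) K

    keeps-localRatio : ∀ k → All (Keeps b) (localRatio k)
    keeps-localRatio zero    = keeps-clear ∷ []
    keeps-localRatio (suc k) = ++⁺ (++⁺ {xs = unit ∷ loop K (λ _ → grow (2 ^ K))} (keeps-unit ∷ keeps-loop K (λ _ → keeps-grow K hK))
      (++⁺ (keeps-rounding K) (keeps-resolve ∷ keeps-residual ∷ []))) (++⁺ (keeps-localRatio k) (keeps-pop ∷ []))

-- Kept opaque so that powers of two with these exponents are never unfolded.
opaque
  q₀ κ₀ : ℕ
  q₀ = 4
  κ₀ = 17

  q₀≡4 : q₀ ≡ 4
  q₀≡4 = refl

  κ₀≡17 : κ₀ ≡ 17
  κ₀≡17 = refl

phaseFactor : ℕ
phaseFactor = 2 + q₀ * (3 + 2 ^ κ₀) + 2 ^ q₀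

length-repeat : ∀ k p → length (repeat k p) ≡ k * length p
length-repeat zero    p = refl
length-repeat (suc k) p = trans (length-++ (repeat k p)) (trans (cong (_+ length p) (length-repeat k p)) (+-comm (k * length p) (length p)))

module PhaseLength (par : Params) where
  open Params par
  open Phases par

  phaseLength : ℕ
  phaseLength = 1 + q * (3 + 2 ^ L₂) + (Q + 1)

  length-stage : length stageₚ ≡ 3 + 2 ^ L₂
  length-stage = cong (2 +_) (trans (length-++ (loop (2 ^ L₂) (pick (2 * e) Q)))
    (trans (cong (_+ 1) (length-loop (2 ^ L₂) (pick (2 * e) Q))) (+-comm (2 ^ L₂) 1)))

  length-phase : ∀ j → length (phase j) ≡ phaseLength
  length-phase j = trans (length-++ (restart ∷ repeat q stageₚ)) (cong₂ _+_
    (cong suc (trans (length-repeat q stageₚ) (cong (q *_) length-stage)))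
    (trans (length-++ (loop Q turns)) (cong (_+ 1) (length-loop Q turns))))
    where
    turns : ℕ → Instr
    turns = turn (D ^ j * 2 ^ suc j) (suc D ^ j)

  length-rounding : ∀ K → length (rounding K) ≡ K * phaseLength
  length-rounding zero    = refl
  length-rounding (suc j) = trans (length-++ (phase j)) (cong₂ _+_ (length-phase j) (length-rounding j))

  length-localRatio : ∀ K k → length (LocalRatio.localRatio par K k) ≡ k * (4 + K + K * phaseLength) + 1
  length-localRatio K zero    = refl
  length-localRatio K (suc k) = trans (length-++ iteration)
    (trans (cong₂ _+_ length-iteration (trans (length-++ (localRatio k)) (cong (_+ 1) (length-localRatio K k))))
      (e₁ K (K * phaseLength) (k * (4 + K + K * phaseLength))))
    where
    open LocalRatio par K
    e₁ : ∀ K r x → (1 + K + (r + 2)) + (x + 1 + 1) ≡ (4 + K + r + x) + 1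
    e₁ = solve-∀
    length-iteration : length iteration ≡ 1 + K + (K * phaseLength + 2)
    length-iteration = trans (length-++ (unit ∷ loop K (λ _ → grow (2 ^ K))))
      (cong₂ _+_ (cong suc (length-loop K (λ _ → grow (2 ^ K)))) (trans (length-++ (rounding K)) (cong (_+ 2) (length-rounding K))))

shotBits≤ : ∀ η L → shotBits η L ≤ 2 + η + ⌈log₂ (1 + 2 * L) ⌉
shotBits≤ η L = ≤-trans (⌈log₂*⌉≤ (4 * 2 ^ η) (1 + 2 * L)) (+-monoˡ-≤ _
  (≤-trans (⌈log₂*⌉≤ 4 (2 ^ η)) (+-monoʳ-≤ 2 (≤-reflexive (⌈log₂2^n⌉≡n η)))))

⌈log₂64*2^⌉≤ : ∀ x y → x ≤ 64 * 2 ^ y → ⌈log₂ x ⌉ ≤ 6 + y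
⌈log₂64*2^⌉≤ x y h = ≤-trans (⌈log₂⌉-mono-≤ h) (≤-trans (⌈log₂*⌉≤ 64 (2 ^ y)) (+-monoʳ-≤ 6 (≤-reflexive (⌈log₂2^n⌉≡n y))))

module Choice (H l : ℕ) (0<H : 0 < H) (l≤H : l ≤ H) where
  open ≤-Reasoning

  -- A quarter of log₂ H, rounded up: the accuracy D = 2^(4η) of four digits lies between H and 16
  -- H. `L₀` is `colourBits Δ` when l = `lg Δ`.
  η L₀ : ℕ
  η  = (⌈log₂ H ⌉ + 3) / 4
  L₀ = 26 + 4 * l

  chosen : Params
  chosen = params q₀ η L₀

  open Phases chosen
  open PhaseLength chosen

  η*4≤ : η * 4 ≤ ⌈log₂ H ⌉ + 3
  η*4≤ = m/n*n≤m (⌈log₂ H ⌉ + 3) 4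

  ≤η*4 : ⌈log₂ H ⌉ ≤ η * 4
  ≤η*4 = +-cancelˡ-≤ 3 _ _ (begin
    3 + ⌈log₂ H ⌉                  ≡⟨ +-comm 3 ⌈log₂ H ⌉ ⟩
    ⌈log₂ H ⌉ + 3                  ≡⟨ m≡m%n+[m/n]*n (⌈log₂ H ⌉ + 3) 4 ⟩
    (⌈log₂ H ⌉ + 3) % 4 + η * 4    ≤⟨ +-monoˡ-≤ (η * 4) (≤-pred (m%n<n (⌈log₂ H ⌉ + 3) 4)) ⟩
    3 + η * 4 ∎)

  x : ℕ
  x = 2 ^ (η * q₀)

  η*q₀≡ : η * q₀ ≡ η * 4
  η*q₀≡ = cong (η *_) q₀≡4

  D≡ : D ≡ x
  D≡ = ^-*-assoc 2 η q₀

  H≤x : H ≤ x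
  H≤x = ≤-trans (n≤2^⌈log₂n⌉ H) (^-monoʳ-≤ 2 (≤-trans ≤η*4 (≤-reflexive (≡-sym η*q₀≡))))

  H≤D : H ≤ D
  H≤D = ≤-trans H≤x (≤-reflexive (≡-sym D≡))

  0<x : 0 < x
  0<x = 0<2^ (η * q₀)

  x≤16H : x ≤ 16 * H
  x≤16H = begin
    2 ^ (η * q₀)            ≤⟨ ^-monoʳ-≤ 2 (≤-trans (≤-reflexive η*q₀≡) η*4≤) ⟩
    2 ^ (⌈log₂ H ⌉ + 3)     ≡⟨ ^-distribˡ-+-* 2 ⌈log₂ H ⌉ 3 ⟩
    2 ^ ⌈log₂ H ⌉ * 8       ≤⟨ *-monoˡ-≤ 8 (2^⌈log₂⌉≤2* H 0<H) ⟩
    2 * H * 8               ≡⟨ e₁ H ⟩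
    16 * H ∎
    where
    e₁ : ∀ h → 2 * h * 8 ≡ 16 * h
    e₁ = solve-∀

  L₁≤ : L₁-of η L₀ ≤ 17 + 10 * η
  L₁≤ = begin
    2 * shotBits η L₀ + 1           ≤⟨ +-monoˡ-≤ 1 (*-monoʳ-≤ 2 (≤-trans (shotBits≤ η L₀) (+-monoʳ-≤ (2 + η) (⌈log₂64*2^⌉≤ _ (η * q₀) small)))) ⟩
    2 * (2 + η + (6 + η * q₀)) + 1  ≡⟨ cong (λ z → 2 * (2 + η + (6 + η * z)) + 1) q₀≡4 ⟩
    2 * (2 + η + (6 + η * 4)) + 1   ≡⟨ e₁ η ⟩
    17 + 10 * η ∎
    where
    e₁ : ∀ η → 2 * (2 + η + (6 + η * 4)) + 1 ≡ 17 + 10 * η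
    e₁ = solve-∀
    e₂ : ∀ l → 1 + 2 * (26 + 4 * l) ≡ 53 * 1 + 8 * l
    e₂ = solve-∀
    e₃ : ∀ x → 53 * x + 8 * x + 3 * x ≡ 64 * x
    e₃ = solve-∀
    small : 1 + 2 * L₀ ≤ 64 * x
    small = begin
      1 + 2 * L₀               ≡⟨ e₂ l ⟩
      53 * 1 + 8 * l           ≤⟨ +-mono-≤ (*-monoʳ-≤ 53 0<x) (*-monoʳ-≤ 8 (≤-trans l≤H H≤x)) ⟩
      53 * x + 8 * x           ≤⟨ m≤m+n _ (3 * x) ⟩
      53 * x + 8 * x + 3 * x   ≡⟨ e₃ x ⟩
      64 * x ∎

  -- After the first shot colours have O(η) bits, so the factor 1 + 2 L₁ in the second code length
  -- is at most 64 · 2^η. That length is thus O(4^η), and its square is O(2^(4η)) = O(D). This is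
  -- where four digits suffice, and 17 collects the constants.
  L₂≤ : L₂-of η L₀ ≤ κ₀ + η * q₀
  L₂≤ = begin
    2 * shotBits η (L₁-of η L₀) + 1 ≤⟨ +-monoˡ-≤ 1 (*-monoʳ-≤ 2 (≤-trans (shotBits≤ η (L₁-of η L₀)) (+-monoʳ-≤ (2 + η) (⌈log₂64*2^⌉≤ _ η small)))) ⟩
    2 * (2 + η + (6 + η)) + 1       ≡⟨ e₁ η ⟩
    17 + η * 4                      ≡⟨ cong₂ (λ k z → k + η * z) κ₀≡17 q₀≡4 ⟨
    κ₀ + η * q₀ ∎
    where
    e₁ : ∀ η → 2 * (2 + η + (6 + η)) + 1 ≡ 17 + η * 4
    e₁ = solve-∀
    e₂ : ∀ η → 1 + 2 * (17 + 10 * η) ≡ 35 * 1 + 20 * η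
    e₂ = solve-∀
    e₃ : ∀ x → 35 * x + 20 * x + 9 * x ≡ 64 * x
    e₃ = solve-∀
    small : 1 + 2 * L₁-of η L₀ ≤ 64 * 2 ^ η
    small = begin
      1 + 2 * L₁-of η L₀        ≤⟨ +-monoʳ-≤ 1 (*-monoʳ-≤ 2 L₁≤) ⟩
      1 + 2 * (17 + 10 * η)     ≡⟨ e₂ η ⟩
      35 * 1 + 20 * η           ≤⟨ +-mono-≤ (*-monoʳ-≤ 35 (0<2^ η)) (*-monoʳ-≤ 20 (<⇒≤ (n<2^n η))) ⟩
      35 * 2 ^ η + 20 * 2 ^ η   ≤⟨ m≤m+n _ (9 * 2 ^ η) ⟩
      35 * 2 ^ η + 20 * 2 ^ η + 9 * 2 ^ η ≡⟨ e₃ (2 ^ η) ⟩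
      64 * 2 ^ η ∎

  phaseLength≤ : phaseLength ≤ phaseFactor * (16 * H)
  phaseLength≤ = begin
    1 + q₀ * (3 + 2 ^ L₂-of η L₀) + (Q + 1)
      ≤⟨ +-mono-≤ (s≤s (*-monoʳ-≤ q₀ (+-monoʳ-≤ 3 (≤-trans (^-monoʳ-≤ 2 L₂≤) (≤-reflexive (^-distribˡ-+-* 2 κ₀ (η * q₀))))))) (≤-reflexive (cong (_+ 1) Q≡)) ⟩
    1 + q₀ * (3 + 2 ^ κ₀ * x) + (2 ^ q₀ * x + 1)
      ≡⟨ e₁ q₀ (2 ^ κ₀) x (2 ^ q₀) ⟩
    2 * 1 + q₀ * (3 * 1 + 2 ^ κ₀ * x) + 2 ^ q₀ * x
      ≤⟨ +-monoˡ-≤ (2 ^ q₀ * x) (+-mono-≤ (*-monoʳ-≤ 2 0<x) (*-monoʳ-≤ q₀ (+-monoˡ-≤ (2 ^ κ₀ * x) (*-monoʳ-≤ 3 0<x)))) ⟩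
    2 * x + q₀ * (3 * x + 2 ^ κ₀ * x) + 2 ^ q₀ * x
      ≡⟨ e₂ q₀ (2 ^ κ₀) x (2 ^ q₀) ⟩
    phaseFactor * x
      ≤⟨ *-monoʳ-≤ phaseFactor x≤16H ⟩
    phaseFactor * (16 * H) ∎
    where
    Q≡ : Q ≡ 2 ^ q₀ * x
    Q≡ = trans (^-*-assoc 2 (1 + η) q₀) (^-distribˡ-+-* 2 q₀ (η * q₀))
    e₁ : ∀ q k x t → 1 + q * (3 + k * x) + (t * x + 1) ≡ 2 * 1 + q * (3 * 1 + k * x) + t * x
    e₁ = solve-∀
    e₂ : ∀ q k x t → 2 * x + q * (3 * x + k * x) + t * x ≡ (2 + q * (3 + k) + t) * x
    e₂ = solve-∀

  bitsNeeded : ℕ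
  bitsNeeded = 47 + 10 * ⌈log₂ H ⌉

  module Fit (b : ℕ) (h : bitsNeeded ≤ b) where
    η≤ : η ≤ ⌈log₂ H ⌉ + 3
    η≤ = ≤-trans (m≤m*n η 4) η*4≤

    1≤b : 1 ≤ b
    1≤b = ≤-trans (s≤s z≤n) h

    fit₁ : L₁-of η L₀ ≤ b
    fit₁ = ≤-trans L₁≤ (≤-trans (+-monoʳ-≤ 17 (*-monoʳ-≤ 10 η≤)) (≤-trans (≤-reflexive (e₁ ⌈log₂ H ⌉)) h))
      where
      e₁ : ∀ c → 17 + 10 * (c + 3) ≡ 47 + 10 * c
      e₁ = solve-∀

    fit₂ : L₂-of η L₀ ≤ b
    fit₂ = ≤-trans L₂≤ (≤-trans (≤-reflexive (cong₂ _+_ κ₀≡17 η*q₀≡)) (≤-trans (+-monoʳ-≤ 17 η*4≤)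
      (≤-trans (m≤m+n _ (27 + 9 * ⌈log₂ H ⌉)) (≤-trans (≤-reflexive (e₁ ⌈log₂ H ⌉)) h))))
      where
      e₁ : ∀ c → 17 + (c + 3) + (27 + 9 * c) ≡ 47 + 10 * c
      e₁ = solve-∀

    fitQ : (1 + η) * q₀ ≤ b
    fitQ = ≤-trans (≤-reflexive (cong ((1 + η) *_) q₀≡4)) (≤-trans (+-monoʳ-≤ 4 η*4≤)
      (≤-trans (m≤m+n _ (40 + 9 * ⌈log₂ H ⌉)) (≤-trans (≤-reflexive (e₁ ⌈log₂ H ⌉)) h)))
      where
      e₁ : ∀ c → 4 + (c + 3) + (40 + 9 * c) ≡ 47 + 10 * c
      e₁ = solve-∀

    open KeepingRounding q₀ η L₀ b 1≤b fit₁ fit₂ fitQ public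

-- Global parameters of an instance and the initial configuration

≤-foldr-⊔ : ∀ {A : Set} (f : A → ℕ) {xs x} → x ∈ xs → f x ≤ foldr _⊔_ 0 (map f xs)
≤-foldr-⊔ f (here refl) = m≤m⊔n _ _
≤-foldr-⊔ f (there x∈)  = ≤-trans (≤-foldr-⊔ f x∈) (m≤n⊔m _ _)

foldr-⊔-≤ : ∀ {A : Set} (f : A → ℕ) xs {k} → (∀ x → f x ≤ k) → foldr _⊔_ 0 (map f xs) ≤ k
foldr-⊔-≤ f []       h = z≤n
foldr-⊔-≤ f (x ∷ xs) h = ⊔-lub (h x) (foldr-⊔-≤ f xs h)

∑-ones : ∀ {A : Set} (xs : List A) → ∑ xs (λ _ → 1) ≡ length xs
∑-ones []       = refl
∑-ones (x ∷ xs) = cong suc (∑-ones xs)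

𝟙ᵇ≤1 : ∀ b → 𝟙ᵇ b ≤ 1
𝟙ᵇ≤1 true  = ≤-refl
𝟙ᵇ≤1 false = z≤n

wt-∑ : ∀ {n} (ω : Fin n → ℕ) (S : Subset n) (m : Fin n → ℕ) → (∀ v → 𝟙ᵇ (S v) ≡ m v) → wt ω S ≡ ∑ (allFin n) (λ v → ω v * m v)
wt-∑ {n} ω S m h = ∑-cong (allFin n) (λ v → trans (lem (S v) (ω v)) (cong (ω v *_) (h v)))
  where
  lem : ∀ b x → (if b then x else 0) ≡ x * 𝟙ᵇ b
  lem true  x = ≡-sym (*-identityʳ x)
  lem false x = ≡-sym (*-zeroʳ x)

𝟙ᵇ-isOn : ∀ m → m ≤ 1 → 𝟙ᵇ (isOn m) ≡ m
𝟙ᵇ-isOn zero          _        = refl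
𝟙ᵇ-isOn (suc zero)    _        = refl
𝟙ᵇ-isOn (suc (suc m)) (s≤s ())

opaque
  -- One word width for all three parts. The largest demand is 147 + 20 `cId`, made by part 3, where
  -- the accuracy may be as fine as a polynomial in n.
  bitsPer : ℕ → ℕ
  bitsPer cId = 160 + 20 * cId

  ≤bitsPer : ∀ {k} cId → k ≤ 160 + 20 * cId → k ≤ bitsPer cId
  ≤bitsPer _ h = h

message-bound : ∀ k ℓ → 1 ≤ ℓ → 7 * suc (k * ℓ) ≤ 7 * suc k * ℓ
message-bound k ℓ h = ≤-trans (*-monoʳ-≤ 7 (+-monoˡ-≤ (k * ℓ) h)) (≤-reflexive (≡-sym (*-assoc 7 (suc k) ℓ)))

inputOf : (I : Instance) → Fin (n I) → LocalInput
inputOf I v = record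
  { netSize = n I ; maxDegree = maxDeg (G I) ; maxWeight = maxWt (w I) ; numColors = ξ I
  ; myId = ident I v ; myWeight = w I v ; myColor = toℕ (col I v)
  ; neighbors = map (λ u → ident I u , w I u) (neighbours (G I) v) }

-- Nodes start from their colour, or from their identifier if the colours are too large to be sent.
module Start (cId : ℕ) where

  idRange : LocalInput → ℕ
  idRange x = (LocalInput.netSize x ⊔ 2) ^ cId

  startNode : LocalInput → Node
  startNode x = record
    { wgt = LocalInput.myWeight x ; frc = 0
    ; clr = ifLe (LocalInput.numColors x) (idRange x) (LocalInput.myColor x) (LocalInput.myId x)
    ; aux = 0 ; slt = 0 ; nxt = 0 ; mem = 0 ; stack = [] }

  startBits : (ξ n : ℕ) → ℕ
  startBits ξ n = ⌈log₂ ξ ⊓ (n ⊔ 2) ^ cId ⌉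

  width : LocalInput → ℕ
  width x = bitsPer cId * lg (LocalInput.netSize x)

  module _ (I : Instance) where
    open Local (G I)
    open Stage (G I)

    Δ ℓ range bits₀ b : ℕ
    Δ     = maxDeg (G I)
    ℓ     = lg (n I)
    range = (n I ⊔ 2) ^ cId
    bits₀ = startBits (ξ I) (n I)
    b     = bitsPer cId * ℓ

    degree≤Δ : ∀ v → ∑ V (a v) ≤ Δ
    degree≤Δ v = ≤-foldr-⊔ (deg (G I)) (∈-allFin v)

    Δ≤n : Δ ≤ n I
    Δ≤n = foldr-⊔-≤ (deg (G I)) V (λ v → ≤-trans (∑-mono V (λ u → 𝟙ᵇ≤1 (adj (G I) v u))) (≤-reflexive (trans (∑-ones V) (length-tabulate (λ i → i)))))

    lgΔ≤ℓ : lg Δ ≤ ℓ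
    lgΔ≤ℓ = lg-mono Δ≤n

    1≤ℓ : 1 ≤ ℓ
    1≤ℓ = 1≤lg (n I)

    range≤ : range ≤ 2 ^ (cId * ℓ)
    range≤ = ≤-trans (^-monoˡ-≤ cId (n≤2^⌈log₂n⌉ (n I ⊔ 2))) (≤-reflexive (trans (^-*-assoc 2 ℓ cId) (cong (2 ^_) (*-comm ℓ cId))))

    bits₀≤ : bits₀ ≤ cId * ℓ
    bits₀≤ = ≤2^⇒⌈log₂⌉≤ _ _ (≤-trans (m⊓n≤n (ξ I) range) range≤)

    scale : ∀ k → k ≤ 160 + 20 * cId → k * ℓ ≤ b
    scale k h = *-monoˡ-≤ ℓ (≤bitsPer cId h)

    cId*ℓ≤b : cId * ℓ ≤ b
    cId*ℓ≤b = scale cId (≤-trans (m≤n*m cId 20) (m≤n+m (20 * cId) 160))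

    const≤ : ∀ k → k ≤ k * ℓ
    const≤ k = ≤-trans (≤-reflexive (≡-sym (*-identityʳ k))) (*-monoʳ-≤ k 1≤ℓ)

    colourBits≤b : colourBits Δ ≤ b
    colourBits≤b = ≤-trans (+-mono-≤ (const≤ 26) (*-monoʳ-≤ 4 lgΔ≤ℓ)) (≤-trans (≤-reflexive (≡-sym (*-distribʳ-+ ℓ 26 4)))
      (scale 30 (≤-trans (m≤m+n 30 130) (m≤m+n 160 (20 * cId)))))

    finalBits≤ : finalBits Δ bits₀ (logStar (ξ I)) ≤ colourBits Δ
    finalBits≤ = finalBits-logStar Δ (ξ I) bits₀ (⌈log₂⌉-mono-≤ (m⊓n≤m (ξ I) range))

    module _ (hid : ∀ v → ident I v < range) (hwt : maxWt (w I) < range) where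

      c₀ : Config (n I)
      c₀ v = startNode (inputOf I v)

      start-proper : Proper bits₀ c₀
      start-proper = record { clr-< = small ; clr-≢ = distinct }
        where
        small : ∀ v → clr (c₀ v) < 2 ^ bits₀
        small v with ξ I ≤? range
        ... | yes h = <-≤-trans (subst (_< ξ I ⊓ range) (≡-sym (ifLe-yes h)) (subst (toℕ (col I v) <_) (≡-sym (m≤n⇒m⊓n≡m h)) (toℕ<n (col I v)))) (n≤2^⌈log₂n⌉ (ξ I ⊓ range))
        ... | no ¬h = <-≤-trans (subst (_< ξ I ⊓ range) (≡-sym (ifLe-no ¬h)) (subst (ident I v <_) (≡-sym (m≥n⇒m⊓n≡n (<⇒≤ (≰⇒> ¬h)))) (hid v))) (n≤2^⌈log₂n⌉ (ξ I ⊓ range))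
        distinct : ∀ v u → adj (G I) v u ≡ true → clr (c₀ v) ≢ clr (c₀ u)
        distinct v u vu e with ξ I ≤? range
        ... | yes h = proper I v u vu (toℕ-injective (trans (≡-sym (ifLe-yes h)) (trans e (ifLe-yes h))))
        ... | no ¬h with ident-inj I v u (trans (≡-sym (ifLe-no ¬h)) (trans e (ifLe-no ¬h)))
        ...   | refl with trans (≡-sym vu) (irrefl (G I) v)
        ...     | ()

      w≤ : ∀ v → w I v ≤ 2 ^ (cId * ℓ)
      w≤ v = ≤-trans (≤-foldr-⊔ (w I) (∈-allFin v)) (≤-trans (<⇒≤ hwt) range≤)

      start-bounded : ∀ v → Bounded b (c₀ v)
      start-bounded v = ≤-trans (w≤ v) (^-monoʳ-≤ 2 cId*ℓ≤b) ∷ z≤n ∷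
        ≤-trans (<⇒≤ (clr-< start-proper v)) (^-monoʳ-≤ 2 (≤-trans bits₀≤ cId*ℓ≤b)) ∷ z≤n ∷ z≤n ∷ z≤n ∷ z≤n ∷ []

      keeps-reduction : All (Keeps b) (recolour Δ bits₀ (logStar (ξ I)))
      keeps-reduction = Keeping.keeps-recolour b Δ bits₀ (logStar (ξ I)) colourBits≤b (≤-trans bits₀≤ cId*ℓ≤b)

      reduced : Σ (Fin (n I) → ℕ) λ y → Σ (Fin (n I) → ℕ) λ x → let c₁ = Recolour.recoloured (G I) Δ degree≤Δ c₀ y x in
        exec (G I) (recolour Δ bits₀ (logStar (ξ I))) c₀ ≗ c₁ × Proper (colourBits Δ) c₁
      reduced = y , x , proj₁ (proj₂ (proj₂ r)) , proper-mono finalBits≤ p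
        where
        r = Recolour.recolour-spec (G I) Δ degree≤Δ (logStar (ξ I)) bits₀ c₀ start-proper
        y = proj₁ r
        x = proj₁ (proj₂ r)
        p = proj₂ (proj₂ (proj₂ r))

    short-messages : 7 * suc b ≤ 7 * suc (bitsPer cId) * ℓ
    short-messages = message-bound (bitsPer cId) ℓ 1≤ℓ

-- Parts 1 and 2

ℕtoℚᵘ : ∀ k → toℚᵘ (ℕtoℚ k) U.≃ mkℚᵘ (Z.+ k) 0
ℕtoℚᵘ k = QP.toℚᵘ-fromℚᵘ (mkℚᵘ (Z.+ k) 0)

ℕtoℚ-+ : ∀ a b → ℕtoℚ (a + b) ≡ ℕtoℚ a Q.+ ℕtoℚ b
ℕtoℚ-+ a b = QP.toℚᵘ-injective (UP.≃-trans (ℕtoℚᵘ (a + b)) (UP.≃-trans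
  (*≡* (cong (Z._* Z.1ℤ) (≡-sym (cong₂ Z._+_ (ZP.*-identityʳ (Z.+ a)) (ZP.*-identityʳ (Z.+ b))))))
  (UP.≃-sym (UP.≃-trans (QP.toℚᵘ-homo-+ (ℕtoℚ a) (ℕtoℚ b)) (UP.+-cong (ℕtoℚᵘ a) (ℕtoℚᵘ b))))))

ℕtoℚ-* : ∀ a b → ℕtoℚ (a * b) ≡ ℕtoℚ a Q.* ℕtoℚ b
ℕtoℚ-* a b = QP.toℚᵘ-injective (UP.≃-trans (ℕtoℚᵘ (a * b)) (UP.≃-trans
  (*≡* (cong (Z._* Z.1ℤ) (ZP.pos-* a b)))
  (UP.≃-sym (UP.≃-trans (QP.toℚᵘ-homo-* (ℕtoℚ a) (ℕtoℚ b)) (UP.*-cong (ℕtoℚᵘ a) (ℕtoℚᵘ b))))))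

ℕtoℚ-mono : ∀ {a b} → a ≤ b → ℕtoℚ a Q.≤ ℕtoℚ b
ℕtoℚ-mono {a} {b} h = QP.toℚᵘ-cancel-≤ (UP.≤-respˡ-≃ (UP.≃-sym (ℕtoℚᵘ a)) (UP.≤-respʳ-≃ (UP.≃-sym (ℕtoℚᵘ b))
  (*≤* (ZP.*-monoʳ-≤-nonNeg Z.1ℤ (Z.+≤+ h)))))

ℕtoℚ-nonNeg : ∀ a → 0ℚ Q.≤ ℕtoℚ a
ℕtoℚ-nonNeg a = ℕtoℚ-mono {0} {a} z≤n

ℕtoℚ-pos : ∀ {a} → 0 < a → 0ℚ Q.< ℕtoℚ a
ℕtoℚ-pos {a} h = QP.<-≤-trans (*<* (Z.+<+ (s≤s z≤n))) (ℕtoℚ-mono {1} {a} h)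

denominator-* : ∀ ε → 0ℚ Q.< ε → ε Q.* ℕtoℚ (↧ₙ ε) ≡ ℕtoℚ ∣ ↥ ε ∣
denominator-* ε@(mkℚ (Z.+ m) d _) _ = QP.toℚᵘ-injective (UP.≃-trans (UP.≃-trans (QP.toℚᵘ-homo-* ε (ℕtoℚ (suc d)))
  (UP.*-cong {toℚᵘ ε} UP.≃-refl (ℕtoℚᵘ (suc d)))) (UP.≃-trans (*≡* (trans (ZP.*-identityʳ (Z.+ m Z.* Z.+ suc d))
    (cong (λ k → Z.+ m Z.* Z.+ k) (≡-sym (*-identityʳ (suc d)))))) (UP.≃-sym (ℕtoℚᵘ m))))
denominator-* (mkℚ -[1+ m ] d _) (*<* ())

fraction-* : ∀ a d → (Z.+ a Q./ suc d) Q.* ℕtoℚ (suc d) ≡ ℕtoℚ a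
fraction-* a d = QP.toℚᵘ-injective (UP.≃-trans (UP.≃-trans (QP.toℚᵘ-homo-* (Z.+ a Q./ suc d) (ℕtoℚ (suc d)))
  (UP.*-cong (QP.toℚᵘ-fromℚᵘ (mkℚᵘ (Z.+ a) d)) (ℕtoℚᵘ (suc d)))) (UP.≃-trans (*≡* (trans (ZP.*-identityʳ (Z.+ a Z.* Z.+ suc d))
    (cong (λ k → Z.+ a Z.* Z.+ k) (≡-sym (*-identityʳ (suc d)))))) (UP.≃-sym (ℕtoℚᵘ a))))

numerator-pos : ∀ ε → 0ℚ Q.< ε → 0 < ∣ ↥ ε ∣
numerator-pos (mkℚ (Z.+ zero)  d _) (*<* (Z.+<+ ()))
numerator-pos (mkℚ (Z.+ suc m) d _) _ = s≤s z≤n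
numerator-pos (mkℚ -[1+ m ]  d _) (*<* ())

denominator-pos : ∀ ε → 0 < ↧ₙ ε
denominator-pos (mkℚ _ d _) = s≤s z≤n

≤-by-scaling : ∀ {p r} k → 0 < k → p Q.* ℕtoℚ k Q.≤ r Q.* ℕtoℚ k → p Q.≤ r
≤-by-scaling {p} {r} k h = QP.*-cancelʳ-≤-pos (ℕtoℚ k) {{positive (ℕtoℚ-pos h)}}

[1-ε]*≤ : ∀ ε t r → 0ℚ Q.< ε → ↧ₙ ε * t ≤ ↧ₙ ε * r + ∣ ↥ ε ∣ * t → (1ℚ - ε) Q.* ℕtoℚ t Q.≤ ℕtoℚ r
[1-ε]*≤ ε t r 0<ε h = ≤-by-scaling q (denominator-pos ε) (begin
  (1ℚ - ε) Q.* ℕtoℚ t Q.* ℕtoℚ q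
    ≡⟨ solve 3 (λ e t q → (con 1ℚ :- e) :* t :* q := q :* t :- (e :* q) :* t) refl ε (ℕtoℚ t) (ℕtoℚ q) ⟩
  ℕtoℚ q Q.* ℕtoℚ t Q.- (ε Q.* ℕtoℚ q) Q.* ℕtoℚ t
    ≡⟨ cong₂ Q._-_ (≡-sym (ℕtoℚ-* q t)) (trans (cong (Q._* ℕtoℚ t) (denominator-* ε 0<ε)) (≡-sym (ℕtoℚ-* p t))) ⟩
  ℕtoℚ (q * t) Q.- ℕtoℚ (p * t)
    ≤⟨ QP.+-monoˡ-≤ (Q.- ℕtoℚ (p * t)) (ℕtoℚ-mono h) ⟩
  ℕtoℚ (q * r + p * t) Q.- ℕtoℚ (p * t)
    ≡⟨ cong (Q._- ℕtoℚ (p * t)) (trans (ℕtoℚ-+ (q * r) (p * t)) (cong (Q._+ ℕtoℚ (p * t)) (ℕtoℚ-* q r))) ⟩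
  ℕtoℚ q Q.* ℕtoℚ r Q.+ ℕtoℚ (p * t) Q.- ℕtoℚ (p * t)
    ≡⟨ solve 3 (λ q r x → q :* r :+ x :- x := r :* q) refl (ℕtoℚ q) (ℕtoℚ r) (ℕtoℚ (p * t)) ⟩
  ℕtoℚ r Q.* ℕtoℚ q ∎)
  where
  open QP.≤-Reasoning
  open +-*-Solver
  p q : ℕ
  p = ∣ ↥ ε ∣
  q = ↧ₙ ε

≤*ceilDiv : ∀ a p → 0 < p → a ≤ p * ceilDiv a p
≤*ceilDiv a (suc b) _ = +-cancelʳ-≤ b _ _ (begin
  a + b                                              ≡⟨ m≡m%n+[m/n]*n (a + b) (suc b) ⟩
  (a + b) % suc b + (a + b) / suc b * suc b          ≤⟨ +-mono-≤ (≤-pred (m%n<n (a + b) (suc b))) (≤-reflexive (*-comm ((a + b) / suc b) (suc b))) ⟩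
  b + suc b * ((a + b) / suc b)                      ≡⟨ +-comm b _ ⟩
  suc b * ((a + b) / suc b) + b ∎)
  where open ≤-Reasoning

↧≤↥*⌈1/ε⌉ : ∀ ε → 0ℚ Q.< ε → ↧ₙ ε ≤ ∣ ↥ ε ∣ * ceilDivQ 1 ε
↧≤↥*⌈1/ε⌉ ε h = ≤-trans (≤-reflexive (≡-sym (*-identityˡ (↧ₙ ε)))) (≤*ceilDiv (1 * ↧ₙ ε) ∣ ↥ ε ∣ (numerator-pos ε h))

halving : ∀ p q m j → p ^ m * 2 ≤ q ^ m → p ^ (m * j) * 2 ^ j ≤ q ^ (m * j)
halving p q m j h = begin
  p ^ (m * j) * 2 ^ j    ≡⟨ cong (_* 2 ^ j) (^-*-assoc p m j) ⟨
  (p ^ m) ^ j * 2 ^ j    ≡⟨ ^-distribʳ-* (p ^ m) 2 j ⟨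
  (p ^ m * 2) ^ j        ≤⟨ ^-monoˡ-≤ j h ⟩
  (q ^ m) ^ j            ≡⟨ ^-*-assoc q m j ⟩
  q ^ (m * j) ∎
  where open ≤-Reasoning

-- (15/16)^16 ≤ 1/2 is decided by evaluation. Hence 16 j repetitions leave an error of at most 2^-j,
-- which is at most ε for j = `lg` ⌈1/ε⌉.
halving₁₆ : ∀ j → 15 ^ (16 * j) * 2 ^ j ≤ 16 ^ (16 * j)
halving₁₆ j = halving 15 16 16 j (≤ᵇ⇒≤ (15 ^ 16 * 2) (16 ^ 16) _)

-- The chain q/p ≤ 1/r ≤ 1/E ≤ num/den for the relative error, without division.
precision : ∀ p q r t s num den E → 0 < p → 0 < r → q * r ≤ p → E ≤ r → den ≤ num * E →
  p * t ≤ p * s + q * t → den * t ≤ den * s + num * t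
precision p q r t s num den E 0<p 0<r qr≤p E≤r den≤ h = *-cancelˡ-≤ (r * p) {{>-nonZero (*-mono-≤ 0<r 0<p)}} (begin
  r * p * (den * t)                             ≡⟨ e₁ r p den t ⟩
  r * den * (p * t)                             ≤⟨ *-monoʳ-≤ (r * den) h ⟩
  r * den * (p * s + q * t)                     ≡⟨ e₂ r den p s q t ⟩
  r * p * (den * s) + q * r * (den * t)         ≤⟨ +-monoʳ-≤ (r * p * (den * s)) (*-mono-≤ qr≤p (*-monoˡ-≤ t (≤-trans den≤ (*-monoʳ-≤ num E≤r)))) ⟩
  r * p * (den * s) + p * (num * r * t)         ≡⟨ e₃ r p den s num t ⟩
  r * p * (den * s + num * t) ∎)
  where
  open ≤-Reasoning
  e₁ : ∀ r p d t → r * p * (d * t) ≡ r * d * (p * t)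
  e₁ = solve-∀
  e₂ : ∀ r d p s q t → r * d * (p * s + q * t) ≡ r * p * (d * s) + q * r * (d * t)
  e₂ = solve-∀
  e₃ : ∀ r p d s n t → r * p * (d * s) + p * (n * r * t) ≡ r * p * (d * s + n * t)
  e₃ = solve-∀

rounds-bound : ∀ F P l l′ j ls → P ≤ F * (16 * ((l + 3) * 2)) → 1 ≤ l → l ≤ l′ → 1 ≤ j →
  2 * ls + (16 * j * (4 + (l + 3) + (l + 3) * P) + 1) ≤ (2 + 256 * (2 + 32 * F) + 1) * (l′ ^ 2 * j + ls)
rounds-bound F P l l′ j ls hP 1≤l l≤l′ 1≤j = begin
  2 * ls + (16 * j * (4 + K + K * P) + 1)
    ≤⟨ +-monoʳ-≤ (2 * ls) (+-mono-≤ (*-monoʳ-≤ (16 * j) (≤-trans inner (*-monoʳ-≤ (2 + 32 * F) KK))) (*-mono-≤ 1≤l² 1≤j)) ⟩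
  2 * ls + (16 * j * ((2 + 32 * F) * (16 * X)) + X * j)
    ≤⟨ m≤m+n _ (2 * (X * j) + (256 * (2 + 32 * F) + 1) * ls) ⟩
  2 * ls + (16 * j * ((2 + 32 * F) * (16 * X)) + X * j) + (2 * (X * j) + (256 * (2 + 32 * F) + 1) * ls)
    ≡⟨ e₁ (2 + 32 * F) j X ls ⟩
  (2 + 256 * (2 + 32 * F) + 1) * (X * j + ls) ∎
  where
  open ≤-Reasoning
  K X : ℕ
  K = l + 3
  X = l′ ^ 2
  e₁ : ∀ f j x s → 2 * s + (16 * j * (f * (16 * x)) + x * j) + (2 * (x * j) + (256 * f + 1) * s) ≡ (2 + 256 * f + 1) * (x * j + s)
  e₁ = solve-∀
  e₂ : ∀ l → (l + 3 * l) * (l + 3 * l) ≡ 16 * (l * (l * 1))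
  e₂ = solve-∀
  e₃ : ∀ K F → K * K + K * K + K * (F * (16 * (K * 2))) ≡ (2 + 32 * F) * (K * K)
  e₃ = solve-∀
  1≤l² : 1 ≤ X
  1≤l² = ^-monoˡ-≤ 2 (≤-trans 1≤l l≤l′)
  KK : K * K ≤ 16 * X
  KK = begin
    K * K                      ≤⟨ *-mono-≤ K≤ K≤ ⟩
    (l + 3 * l) * (l + 3 * l)  ≡⟨ e₂ l ⟩
    16 * l ^ 2                 ≤⟨ *-monoʳ-≤ 16 (^-monoˡ-≤ 2 l≤l′) ⟩
    16 * X ∎
    where
    K≤ : K ≤ l + 3 * l
    K≤ = +-monoʳ-≤ l (*-monoʳ-≤ 3 1≤l)
  4≤K : 4 ≤ K
  4≤K = +-monoˡ-≤ 3 1≤l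
  K≤KK : K ≤ K * K
  K≤KK = m≤m*n K K {{>-nonZero (≤-trans (s≤s z≤n) 4≤K)}}
  inner : 4 + K + K * P ≤ (2 + 32 * F) * (K * K)
  inner = begin
    4 + K + K * P               ≤⟨ +-mono-≤ (+-mono-≤ (≤-trans 4≤K K≤KK) K≤KK) (*-monoʳ-≤ K hP) ⟩
    K * K + K * K + K * (F * (16 * (K * 2))) ≡⟨ e₃ K F ⟩
    (2 + 32 * F) * (K * K) ∎

opaque
  roundFactor : ℕ
  roundFactor = 2 + 256 * (2 + 32 * phaseFactor) + 1

  rounds≤ : ∀ P l l′ j ls → P ≤ phaseFactor * (16 * ((l + 3) * 2)) → 1 ≤ l → l ≤ l′ → 1 ≤ j →
    2 * ls + (16 * j * (4 + (l + 3) + (l + 3) * P) + 1) ≤ roundFactor * (l′ ^ 2 * j + ls)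
  rounds≤ = rounds-bound phaseFactor

on-independent : ∀ {n} (G : Graph n) (m : Fin n → ℕ) → (∀ u v → adj G u v ≡ true → 0 < m u → 0 < m v → ⊥) →
  Independent G (λ v → isOn (m v))
on-independent G m h u v hu hv with adj G u v in uv
... | false = refl
... | true  = ⊥-elim (h u v uv (isOn-positive hu) (isOn-positive hv))

on-weight : ∀ {n} (ω : Fin n → ℕ) (m m′ : Fin n → ℕ) → (∀ v → m v ≡ m′ v) → (∀ v → m′ v ≤ 1) →
  wt ω (λ v → isOn (m v)) ≡ ∑ (allFin n) (λ v → ω v * m′ v)
on-weight ω m m′ h h≤1 = wt-∑ ω (λ v → isOn (m v)) m′ (λ v → trans (cong (λ z → 𝟙ᵇ (isOn z)) (h v)) (𝟙ᵇ-isOn (m′ v) (h≤1 v)))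

logFactor : ℕ → ℕ
logFactor Δ = lg Δ + 3

-- With K = `logFactor Δ` binary digits the scale 2^K is at least 2Δ, as the start of the doubling
-- requires, and H = 2K makes the accumulated rounding loss at most a factor 2.
module Chosen₁ (Δ : ℕ) where
  0<H : 0 < logFactor Δ * 2
  0<H = ≤-trans (≤-trans (1≤lg Δ) (m≤m+n (lg Δ) 3)) (m≤m*n (logFactor Δ) 2)

  open Choice (logFactor Δ * 2) (lg Δ) 0<H (≤-trans (m≤m+n (lg Δ) 3) (m≤m*n (logFactor Δ) 2)) public
  open PhaseLength chosen public
  open LocalRatio chosen (logFactor Δ) public using (localRatio)

module Ratio (cId : ℕ) (ε : ℚ) (0<ε : 0ℚ Q.< ε) where
  open Start cId

  j : ℕ
  j = lg (ceilDivQ 1 ε)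

  opaque
    mainProgram : (Δ ξ n : ℕ) → List Instr
    mainProgram Δ ξ n = recolour Δ (startBits ξ n) (logStar ξ) ++ Chosen₁.localRatio Δ (16 * j)

    mainProgram≡ : ∀ Δ ξ n → mainProgram Δ ξ n ≡ recolour Δ (startBits ξ n) (logStar ξ) ++ Chosen₁.localRatio Δ (16 * j)
    mainProgram≡ Δ ξ n = refl

  -- If all weights vanish, `lg (Δ * W)` no longer dominates `lg Δ`; but then the empty set is
  -- optimal, and no round is spent.
  program : LocalInput → List Instr
  program x = ifEq (LocalInput.maxWeight x) 0 []
    (mainProgram (LocalInput.maxDegree x) (LocalInput.numColors x) (LocalInput.netSize x))

  algorithm : Algorithm
  algorithm = compile width startNode program

  -- `l′`, `T` and `B` belong to the analysis, so one algorithm per ε serves parts 1 and 2. `l′` is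
  -- `lg (Δ * W)` in part 1 and `lg Δ` in part 2; for W = 0 the required comparison with `lg Δ` may
  -- fail in part 1.
  module _ (I : Instance) (l′ : ℕ) (l≤l′ : maxWt (w I) ≢ 0 → lg (maxDeg (G I)) ≤ l′) (T : Fin (n I) → ℕ) (B : ℕ) where
    open Local (G I)
    open Stage (G I)

    bound : ℕ
    bound = roundFactor * (l′ ^ 2 * j + logStar (ξ I))

    weightOf : (Fin (n I) → ℕ) → ℕ
    weightOf m = ∑ V (λ v → w I v * m v)

    Quality : Subset (n I) → Set
    Quality S = (1ℚ - ε) Q.* ℕtoℚ (weightOf T) Q.≤ ℕtoℚ B Q.* ℕtoℚ (wt (w I) S)

    module Weightless (W≡0 : maxWt (w I) ≡ 0) where
      open Simulation width startNode program I (b I) []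

      solution : Solves cId (7 * suc (bitsPer cId)) algorithm I bound Quality
      solution = solves cId (7 * suc (bitsPer cId)) bound Quality (λ v → ifEq-≡ W≡0) (λ v → refl) (short-messages I)
        (λ hid hwt → (start-bounded I hid hwt , []) , z≤n , (λ u v ()) ,
          QP.≤-trans (QP.≤-reflexive (trans (cong (λ t → (1ℚ - ε) Q.* ℕtoℚ t) zero-weight) (QP.*-zeroʳ (1ℚ - ε))))
            (QP.≤-trans (ℕtoℚ-nonNeg (B * wt (w I) (λ _ → false))) (QP.≤-reflexive (ℕtoℚ-* B (wt (w I) (λ _ → false))))))
        where
        zero-weight : weightOf T ≡ 0
        zero-weight = trans (∑-cong V (λ v → cong (_* T v) (n≤0⇒n≡0 (≤-trans (≤-foldr-⊔ (w I) (∈-allFin v)) (≤-reflexive W≡0))))) (∑-zero V)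

    module Weighted (W≢0 : maxWt (w I) ≢ 0) (sparse : ∀ v → T v + ∑ V (λ u → a v u * T u) ≤ B) where
      Δ₀ k : ℕ
      Δ₀ = maxDeg (G I)
      k  = 16 * j
      module C = Chosen₁ Δ₀
      p₀ p₁ : List Instr
      p₀ = mainProgram Δ₀ (ξ I) (n I)
      p₁ = recolour Δ₀ (bits₀ I) (logStar (ξ I)) ++ C.localRatio k
      p₀≡p₁ : p₀ ≡ p₁
      p₀≡p₁ = mainProgram≡ Δ₀ (ξ I) (n I)
      open Simulation width startNode program I (b I) p₀ using (solves)

      module _ (hid : ∀ v → ident I v < range I) (hwt : maxWt (w I) < range I) where
        K≤b : logFactor Δ₀ ≤ b I
        K≤b = ≤-trans (+-mono-≤ (lgΔ≤ℓ I) (const≤ I 3)) (scale I 4 (≤-trans (m≤m+n 4 156) (m≤m+n 160 (20 * cId))))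

        fits : C.bitsNeeded ≤ b I
        fits = ≤-trans (+-monoʳ-≤ 47 (*-monoʳ-≤ 10 (≤-trans (⌈log₂*⌉≤ (logFactor Δ₀) 2) (+-monoˡ-≤ 1 (≤-trans (⌈log₂⌉≤ (logFactor Δ₀)) (+-monoˡ-≤ 3 (lgΔ≤ℓ I)))))))
          (≤-trans (generic (ℓ I) (1≤ℓ I)) (scale I 97 (≤-trans (m≤m+n 97 63) (m≤m+n 160 (20 * cId)))))
          where
          e₁ : ∀ l → 47 + 10 * (l + 3 + 1) ≡ 87 * 1 + 10 * l
          e₁ = solve-∀
          generic : ∀ l → 1 ≤ l → 47 + 10 * (l + 3 + 1) ≤ 97 * l
          generic l h = ≤-trans (≤-reflexive (e₁ l)) (≤-trans (+-monoˡ-≤ (10 * l) (*-monoʳ-≤ 87 h)) (≤-reflexive (≡-sym (*-distribʳ-+ l 87 10))))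

        module F = C.Fit (b I) fits

        keeps : All (Keeps (b I)) p₀
        keeps = subst (All (Keeps (b I))) (≡-sym p₀≡p₁) (++⁺ (keeps-reduction I hid hwt) (F.keeps-localRatio (logFactor Δ₀) K≤b k))

        rounds : length p₀ ≤ bound
        rounds = ≤-trans (≤-reflexive (trans (cong length p₀≡p₁) (trans (length-++ (recolour Δ₀ (bits₀ I) (logStar (ξ I))))
            (cong₂ _+_ (length-recolour Δ₀ (bits₀ I) (logStar (ξ I))) (C.length-localRatio (logFactor Δ₀) k)))))
          (rounds≤ C.phaseLength (lg Δ₀) l′ j (logStar (ξ I)) C.phaseLength≤ (1≤lg Δ₀)
            (l≤l′ W≢0) (1≤lg (ceilDivQ 1 ε)))

        c₁ c₂ : Config (n I)
        c₁ = Recolour.recoloured (G I) Δ₀ (degree≤Δ I) (c₀ I hid hwt) (proj₁ (reduced I hid hwt)) (proj₁ (proj₂ (reduced I hid hwt)))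
        c₂ = exec (G I) (C.localRatio k) c₁

        hdeg : ∀ v → 2 * ∑ V (a v) ≤ 2 ^ logFactor Δ₀
        hdeg v = ≤-trans (*-monoʳ-≤ 2 (≤-trans (degree≤Δ I v) (≤2^lg Δ₀))) (^-monoʳ-≤ 2 {suc (lg Δ₀)} {logFactor Δ₀} (≤-trans (m≤n+m (suc (lg Δ₀)) 2) (≤-reflexive (+-comm 3 (lg Δ₀)))))

        module S = LocalRatioSpec.Solved (LocalRatioSpec.solved C.chosen (logFactor Δ₀) (G I) hdeg C.H≤D k c₁ (proj₂ (proj₂ (proj₂ (reduced I hid hwt)))))
        module S-valid = Closed.Valid S.valid

        m : Fin (n I) → ℕ
        m v = mem (exec (G I) p₀ (c₀ I hid hwt) v)

        m≡ : ∀ v → m v ≡ mem (c₂ v)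
        m≡ v = trans (cong (λ p → mem (exec (G I) p (c₀ I hid hwt) v)) p₀≡p₁) (cong mem (exec-then (recolour Δ₀ (bits₀ I) (logStar (ξ I))) (C.localRatio k) {c₀ I hid hwt} {c₁} {c₂} (proj₁ (proj₂ (proj₂ (reduced I hid hwt)))) (λ _ → refl) v))

        independent : Independent (G I) (λ v → isOn (m v))
        independent = on-independent (G I) m (λ u v uv hu hv → S-valid.indep u v uv (subst (0 <_) (m≡ u) hu) (subst (0 <_) (m≡ v) hv))

        weight≡ : wt (w I) (λ v → isOn (m v)) ≡ weightOf (λ v → mem (c₂ v))
        weight≡ = on-weight (w I) m (λ v → mem (c₂ v)) m≡ S-valid.≤1

        quality : Quality (λ v → isOn (m v))
        quality = QP.≤-trans ([1-ε]*≤ ε (weightOf T) (B * weightOf (λ v → mem (c₂ v))) 0<ε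
            (precision (16 ^ k) (15 ^ k) (2 ^ j) (weightOf T) (B * weightOf (λ v → mem (c₂ v))) ∣ ↥ ε ∣ (↧ₙ ε) (ceilDivQ 1 ε)
              (m^n>0 16 k) (0<2^ j) (halving₁₆ j) (≤2^lg (ceilDivQ 1 ε)) (↧≤↥*⌈1/ε⌉ ε 0<ε) (S.large T B sparse)))
          (QP.≤-reflexive (trans (ℕtoℚ-* B _) (cong (λ z → ℕtoℚ B Q.* ℕtoℚ z) (≡-sym weight≡))))

      started : ∀ hid hwt → (∀ v → Bounded (b I) (c₀ I hid hwt v)) × All (Keeps (b I)) p₀
      started hid hwt = start-bounded I hid hwt , keeps hid hwt

      result : ∀ hid hwt → length p₀ ≤ bound × Independent (G I) (λ v → isOn (m hid hwt v)) × Quality (λ v → isOn (m hid hwt v))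
      result hid hwt = rounds hid hwt , independent hid hwt , quality hid hwt

      solution : Solves cId (7 * suc (bitsPer cId)) algorithm I bound Quality
      solution = solves cId (7 * suc (bitsPer cId)) bound Quality
        (λ v → ifEq-≢ W≢0) (λ v → refl) (short-messages I)
        (λ hid hwt → started hid hwt , result hid hwt)

    solution : (∀ v → T v + ∑ V (λ u → a v u * T u) ≤ B) → Solves cId (7 * suc (bitsPer cId)) algorithm I bound Quality
    solution sparse with maxWt (w I) ≟ 0
    ... | yes h = Weightless.solution h
    ... | no ¬h = Weighted.solution ¬h sparse

solves-map : ∀ {cId cMsg A I bound} {P P′ : Subset (n I) → Set} → (∀ S → P S → P′ S) →
  Solves cId cMsg A I bound P → Solves cId cMsg A I bound P′
solves-map f s hid hwt with s hid hwt
... | len , irr , T , T≤ , S , out , ind , p = len , irr , T , T≤ , S , out , ind , f S p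

module Independents {n : ℕ} (G : Graph n) where
  open Local G

  indicator : Subset n → Fin n → ℕ
  indicator O v = 𝟙ᵇ (O v)

  inter : Fin n → Subset n → Subset n
  inter v O u = if adj G v u then O u else false

  inter-size : ∀ v O → ∑ V (λ u → a v u * indicator O u) ≡ size (inter v O)
  inter-size v O = ∑-cong V (λ u → lem (adj G v u) (O u))
    where
    lem : ∀ b c → 𝟙ᵇ b * 𝟙ᵇ c ≡ (if (if b then c else false) then 1 else 0)
    lem true  c = *-identityˡ (𝟙ᵇ c)
    lem false c = refl

  inter-both : ∀ v O u → inter v O u ≡ true → adj G v u ≡ true × O u ≡ true
  inter-both v O u h with adj G v u
  ... | true  = refl , h
  inter-both v O u () | false

  -- An independent set meets a closed neighbourhood in its centre alone or in at most β neighbours.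
  sparse-independent : ∀ β O → IsNbhdIndep G β → Independent G O → ∀ v →
    indicator O v + ∑ V (λ u → a v u * indicator O u) ≤ β ⊔ 1
  sparse-independent β O (nb , _) ind v with O v in Ov
  ... | false = ≤-trans (≤-reflexive (inter-size v O)) (≤-trans
    (nb v (inter v O) (λ u h → proj₁ (inter-both v O u h)) (λ x y hx hy → ind x y (proj₂ (inter-both v O x hx)) (proj₂ (inter-both v O y hy))))
    (m≤m⊔n β 1))
  ... | true = ≤-trans (≤-reflexive (cong suc (trans (∑-cong V away) (∑-zero V)))) (m≤n⊔m β 1)
    where
    away : ∀ u → a v u * indicator O u ≡ 0
    away u with O u in Ou
    ... | false = *-zeroʳ (a v u)
    ... | true  = cong (λ b → 𝟙ᵇ b * 1) (ind v u Ov Ou)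

part₁ : ∀ (cId : ℕ) → Σ ℕ λ cMsg → Σ ℕ λ C → ∀ (ε : ℚ) → 0ℚ Q.< ε → Σ Algorithm λ A →
  ∀ (I : Instance) (β OPT : ℕ) → IsNbhdIndep (G I) β → IsOPT (G I) (w I) OPT →
  Solves cId cMsg A I
    (C * (lg (maxDeg (G I) * maxWt (w I)) ^ 2 * lg (ceilDivQ 1 ε) + logStar (ξ I)))
    (λ S → (1ℚ - ε) Q.* ℕtoℚ OPT Q.≤ ℕtoℚ (β ⊔ 1) Q.* ℕtoℚ (wt (w I) S))
part₁ cId = 7 * suc (bitsPer cId) , roundFactor , λ ε 0<ε → Ratio.algorithm cId ε 0<ε ,
  λ I β OPT nb → λ { (_ , O , ind , refl) → solves-map {cId} {7 * suc (bitsPer cId)} {Ratio.algorithm cId ε 0<ε} {I}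
    (λ S q → subst (λ t → (1ℚ - ε) Q.* ℕtoℚ t Q.≤ ℕtoℚ (β ⊔ 1) Q.* ℕtoℚ (wt (w I) S)) (≡-sym (wt-∑ (w I) O (Independents.indicator (G I) O) (λ _ → refl))) q)
    (Ratio.solution cId ε 0<ε I (lg (maxDeg (G I) * maxWt (w I))) (λ W≢0 → lg-mono (m≤m*n (maxDeg (G I)) (maxWt (w I)) {{≢-nonZero W≢0}}))
      (Independents.indicator (G I) O) (β ⊔ 1) (Independents.sparse-independent (G I) β O nb ind)) }

part₂ : ∀ (cId : ℕ) → Σ ℕ λ cMsg → Σ ℕ λ C → ∀ (ε : ℚ) → 0ℚ Q.< ε → Σ Algorithm λ A →
  ∀ (I : Instance) →
  Solves cId cMsg A I
    (C * (lg (maxDeg (G I)) ^ 2 * lg (ceilDivQ 1 ε) + logStar (ξ I)))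
    (λ S → (1ℚ - ε) Q.* ℕtoℚ (wt (w I) (λ _ → true)) Q.≤ ℕtoℚ (maxDeg (G I) + 1) Q.* ℕtoℚ (wt (w I) S))
part₂ cId = 7 * suc (bitsPer cId) , roundFactor , λ ε 0<ε → Ratio.algorithm cId ε 0<ε ,
  λ I → solves-map {cId} {7 * suc (bitsPer cId)} {Ratio.algorithm cId ε 0<ε} {I}
    (λ S q → subst (λ t → (1ℚ - ε) Q.* ℕtoℚ t Q.≤ ℕtoℚ (maxDeg (G I) + 1) Q.* ℕtoℚ (wt (w I) S)) (≡-sym (wt-∑ (w I) (λ _ → true) (λ _ → 1) (λ _ → refl))) q)
    (Ratio.solution cId ε 0<ε I (lg (maxDeg (G I))) (λ _ → ≤-refl) (λ _ → 1) (maxDeg (G I) + 1)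
      (λ v → ≤-trans (≤-reflexive (+-comm 1 _)) (+-monoˡ-≤ 1 (≤-trans (≤-reflexive (∑-cong (allFin (n I)) (λ u → *-identityʳ _))) (Start.degree≤Δ cId I v)))))

-- Part 3

-- Division by zero gives 0, as in `term3`; it occurs where a node and all its neighbours are
-- weightless.
quotient : ℕ → ℕ → ℕ
quotient a zero    = 0
quotient a (suc d) = a / suc d

quotient-* : ∀ a d → quotient a d * d ≤ a
quotient-* a zero    = z≤n
quotient-* a (suc d) = m/n*n≤m a (suc d)

<quotient-* : ∀ a d → (d ≡ 0 → a ≡ 0) → a ≤ suc (quotient a d) * d
<quotient-* a zero    h = ≤-reflexive (h refl)
<quotient-* a (suc d) _ = begin
  a                                      ≡⟨ m≡m%n+[m/n]*n a (suc d) ⟩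
  a % suc d + a / suc d * suc d          ≤⟨ +-monoˡ-≤ _ (<⇒≤ (m%n<n a (suc d))) ⟩
  suc d + a / suc d * suc d ∎
  where open ≤-Reasoning

≤quotient : ∀ k a d → 0 < d → k * d ≤ a → k ≤ quotient a d
≤quotient k a (suc d) _ h = ≤-pred (*-cancelʳ-< (suc d) k (suc (a / suc d)) (≤-<-trans h (begin-strict
  a                                      ≡⟨ m≡m%n+[m/n]*n a (suc d) ⟩
  a % suc d + a / suc d * suc d          <⟨ +-monoˡ-< _ (m%n<n a (suc d)) ⟩
  suc d + a / suc d * suc d ∎)))
  where open ≤-Reasoning

quotient≤ : ∀ S x d → x ≤ d → quotient (S * x) d ≤ S
quotient≤ S x zero    _ = z≤n
quotient≤ S x (suc d) h = *-cancelʳ-≤ _ _ (suc d) (≤-trans (m/n*n≤m (S * x) (suc d)) (*-monoʳ-≤ S h))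

2*xy≤ : ∀ x y → 2 * (x * y) ≤ x * x + y * y
2*xy≤ x y with ≤-total x y
... | inj₁ h = subst (λ y → 2 * (x * y) ≤ x * x + y * y) (m+[n∸m]≡n h) (ordered x (y ∸ x))
  where
  e₁ : ∀ x k → 2 * (x * (x + k)) + k * k ≡ x * x + (x + k) * (x + k)
  e₁ = solve-∀
  ordered : ∀ x k → 2 * (x * (x + k)) ≤ x * x + (x + k) * (x + k)
  ordered x k = ≤-trans (m≤m+n _ (k * k)) (≤-reflexive (e₁ x k))
... | inj₂ h = subst (λ x → 2 * (x * y) ≤ x * x + y * y) (m+[n∸m]≡n h) (ordered y (x ∸ y))
  where
  e₁ : ∀ y k → 2 * ((y + k) * y) + k * k ≡ (y + k) * (y + k) + y * y
  e₁ = solve-∀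
  ordered : ∀ y k → 2 * ((y + k) * y) ≤ (y + k) * (y + k) + y * y
  ordered y k = ≤-trans (m≤m+n _ (k * k)) (≤-reflexive (e₁ y k))

-- 2 x y ≤ x² + y², weighted: the factor min (p , q) may be replaced by q at x² and by p at y².
weighted-am-gm : ∀ p q x y → 2 * ((p ⊓ q) * (x * y)) ≤ x * x * q + y * y * p
weighted-am-gm p q x y = begin
  2 * ((p ⊓ q) * (x * y))                ≡⟨ *-swapˡ 2 (p ⊓ q) (x * y) ⟩
  (p ⊓ q) * (2 * (x * y))                ≤⟨ *-monoʳ-≤ (p ⊓ q) (2*xy≤ x y) ⟩
  (p ⊓ q) * (x * x + y * y)              ≡⟨ e₁ (p ⊓ q) (x * x) (y * y) ⟩
  x * x * (p ⊓ q) + y * y * (p ⊓ q)      ≤⟨ +-mono-≤ (*-monoʳ-≤ (x * x) (m⊓n≤n p q)) (*-monoʳ-≤ (y * y) (m⊓n≤m p q)) ⟩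
  x * x * q + y * y * p ∎
  where
  open ≤-Reasoning
  e₁ : ∀ m x y → m * (x + y) ≡ x * m + y * m
  e₁ = solve-∀

spread : ℕ → Instr
spread S d ds = record d { frc = quotient (S * wgt d) (wgt d + ∑ ds wgt) }

module Spread {n : ℕ} (G : Graph n) (ω X : Fin n → ℕ) (S : ℕ) where
  open Local G
  open ≤-Reasoning

  reach : Fin n → ℕ
  reach v = ω v + ∑ V (λ u → a v u * ω u)

  U weight : ℕ
  U = ∑ V (λ v → ω v * X v)
  weight = ∑ V ω

  squares : ℕ
  squares = ∑ V (λ v → X v * X v * ω v)

  module _ (upper : ∀ v → X v * reach v ≤ S * ω v) where

    total-squares : total ω X ≤ ∑ V (λ v → X v * X v * ∑ V (λ u → a v u * ω u))
    total-squares = *-cancelˡ-≤ 2 (begin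
      2 * total ω X
        ≡⟨ ∑∑-*ˡ 2 (cost ω X) ⟨
      ∑∑ (λ v u → 2 * cost ω X v u)
        ≤⟨ ∑∑-mono (λ v u → ≤-trans (≤-reflexive (*-swapˡ 2 (a v u) _)) (≤-trans (*-monoʳ-≤ (a v u) (weighted-am-gm (ω v) (ω u) (X v) (X u))) (≤-reflexive (*-distribˡ-+ (a v u) _ _)))) ⟩
      ∑∑ (λ v u → a v u * (X v * X v * ω u) + a v u * (X u * X u * ω v))
        ≡⟨ ∑∑-+ _ _ ⟩
      ∑∑ F + ∑∑ (λ v u → a v u * (X u * X u * ω v))
        ≡⟨ cong (∑∑ F +_) (trans (∑∑-cong (λ v u → cong (_* (X u * X u * ω v)) (a-sym v u))) (∑∑-transpose F)) ⟩
      ∑∑ F + ∑∑ F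
        ≡⟨ cong (∑∑ F +_) (≡-sym (+-identityʳ (∑∑ F))) ⟩
      2 * ∑∑ F
        ≡⟨ cong (2 *_) (∑-cong V (λ v → trans (∑-cong V (λ u → *-swapˡ (a v u) (X v * X v) (ω u))) (∑-*ˡ V (X v * X v) _))) ⟩
      2 * ∑ V (λ v → X v * X v * ∑ V (λ u → a v u * ω u)) ∎)
      where
      F : Fin n → Fin n → ℕ
      F v u = a v u * (X v * X v * ω u)

    -- Together with `squares`, the neighbourhood sums complete to `X v * X v * reach v`, and
    -- `upper` applies. The squares are retained as the slack that absorbs all errors when ε is
    -- extremely small.
    cost-bound : total ω X + squares ≤ S * U
    cost-bound = begin
      total ω X + squares
        ≤⟨ +-monoˡ-≤ squares total-squares ⟩
      ∑ V (λ v → X v * X v * ∑ V (λ u → a v u * ω u)) + squares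
        ≡⟨ ∑-+ V _ _ ⟨
      ∑ V (λ v → X v * X v * ∑ V (λ u → a v u * ω u) + X v * X v * ω v)
        ≤⟨ ∑-mono V (λ v → ≤-trans (≤-reflexive (e₁ (X v) (ω v) _)) (≤-trans (*-monoʳ-≤ (X v) (upper v)) (≤-reflexive (e₂ (X v) S (ω v))))) ⟩
      ∑ V (λ v → S * (ω v * X v))
        ≡⟨ ∑-*ˡ V S _ ⟩
      S * U ∎
      where
      e₁ : ∀ x w r → x * x * r + x * x * w ≡ x * (x * (w + r))
      e₁ = solve-∀
      e₂ : ∀ x s w → x * (s * w) ≡ s * (w * x)
      e₂ = solve-∀

  module _ (m : ℕ) (0<m : 0 < m) (0<S : 0 < S) (sparse : ∀ v → 1 + ∑ V (λ u → a v u * 1) ≤ m)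
    (lower : ∀ v → S * ω v ≤ suc (X v) * reach v) where

    -- The tangent inequality (m w)² / r ≥ 2 m w - r with r = `reach v`, where `suc (X v)` stands
    -- for S w / r rounded up. Summed over v it replaces the Cauchy-Schwarz inequality in the
    -- weighted Turán bound.
    tangent : ∀ v → 2 * m * (S * ω v) ≤ m * m * (ω v * suc (X v)) + S * reach v
    tangent v with reach v ≟ 0
    ... | yes d≡0 = ≤-trans (≤-reflexive (trans (cong (2 * m *_) (n≤0⇒n≡0 (≤-trans (lower v) (≤-reflexive (trans (cong (suc (X v) *_) d≡0) (*-zeroʳ (suc (X v)))))))) (*-zeroʳ (2 * m)))) z≤n
    ... | no ¬d≡0 = *-cancelʳ-≤ _ _ (reach v) {{≢-nonZero ¬d≡0}} (begin
      2 * m * (S * ω v) * reach v                       ≡⟨ e₁ m S (ω v) (reach v) ⟩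
      S * (2 * (m * ω v * reach v))                     ≤⟨ *-monoʳ-≤ S (2*xy≤ (m * ω v) (reach v)) ⟩
      S * (m * ω v * (m * ω v) + reach v * reach v)     ≡⟨ e₂ m S (ω v) (reach v) ⟩
      m * m * ω v * (S * ω v) + S * reach v * reach v   ≤⟨ +-monoˡ-≤ _ (*-monoʳ-≤ (m * m * ω v) (lower v)) ⟩
      m * m * ω v * (suc (X v) * reach v) + S * reach v * reach v ≡⟨ e₃ m S (ω v) (reach v) (suc (X v)) ⟩
      (m * m * (ω v * suc (X v)) + S * reach v) * reach v ∎)
      where
      e₁ : ∀ m s w d → 2 * m * (s * w) * d ≡ s * (2 * (m * w * d))
      e₁ = solve-∀
      e₂ : ∀ m s w d → s * (m * w * (m * w) + d * d) ≡ m * m * w * (s * w) + s * d * d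
      e₂ = solve-∀
      e₃ : ∀ m s w d x → m * m * w * (x * d) + s * d * d ≡ (m * m * (w * x) + s * d) * d
      e₃ = solve-∀

    reach-total : ∑ V reach ≤ m * weight
    reach-total = ≤-trans (≤-reflexive (∑-cong V (λ v → ≡-sym (*-identityˡ (reach v))))) (Closed.sparse-bound G (λ _ → 1) m ω sparse)

    -- The weighted Turán bound, up to the rounding error of the fractions X.
    weight-bound : S * weight ≤ m * (U + weight)
    weight-bound = *-cancelˡ-≤ m {{>-nonZero 0<m}} (+-cancelʳ-≤ (m * (S * weight)) _ _ (begin
      m * (S * weight) + m * (S * weight)           ≡⟨ e₁ m (S * weight) ⟩
      2 * m * (S * weight)                          ≡⟨ trans (cong (2 * m *_) (≡-sym (∑-*ˡ V S ω))) (≡-sym (∑-*ˡ V (2 * m) _)) ⟩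
      ∑ V (λ v → 2 * m * (S * ω v))                 ≤⟨ ∑-mono V tangent ⟩
      ∑ V (λ v → m * m * (ω v * suc (X v)) + S * reach v) ≡⟨ trans (∑-+ V _ _) (cong₂ _+_ (∑-*ˡ V (m * m) _) (∑-*ˡ V S reach)) ⟩
      m * m * ∑ V (λ v → ω v * suc (X v)) + S * ∑ V reach ≤⟨ +-monoʳ-≤ (m * m * ∑ V (λ v → ω v * suc (X v))) (*-monoʳ-≤ S reach-total) ⟩
      m * m * ∑ V (λ v → ω v * suc (X v)) + S * (m * weight)
        ≡⟨ cong (λ z → m * m * z + S * (m * weight)) (trans (∑-cong V (λ v → trans (*-suc (ω v) (X v)) (+-comm (ω v) _))) (∑-+ V _ _)) ⟩
      m * m * (U + weight) + S * (m * weight)       ≡⟨ e₂ m (U + weight) S weight ⟩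
      m * (m * (U + weight)) + m * (S * weight) ∎))
      where
      e₁ : ∀ m x → m * x + m * x ≡ 2 * m * x
      e₁ = solve-∀
      e₂ : ∀ m y s w → m * m * y + s * (m * w) ≡ m * (m * y) + m * (s * w)
      e₂ = solve-∀

-- ★ is the outcome of the rounding; the two cases are E ≥ 1/ε, and E so large that the slack of the
-- cost bound pays for all errors.
module Accuracy (E S U W t sq weight : ℕ) (0<E : 0 < E) (0<S : 0 < S)
  (★ : 4 * E * (S * U) ≤ 4 * E * (S * S * W) + (2 * E + 1) * t)
  (cheap : t + sq ≤ S * U) (light : 4 * E * weight ≤ U + weight) where
  open ≤-Reasoning

  Y : ℕ
  Y = U + weight

  -- By `cheap` the cost uses up half of twice the utility, whence the factor 1/2 of part 3. The
  -- rounding adds an error of relative size 1/(2E), the truncation of the fractions one of size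
  -- 1/(4E).
  coarse : E * Y ≤ 2 * E * (S * W) + Y
  coarse = *-cancelˡ-≤ 2 (begin
    2 * (E * (U + weight))          ≡⟨ e₁ E U weight ⟩
    2 * E * U + 2 * E * weight      ≤⟨ +-mono-≤ main (≤-trans (*-monoˡ-≤ weight (*-monoˡ-≤ E {2} {4} (s≤s (s≤s z≤n)))) light) ⟩
    4 * E * (S * W) + U + Y         ≤⟨ +-monoˡ-≤ Y (+-monoʳ-≤ (4 * E * (S * W)) (m≤m+n U weight)) ⟩
    4 * E * (S * W) + Y + Y         ≡⟨ e₂ E (S * W) Y ⟩
    2 * (2 * E * (S * W) + Y) ∎)
    where
    e₁ : ∀ E u w → 2 * (E * (u + w)) ≡ 2 * E * u + 2 * E * w
    e₁ = solve-∀
    e₂ : ∀ E x y → 4 * E * x + y + y ≡ 2 * (2 * E * x + y)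
    e₂ = solve-∀
    e₃ : ∀ E S u → S * (2 * E * u) + (2 * E + 1) * (S * u) ≡ 4 * E * (S * u) + S * u
    e₃ = solve-∀
    e₄ : ∀ E S W u → 4 * E * (S * S * W) + (2 * E + 1) * (S * u) + S * u ≡ S * (4 * E * (S * W) + u) + (2 * E + 1) * (S * u)
    e₄ = solve-∀
    main : 2 * E * U ≤ 4 * E * (S * W) + U
    main = *-cancelˡ-≤ S {{>-nonZero 0<S}} (+-cancelʳ-≤ ((2 * E + 1) * (S * U)) _ _ (begin
      S * (2 * E * U) + (2 * E + 1) * (S * U)             ≡⟨ e₃ E S U ⟩
      4 * E * (S * U) + S * U                             ≤⟨ +-monoˡ-≤ (S * U) ★ ⟩
      4 * E * (S * S * W) + (2 * E + 1) * t + S * U       ≤⟨ +-monoˡ-≤ (S * U) (+-monoʳ-≤ (4 * E * (S * S * W)) (*-monoʳ-≤ (2 * E + 1) (≤-trans (m≤m+n t sq) cheap))) ⟩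
      4 * E * (S * S * W) + (2 * E + 1) * (S * U) + S * U ≡⟨ e₄ E S W U ⟩
      S * (4 * E * (S * W) + U) + (2 * E + 1) * (S * U) ∎))

  -- The squares lower the cost to (1 - 1/E) S U. As (1 + 1/(2E)) (1 - 1/E) < 1, the rounding now
  -- leaves a surplus, which also pays for the truncation, and no error remains.
  exact : S * U ≤ E * sq → Y ≤ 2 * (S * W)
  exact slack = *-cancelˡ-≤ (2 * (E * E)) {{m*n≢0 2 (E * E) {{_}} {{m*n≢0 E E {{>-nonZero 0<E}} {{>-nonZero 0<E}}}}}} (begin
    2 * (E * E) * (U + weight)                    ≡⟨ *-distribˡ-+ (2 * (E * E)) U weight ⟩
    2 * (E * E) * U + 2 * (E * E) * weight        ≤⟨ +-monoʳ-≤ (2 * (E * E) * U) weight≤ ⟩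
    2 * (E * E) * U + (E + 1) * U                 ≤⟨ main ⟩
    4 * (E * E) * (S * W)                         ≡⟨ e₁ E (S * W) ⟩
    2 * (E * E) * (2 * (S * W)) ∎)
    where
    e₁ : ∀ E x → 4 * (E * E) * x ≡ 2 * (E * E) * (2 * x)
    e₁ = solve-∀
    e₂ : ∀ E w → 2 * (E * E) * w + (E + 1) * w + (2 * (E * E) * w + (3 * E) * w) ≡ (E + 1) * (4 * E * w) + w
    e₂ = solve-∀
    e₂′ : ∀ E u w → (E + 1) * (u + w) ≡ (E + 1) * u + (E + 1) * w
    e₂′ = solve-∀
    weight≤ : 2 * (E * E) * weight ≤ (E + 1) * U
    weight≤ = +-cancelʳ-≤ ((E + 1) * weight) _ _ (begin
      2 * (E * E) * weight + (E + 1) * weight ≤⟨ +-cancelʳ-≤ weight _ _ (begin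
          2 * (E * E) * weight + (E + 1) * weight + weight
            ≤⟨ +-monoʳ-≤ (2 * (E * E) * weight + (E + 1) * weight) (≤-trans (m≤n*m weight (3 * E) {{m*n≢0 3 E {{_}} {{>-nonZero 0<E}}}}) (m≤n+m _ (2 * (E * E) * weight))) ⟩
          2 * (E * E) * weight + (E + 1) * weight + (2 * (E * E) * weight + (3 * E) * weight)
            ≡⟨ e₂ E weight ⟩
          (E + 1) * (4 * E * weight) + weight ∎) ⟩
      (E + 1) * (4 * E * weight) ≤⟨ *-monoʳ-≤ (E + 1) light ⟩
      (E + 1) * (U + weight)     ≡⟨ e₂′ E U weight ⟩
      (E + 1) * U + (E + 1) * weight ∎)
    e₃ : ∀ E S u → S * (2 * (E * E) * u + (E + 1) * u) + (2 * E + 1) * (E * (S * u)) ≡ E * (4 * E * (S * u)) + (2 * E + 1) * (S * u)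
    e₃ = solve-∀
    e₄ : ∀ E S W t q → E * (4 * E * (S * S * W) + (2 * E + 1) * t) + (2 * E + 1) * (E * q) ≡ S * (4 * (E * E) * (S * W)) + (2 * E + 1) * (E * (t + q))
    e₄ = solve-∀
    main : 2 * (E * E) * U + (E + 1) * U ≤ 4 * (E * E) * (S * W)
    main = *-cancelˡ-≤ S {{>-nonZero 0<S}} (+-cancelʳ-≤ ((2 * E + 1) * (E * (S * U))) _ _ (begin
      S * (2 * (E * E) * U + (E + 1) * U) + (2 * E + 1) * (E * (S * U)) ≡⟨ e₃ E S U ⟩
      E * (4 * E * (S * U)) + (2 * E + 1) * (S * U)
        ≤⟨ +-mono-≤ (*-monoʳ-≤ E ★) (*-monoʳ-≤ (2 * E + 1) slack) ⟩
      E * (4 * E * (S * S * W) + (2 * E + 1) * t) + (2 * E + 1) * (E * sq) ≡⟨ e₄ E S W t sq ⟩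
      S * (4 * (E * E) * (S * W)) + (2 * E + 1) * (E * (t + sq))
        ≤⟨ +-monoʳ-≤ (S * (4 * (E * E) * (S * W))) (*-monoʳ-≤ (2 * E + 1) (*-monoʳ-≤ E cheap)) ⟩
      S * (4 * (E * E) * (S * W)) + (2 * E + 1) * (E * (S * U)) ∎))

-- For ε ≥ 1/2 the left side is not positive. Otherwise ½ - ε is a nonnegative factor, `s` may be
-- replaced by its upper bound Y / S, and denominators are cleared.
[½-ε]*≤ : ∀ ε s S Y W → 0ℚ Q.< ε → 0ℚ Q.≤ s → 0 < S → s Q.* ℕtoℚ S Q.≤ ℕtoℚ Y →
  ↧ₙ ε * Y ≤ 2 * ↧ₙ ε * (S * W) + 2 * ∣ ↥ ε ∣ * Y → (½ - ε) Q.* s Q.≤ ℕtoℚ W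
[½-ε]*≤ ε s S Y W 0<ε 0≤s 0<S s≤ h with QP.≤-total (½ - ε) 0ℚ
... | inj₁ neg = QP.≤-trans (QP.*-monoʳ-≤-nonNeg s {{nonNegative 0≤s}} neg) (QP.≤-trans (QP.≤-reflexive (QP.*-zeroˡ s)) (ℕtoℚ-nonNeg W))
... | inj₂ pos = ≤-by-scaling S 0<S (≤-by-scaling (2 * q) (*-mono-≤ {1} {2} {1} {q} (s≤s z≤n) (denominator-pos ε)) (begin
  (½ - ε) Q.* s Q.* ℕtoℚ S Q.* ℕtoℚ (2 * q)
    ≡⟨ cong (Q._* ℕtoℚ (2 * q)) (QP.*-assoc (½ - ε) s (ℕtoℚ S)) ⟩
  (½ - ε) Q.* (s Q.* ℕtoℚ S) Q.* ℕtoℚ (2 * q)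
    ≤⟨ QP.*-monoʳ-≤-nonNeg (ℕtoℚ (2 * q)) {{nonNegative (ℕtoℚ-nonNeg (2 * q))}} (QP.*-monoˡ-≤-nonNeg (½ - ε) {{nonNegative pos}} s≤) ⟩
  (½ - ε) Q.* ℕtoℚ Y Q.* ℕtoℚ (2 * q)
    ≡⟨ cong ((½ - ε) Q.* ℕtoℚ Y Q.*_) (ℕtoℚ-* 2 q) ⟩
  (½ - ε) Q.* ℕtoℚ Y Q.* (ℕtoℚ 2 Q.* ℕtoℚ q)
    ≡⟨ solve 3 (λ e y q → (con ½ :- e) :* y :* (con (ℕtoℚ 2) :* q) := q :* y :- con (ℕtoℚ 2) :* (e :* q) :* y) refl ε (ℕtoℚ Y) (ℕtoℚ q) ⟩
  ℕtoℚ q Q.* ℕtoℚ Y Q.- ℕtoℚ 2 Q.* (ε Q.* ℕtoℚ q) Q.* ℕtoℚ Y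
    ≡⟨ cong₂ Q._-_ (≡-sym (ℕtoℚ-* q Y)) (trans (cong (λ z → ℕtoℚ 2 Q.* z Q.* ℕtoℚ Y) (denominator-* ε 0<ε))
         (trans (cong (Q._* ℕtoℚ Y) (≡-sym (ℕtoℚ-* 2 p))) (≡-sym (ℕtoℚ-* (2 * p) Y)))) ⟩
  ℕtoℚ (q * Y) Q.- ℕtoℚ (2 * p * Y)
    ≤⟨ QP.+-monoˡ-≤ (Q.- ℕtoℚ (2 * p * Y)) (ℕtoℚ-mono h) ⟩
  ℕtoℚ (2 * q * (S * W) + 2 * p * Y) Q.- ℕtoℚ (2 * p * Y)
    ≡⟨ cong (Q._- ℕtoℚ (2 * p * Y)) (ℕtoℚ-+ (2 * q * (S * W)) (2 * p * Y)) ⟩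
  ℕtoℚ (2 * q * (S * W)) Q.+ ℕtoℚ (2 * p * Y) Q.- ℕtoℚ (2 * p * Y)
    ≡⟨ solve 2 (λ x y → x :+ y :- y := x) refl (ℕtoℚ (2 * q * (S * W))) (ℕtoℚ (2 * p * Y)) ⟩
  ℕtoℚ (2 * q * (S * W))
    ≡⟨ trans (ℕtoℚ-* (2 * q) (S * W)) (cong (ℕtoℚ (2 * q) Q.*_) (ℕtoℚ-* S W)) ⟩
  ℕtoℚ (2 * q) Q.* (ℕtoℚ S Q.* ℕtoℚ W)
    ≡⟨ solve 3 (λ q s w → q :* (s :* w) := w :* s :* q) refl (ℕtoℚ (2 * q)) (ℕtoℚ S) (ℕtoℚ W) ⟩
  ℕtoℚ W Q.* ℕtoℚ S Q.* ℕtoℚ (2 * q) ∎))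
  where
  open QP.≤-Reasoning
  open +-*-Solver
  p q : ℕ
  p = ∣ ↥ ε ∣
  q = ↧ₙ ε

module Sum3 {n : ℕ} (G : Graph n) (ω : Fin n → ℕ) where

  fraction-nonNeg : ∀ x d → 0ℚ Q.≤ Z.+ x Q./ suc d
  fraction-nonNeg x d = ≤-by-scaling (suc d) (s≤s z≤n) (QP.≤-trans (QP.≤-reflexive (QP.*-zeroˡ (ℕtoℚ (suc d))))
    (QP.≤-trans (ℕtoℚ-nonNeg x) (QP.≤-reflexive (≡-sym (fraction-* x d)))))

  fraction-bound : ∀ x d S f → S * x ≤ f * suc d → (Z.+ x Q./ suc d) Q.* ℕtoℚ S Q.≤ ℕtoℚ f
  fraction-bound x d S f h = ≤-by-scaling (suc d) (s≤s z≤n) (begin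
    (Z.+ x Q./ suc d) Q.* ℕtoℚ S Q.* ℕtoℚ (suc d)
      ≡⟨ solve 3 (λ q s d → q :* s :* d := q :* d :* s) refl (Z.+ x Q./ suc d) (ℕtoℚ S) (ℕtoℚ (suc d)) ⟩
    (Z.+ x Q./ suc d) Q.* ℕtoℚ (suc d) Q.* ℕtoℚ S
      ≡⟨ cong (Q._* ℕtoℚ S) (fraction-* x d) ⟩
    ℕtoℚ x Q.* ℕtoℚ S
      ≡⟨ trans (≡-sym (ℕtoℚ-* x S)) (cong ℕtoℚ (*-comm x S)) ⟩
    ℕtoℚ (S * x)
      ≤⟨ ℕtoℚ-mono h ⟩
    ℕtoℚ (f * suc d)
      ≡⟨ ℕtoℚ-* f (suc d) ⟩
    ℕtoℚ f Q.* ℕtoℚ (suc d) ∎)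
    where
    open QP.≤-Reasoning
    open +-*-Solver

  term-nonNeg : ∀ v → 0ℚ Q.≤ term3 G ω v
  term-nonNeg v with ω v + wt ω (Nbr G v)
  ... | zero  = QP.≤-refl
  ... | suc d = fraction-nonNeg (ω v * ω v) d

  term-bound : ∀ v S f → S * (ω v * ω v) ≤ f * (ω v + wt ω (Nbr G v)) → term3 G ω v Q.* ℕtoℚ S Q.≤ ℕtoℚ f
  term-bound v S f h with ω v + wt ω (Nbr G v)
  ... | zero  = QP.≤-trans (QP.≤-reflexive (QP.*-zeroˡ (ℕtoℚ S))) (ℕtoℚ-nonNeg f)
  ... | suc d = fraction-bound (ω v * ω v) d S f h

  sum-nonNeg : ∀ xs → 0ℚ Q.≤ foldr Q._+_ 0ℚ (map (term3 G ω) xs)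
  sum-nonNeg []       = QP.≤-refl
  sum-nonNeg (v ∷ xs) = QP.≤-trans (QP.≤-reflexive (≡-sym (QP.+-identityˡ 0ℚ))) (QP.+-mono-≤ (term-nonNeg v) (sum-nonNeg xs))

  sum3-nonNeg : 0ℚ Q.≤ sum3 G ω
  sum3-nonNeg = sum-nonNeg (allFin n)

  sum-bound : ∀ S (f : Fin n → ℕ) → (∀ v → S * (ω v * ω v) ≤ f v * (ω v + wt ω (Nbr G v))) → ∀ xs →
    foldr Q._+_ 0ℚ (map (term3 G ω) xs) Q.* ℕtoℚ S Q.≤ ℕtoℚ (∑ xs f)
  sum-bound S f h []       = QP.≤-reflexive (QP.*-zeroˡ (ℕtoℚ S))
  sum-bound S f h (v ∷ xs) = begin
    (term3 G ω v Q.+ foldr Q._+_ 0ℚ (map (term3 G ω) xs)) Q.* ℕtoℚ S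
      ≡⟨ QP.*-distribʳ-+ (ℕtoℚ S) (term3 G ω v) _ ⟩
    term3 G ω v Q.* ℕtoℚ S Q.+ foldr Q._+_ 0ℚ (map (term3 G ω) xs) Q.* ℕtoℚ S
      ≤⟨ QP.+-mono-≤ (term-bound v S (f v) (h v)) (sum-bound S f h xs) ⟩
    ℕtoℚ (f v) Q.+ ℕtoℚ (∑ xs f)
      ≡⟨ ℕtoℚ-+ (f v) (∑ xs f) ⟨
    ℕtoℚ (f v + ∑ xs f) ∎
    where open QP.≤-Reasoning

  sum3-bound : ∀ S (f : Fin n → ℕ) → (∀ v → S * (ω v * ω v) ≤ f v * (ω v + wt ω (Nbr G v))) → sum3 G ω Q.* ℕtoℚ S Q.≤ ℕtoℚ (∑ (allFin n) f)
  sum3-bound S f h = sum-bound S f h (allFin n)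

join : Instr
join d ds = record d { mem = 1 }

-- Truncating fractions to multiples of 2^-K loses at most w(V) / 2^K, a share 1/(4E) of w(V) / (Δ +
-- 1); the latter is controlled by the weighted Turán bound.
fineness : ℕ → ℕ → ℕ
fineness E Δ = ⌈log₂ 4 * E * (Δ + 1) ⌉

module Chosen₃ (E Δ : ℕ) (0<E : 0 < E) where
  -- D ≥ K (2E + 1) gives (1 + 1/D)^K ≤ 1 + 1/(2E). Each of the K phases takes O(H) rounds, which is
  -- the origin of the factor 1/ε in the round bound.
  K H : ℕ
  K = fineness E Δ
  H = K * (2 * E + 1)

  lgΔ≤K : lg Δ ≤ K
  lgΔ≤K = ⌈log₂⌉-mono-≤ (⊔-lub (≤-trans (m≤m+n Δ 1) (m≤n*m (Δ + 1) (4 * E) {{>-nonZero 0<4E}}))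
    (≤-trans (≤-trans (s≤s (s≤s z≤n)) (*-monoʳ-≤ 4 0<E)) (m≤m*n (4 * E) (Δ + 1) {{>-nonZero (m≤n+m 1 Δ)}})))
    where
    0<4E : 0 < 4 * E
    0<4E = ≤-trans 0<E (m≤n*m E 4)

  0<K : 0 < K
  0<K = ≤-trans (1≤lg Δ) lgΔ≤K

  K≤H : K ≤ H
  K≤H = m≤m*n K (2 * E + 1) {{>-nonZero (m≤n+m 1 (2 * E))}}

  open Choice H (lg Δ) (≤-trans 0<K K≤H) (≤-trans lgΔ≤K K≤H) public
  open PhaseLength chosen public
  open Phases chosen public using (D; rounding)

  body : List Instr
  body = spread (2 ^ K) ∷ rounding K ++ (resolve ∷ [])

  length-body : length body ≡ 2 + K * phaseLength
  length-body = cong suc (trans (length-++ (rounding K)) (trans (cong (_+ 1) (length-rounding K)) (+-comm (K * phaseLength) 1)))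

outcome : ∀ P F S U t W z E D′ → 0 < P → F ≡ S * S * P → D′ * (2 * E) ≤ P * (2 * E + 1) →
  P * (2 * S * U) + F * z ≤ F * (2 * W + z) + D′ * t → 4 * E * (S * U) ≤ 4 * E * (S * S * W) + (2 * E + 1) * t
outcome P F S U t W z E D′ 0<P F≡ hD h = *-cancelˡ-≤ P {{>-nonZero 0<P}} (begin
  P * (4 * E * (S * U))                     ≡⟨ e₁ P E S U ⟩
  2 * E * (P * (2 * S * U))                 ≤⟨ *-monoʳ-≤ (2 * E) (+-cancelʳ-≤ (F * z) _ _ (≤-trans h (≤-reflexive (e₂ F W z (D′ * t))))) ⟩
  2 * E * (F * (2 * W) + D′ * t)            ≡⟨ cong (λ f → 2 * E * (f * (2 * W) + D′ * t)) F≡ ⟩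
  2 * E * (S * S * P * (2 * W) + D′ * t)    ≡⟨ e₃ P E S W D′ t ⟩
  P * (4 * E * (S * S * W)) + D′ * (2 * E) * t ≤⟨ +-monoʳ-≤ (P * (4 * E * (S * S * W))) (*-monoˡ-≤ t hD) ⟩
  P * (4 * E * (S * S * W)) + P * (2 * E + 1) * t ≡⟨ e₄ P (4 * E * (S * S * W)) (2 * E + 1) t ⟩
  P * (4 * E * (S * S * W) + (2 * E + 1) * t) ∎)
  where
  open ≤-Reasoning
  e₁ : ∀ P E S U → P * (4 * E * (S * U)) ≡ 2 * E * (P * (2 * S * U))
  e₁ = solve-∀
  e₂ : ∀ F W z x → F * (2 * W + z) + x ≡ F * (2 * W) + x + F * z
  e₂ = solve-∀
  e₃ : ∀ P E S W D t → 2 * E * (S * S * P * (2 * W) + D * t) ≡ P * (4 * E * (S * S * W)) + D * (2 * E) * t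
  e₃ = solve-∀
  e₄ : ∀ P x e t → P * x + P * e * t ≡ P * (x + e * t)
  e₄ = solve-∀

scaled : ∀ p q E Y x → 0 < E → q ≤ p * E → E * Y ≤ 2 * E * x + Y → q * Y ≤ 2 * q * x + 2 * p * Y
scaled p q E Y x 0<E q≤ h = *-cancelˡ-≤ E {{>-nonZero 0<E}} (begin
  E * (q * Y)                       ≡⟨ *-swapˡ E q Y ⟩
  q * (E * Y)                       ≤⟨ *-monoʳ-≤ q h ⟩
  q * (2 * E * x + Y)               ≡⟨ e₁ q E x Y ⟩
  E * (2 * q * x) + q * Y           ≤⟨ +-monoʳ-≤ (E * (2 * q * x)) (*-monoˡ-≤ Y q≤) ⟩
  E * (2 * q * x) + p * E * Y       ≤⟨ m≤m+n _ (p * E * Y) ⟩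
  E * (2 * q * x) + p * E * Y + p * E * Y ≡⟨ e₂ E q x p Y ⟩
  E * (2 * q * x + 2 * p * Y) ∎)
  where
  open ≤-Reasoning
  e₁ : ∀ q E x Y → q * (2 * E * x + Y) ≡ E * (2 * q * x) + q * Y
  e₁ = solve-∀
  e₂ : ∀ E q x p Y → E * (2 * q * x) + p * E * Y + p * E * Y ≡ E * (2 * q * x + 2 * p * Y)
  e₂ = solve-∀

module Body {n : ℕ} (G : Graph n) (E Δ : ℕ) (0<E : 0 < E) (c : Config n) where
  open Chosen₃ E Δ 0<E
  open Local G
  open Stage G

  ω : Fin n → ℕ
  ω v = wgt (c v)

  reach X : Fin n → ℕ
  reach v = ω v + ∑ V (λ u → a v u * ω u)
  X v = quotient (2 ^ K * ω v) (reach v)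

  c₁ : Config n
  c₁ v = record (c v) { frc = X v }

  spread≡ : round G (spread (2 ^ K)) c ≗ c₁
  spread≡ v = cong (λ z → record (c v) { frc = quotient (2 ^ K * ω v) (ω v + z) }) (∑-received c wgt v)

  module _ (proper-c : Proper L₀ c) (hdeg : ∀ v → ∑ V (a v) ≤ Δ) where
    module Rd = Phases.Rounded (Phases.rounded chosen G K c₁ (proper-clr c₁ (λ _ → refl) proper-c))

    c₂ : Config n
    c₂ = Phases.redo chosen G c₁ Rd.y Rd.x Rd.s Rd.Z

    module R = Resolve G c₂

    mem≡ : ∀ v → mem (exec G body c v) ≡ R.M v
    mem≡ v = cong mem (trans (exec-cong (rounding K ++ (resolve ∷ [])) spread≡ v)
      (exec-then (rounding K) (resolve ∷ []) {c₁} {c₂} {round G resolve c₂} Rd.shape (λ _ → refl) v))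

    independent : ∀ u v → adj G u v ≡ true → 0 < R.M u → 0 < R.M v → ⊥
    independent = R.M-independent {L₀} (proper-clr c₂ (λ _ → refl) proper-c)

    open Spread G ω X (2 ^ K) hiding (reach)

    W : ℕ
    W = ∑ V (λ v → ω v * R.M v)

    X≤ : ∀ v → X v ≤ 2 ^ K
    X≤ v = quotient≤ (2 ^ K) (ω v) (reach v) (m≤m+n (ω v) _)

    ★ : 4 * E * (2 ^ K * U) ≤ 4 * E * (2 ^ K * 2 ^ K * W) + (2 * E + 1) * total ω X
    ★ = outcome (D ^ K) ((4 * D) ^ K) (2 ^ K) U (total ω X) W (total ω Rd.Z) E (suc D ^ K)
      (m^n>0 D {{>-nonZero (≤-trans 0<x (≤-reflexive (≡-sym D≡)))}} K) (4*D^K D K)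
      (≤-trans ([1+1/D]^k≤ D K (2 * E) (≤-trans (*-monoʳ-≤ K (≤-reflexive (+-comm 1 (2 * E)))) H≤D)) (*-monoʳ-≤ (D ^ K) (≤-reflexive (+-comm 1 (2 * E)))))
      (≤-trans Rd.gain (+-monoˡ-≤ (suc D ^ K * total ω X) (*-monoʳ-≤ ((4 * D) ^ K) (R.M-weight (Rd.Z≤1 X≤)))))

    cheap : total ω X + squares ≤ 2 ^ K * U
    cheap = cost-bound (λ v → quotient-* (2 ^ K * ω v) (reach v))

    lower : ∀ v → 2 ^ K * ω v ≤ suc (X v) * reach v
    lower v = <quotient-* (2 ^ K * ω v) (reach v) (λ h → trans (cong (2 ^ K *_) (m+n≡0⇒m≡0 (ω v) h)) (*-zeroʳ (2 ^ K)))

    light : 4 * E * weight ≤ U + weight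
    light = *-cancelˡ-≤ (Δ + 1) {{>-nonZero (m≤n+m 1 Δ)}} (begin
      (Δ + 1) * (4 * E * weight)     ≡⟨ trans (≡-sym (*-assoc (Δ + 1) (4 * E) weight)) (cong (_* weight) (*-comm (Δ + 1) (4 * E))) ⟩
      4 * E * (Δ + 1) * weight       ≤⟨ *-monoˡ-≤ weight (n≤2^⌈log₂n⌉ (4 * E * (Δ + 1))) ⟩
      2 ^ K * weight                 ≤⟨ weight-bound (Δ + 1) (m≤n+m 1 Δ) (0<2^ K) sparse lower ⟩
      (Δ + 1) * (U + weight) ∎)
      where
      open ≤-Reasoning
      sparse : ∀ v → 1 + ∑ V (λ u → a v u * 1) ≤ Δ + 1
      sparse v = ≤-trans (≤-reflexive (+-comm 1 _)) (+-monoˡ-≤ 1 (≤-trans (≤-reflexive (∑-cong V (λ u → *-identityʳ (a v u)))) (hdeg v)))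

    open Accuracy E (2 ^ K) U W (total ω X) squares weight 0<E (0<2^ K) ★ cheap light

    -- If E = 2 ^ κ bounds every reach, all fractions X / 2 ^ K of nodes of positive weight are at least 1 / E.
    slack : ∀ κ → E ≡ 2 ^ κ → (∀ v → reach v ≤ E) → 2 ^ K * U ≤ E * squares
    slack κ E≡ hreach = begin
      2 ^ K * U                              ≡⟨ ∑-*ˡ V (2 ^ K) _ ⟨
      ∑ V (λ v → 2 ^ K * (ω v * X v))        ≤⟨ ∑-mono V pointwise ⟩
      ∑ V (λ v → E * (X v * X v * ω v))      ≡⟨ ∑-*ˡ V E _ ⟩
      E * squares ∎
      where
      open ≤-Reasoning
      κ≤K : κ ≤ K
      κ≤K = 2^-cancel-≤ κ K (begin
        2 ^ κ               ≡⟨ E≡ ⟨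
        E                   ≤⟨ m≤n*m E 4 ⟩
        4 * E               ≤⟨ m≤m*n (4 * E) (Δ + 1) {{>-nonZero (m≤n+m 1 Δ)}} ⟩
        4 * E * (Δ + 1)     ≤⟨ n≤2^⌈log₂n⌉ (4 * E * (Δ + 1)) ⟩
        2 ^ K ∎)
      2^K≡ : 2 ^ K ≡ 2 ^ (K ∸ κ) * E
      2^K≡ = trans (cong (2 ^_) (≡-sym (m∸n+n≡m κ≤K))) (trans (^-distribˡ-+-* 2 (K ∸ κ) κ) (cong (2 ^ (K ∸ κ) *_) (≡-sym E≡)))
      e₁ : ∀ s w x → s * (w * x) ≡ s * (x * w)
      e₁ = solve-∀
      e₂ : ∀ e x w → e * x * (x * w) ≡ e * (x * x * w)
      e₂ = solve-∀
      fraction≥ : ∀ v → 0 < ω v → 2 ^ K ≤ E * X v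
      fraction≥ v h = begin
        2 ^ K             ≡⟨ trans 2^K≡ (*-comm (2 ^ (K ∸ κ)) E) ⟩
        E * 2 ^ (K ∸ κ)   ≤⟨ *-monoʳ-≤ E (≤quotient (2 ^ (K ∸ κ)) (2 ^ K * ω v) (reach v) (≤-trans h (m≤m+n (ω v) _)) (begin
            2 ^ (K ∸ κ) * reach v   ≤⟨ *-monoʳ-≤ (2 ^ (K ∸ κ)) (hreach v) ⟩
            2 ^ (K ∸ κ) * E         ≡⟨ 2^K≡ ⟨
            2 ^ K                   ≤⟨ m≤m*n (2 ^ K) (ω v) {{>-nonZero h}} ⟩
            2 ^ K * ω v ∎)) ⟩
        E * X v ∎
      pointwise : ∀ v → 2 ^ K * (ω v * X v) ≤ E * (X v * X v * ω v)
      pointwise v with ω v ≟ 0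
      ... | yes h = ≤-trans (≤-reflexive (trans (cong (λ z → 2 ^ K * (z * X v)) h) (*-zeroʳ (2 ^ K)))) z≤n
      ... | no ¬h = ≤-trans (≤-reflexive (e₁ (2 ^ K) (ω v) (X v))) (≤-trans (*-monoˡ-≤ (X v * ω v) (fraction≥ v (n≢0⇒n>0 ¬h))) (≤-reflexive (e₂ E (X v) (ω v))))

    quality : ∀ p q κ → (q ≤ p * E) ⊎ (E ≡ 2 ^ κ × (∀ v → reach v ≤ E)) →
      q * (U + weight) ≤ 2 * q * (2 ^ K * W) + 2 * p * (U + weight)
    quality p q κ (inj₁ h) = scaled p q E (U + weight) (2 ^ K * W) 0<E h coarse
    quality p q κ (inj₂ (E≡ , hreach)) = ≤-trans (*-monoʳ-≤ q (exact (slack κ E≡ hreach)))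
      (≤-trans (≤-reflexive (e₁ q (2 ^ K * W))) (m≤m+n _ _))
      where
      e₁ : ∀ q x → q * (2 * x) ≡ 2 * q * x
      e₁ = solve-∀

    reach≡ : ∀ v → reach v ≡ ω v + wt ω (Nbr G v)
    reach≡ v = cong (ω v +_) (trans (∑-cong V (λ u → *-comm (a v u) (ω u))) (≡-sym (wt-∑ ω (Nbr G v) (a v) (λ _ → refl))))

    sum3≤ : sum3 G ω Q.* ℕtoℚ (2 ^ K) Q.≤ ℕtoℚ (U + weight)
    sum3≤ = QP.≤-trans (Sum3.sum3-bound G ω (2 ^ K) (λ v → ω v * X v + ω v) pointwise) (QP.≤-reflexive (cong ℕtoℚ (∑-+ V _ ω)))
      where
      e₁ : ∀ s w → s * (w * w) ≡ w * (s * w)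
      e₁ = solve-∀
      e₂ : ∀ w x r → w * (suc x * r) ≡ (w * x + w) * r
      e₂ = solve-∀
      pointwise : ∀ v → 2 ^ K * (ω v * ω v) ≤ (ω v * X v + ω v) * (ω v + wt ω (Nbr G v))
      pointwise v = ≤-trans (≤-reflexive (e₁ (2 ^ K) (ω v))) (≤-trans (*-monoʳ-≤ (ω v) (lower v))
        (≤-reflexive (trans (e₂ (ω v) (X v) (reach v)) (cong ((ω v * X v + ω v) *_) (reach≡ v)))))

ceilDiv-mono : ∀ {x y} p → x ≤ y → ceilDiv x p ≤ ceilDiv y p
ceilDiv-mono zero    h = z≤n
ceilDiv-mono (suc b) h = /-monoˡ-≤ (suc b) (+-monoˡ-≤ b h)

rounds-bound₃ : ∀ F P K l E E′ ls → P ≤ F * (16 * (K * (2 * E + 1))) → K ≤ 5 * l → E ≤ E′ → 1 ≤ E′ → 1 ≤ l →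
  2 * ls + (2 + K * P) ≤ (4 + 1200 * F) * (l ^ 2 * E′ + ls)
rounds-bound₃ F P K l E E′ ls hP hK hE 1≤E′ 1≤l = begin
  2 * ls + (2 + K * P)
    ≤⟨ +-monoʳ-≤ (2 * ls) (+-mono-≤ (*-monoʳ-≤ 2 1≤X) main) ⟩
  2 * ls + (2 * X + 1200 * F * X)
    ≤⟨ m≤m+n _ (2 * X + (2 + 1200 * F) * ls) ⟩
  2 * ls + (2 * X + 1200 * F * X) + (2 * X + (2 + 1200 * F) * ls)
    ≡⟨ e₁ (1200 * F) X ls ⟩
  (4 + 1200 * F) * (X + ls) ∎
  where
  open ≤-Reasoning
  X : ℕ
  X = l ^ 2 * E′
  1≤X : 1 ≤ X
  1≤X = *-mono-≤ (^-monoˡ-≤ 2 1≤l) 1≤E′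
  e₁ : ∀ f x s → 2 * s + (2 * x + f * x) + (2 * x + (2 + f) * s) ≡ (4 + f) * (x + s)
  e₁ = solve-∀
  e₂ : ∀ F l E → 5 * l * (F * (16 * (5 * l * (3 * E)))) ≡ 1200 * F * (l * (l * 1) * E)
  e₂ = solve-∀
  e₃ : ∀ E → 2 * E + E ≡ 3 * E
  e₃ = solve-∀
  main : K * P ≤ 1200 * F * X
  main = begin
    K * P                                          ≤⟨ *-mono-≤ hK (≤-trans hP (*-monoʳ-≤ F (*-monoʳ-≤ 16 (*-mono-≤ hK (≤-trans (+-mono-≤ (*-monoʳ-≤ 2 hE) 1≤E′) (≤-reflexive (e₃ E′))))))) ⟩
    5 * l * (F * (16 * (5 * l * (3 * E′))))        ≡⟨ e₂ F l E′ ⟩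
    1200 * F * X ∎

opaque
  roundFactor₃ : ℕ
  roundFactor₃ = 4 + 1200 * phaseFactor

  rounds₃≤ : ∀ P K l E E′ ls → P ≤ phaseFactor * (16 * (K * (2 * E + 1))) → K ≤ 5 * l → E ≤ E′ → 1 ≤ E′ → 1 ≤ l →
    2 * ls + (2 + K * P) ≤ roundFactor₃ * (l ^ 2 * E′ + ls)
  rounds₃≤ = rounds-bound₃ phaseFactor

  0<roundFactor₃ : 0 < roundFactor₃
  0<roundFactor₃ = s≤s z≤n

fineness≤ : ∀ E Δ x y → ⌈log₂ E ⌉ ≤ x → ⌈log₂ Δ + 1 ⌉ ≤ y → fineness E Δ ≤ 2 + x + y
fineness≤ E Δ x y hE hΔ = ≤-trans (⌈log₂*⌉≤ (4 * E) (Δ + 1)) (+-mono-≤ (≤-trans (⌈log₂*⌉≤ 4 E) (+-monoʳ-≤ 2 hE)) hΔ)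

⌈log₂Δ+1⌉≤ : ∀ Δ ℓ → Δ ≤ 2 ^ ℓ → ⌈log₂ Δ + 1 ⌉ ≤ 1 + ℓ
⌈log₂Δ+1⌉≤ Δ ℓ h = ≤2^⇒⌈log₂⌉≤ (Δ + 1) (1 + ℓ) (≤-trans (+-mono-≤ h (0<2^ ℓ)) (≤-reflexive (cong (2 ^ ℓ +_) (≡-sym (+-identityʳ (2 ^ ℓ))))))

module Caro (cId : ℕ) (ε : ℚ) (0<ε : 0ℚ Q.< ε) where
  open Start cId

  p q E′ : ℕ
  p  = ∣ ↥ ε ∣
  q  = ↧ₙ ε
  E′ = ceilDivQ 1 ε

  0<E′ : 0 < E′
  0<E′ = 0<*⇒0<ʳ p E′ (≤-trans (denominator-pos ε) (↧≤↥*⌈1/ε⌉ ε 0<ε))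

  -- Beyond 2 ^ κ, a finer accuracy is for free, and its parameters would not fit into messages.
  κ E : ℕ → ℕ
  κ n = (cId + 2) * lg n
  E n = E′ ⊓ 2 ^ κ n

  0<E : ∀ n → 0 < E n
  0<E n = ⊓-glb 0<E′ (0<2^ (κ n))

  opaque
    mainProgram : (Δ ξ n : ℕ) → List Instr
    mainProgram Δ ξ n = recolour Δ (startBits ξ n) (logStar ξ) ++ Chosen₃.body (E n) Δ (0<E n)

    mainProgram≡ : ∀ Δ ξ n → mainProgram Δ ξ n ≡ recolour Δ (startBits ξ n) (logStar ξ) ++ Chosen₃.body (E n) Δ (0<E n)
    mainProgram≡ Δ ξ n = refl

  -- `q ≤ p` means ε ≥ 1, where the empty set is good enough. For Δ = 0 the logarithm of ⌈Δ/ε⌉ does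
  -- not reflect 1/ε, but all nodes may join in one round. In the remaining case both Δ and ⌈1/ε⌉
  -- are at most ⌈Δ/ε⌉.
  program : LocalInput → List Instr
  program x = ifLe q p [] (ifEq (LocalInput.maxDegree x) 0 (join ∷ [])
    (mainProgram (LocalInput.maxDegree x) (LocalInput.numColors x) (LocalInput.netSize x)))

  algorithm : Algorithm
  algorithm = compile width startNode program

  module _ (I : Instance) where
    open Local (G I)
    open Stage (G I)

    Δ₀ l bound : ℕ
    Δ₀ = maxDeg (G I)
    l = lg (ceilDivQ Δ₀ ε)
    bound = roundFactor₃ * (l ^ 2 * E′ + logStar (ξ I))

    1≤bound : 1 ≤ bound
    1≤bound = *-mono-≤ 0<roundFactor₃ (≤-trans (*-mono-≤ (^-monoˡ-≤ 2 (1≤lg (ceilDivQ Δ₀ ε))) 0<E′) (m≤m+n _ _))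

    Quality : Subset (n I) → Set
    Quality S = (½ - ε) Q.* sum3 (G I) (w I) Q.≤ ℕtoℚ (wt (w I) S)

    s : ℚ
    s = sum3 (G I) (w I)

    s≤ : s Q.* ℕtoℚ 1 Q.≤ ℕtoℚ (∑ V (w I))
    s≤ = Sum3.sum3-bound (G I) (w I) 1 (w I) (λ v → ≤-trans (≤-reflexive (*-identityˡ (w I v * w I v))) (*-monoʳ-≤ (w I v) (m≤m+n (w I v) (wt (w I) (Nbr (G I) v)))))

    easy : ∀ W → q * ∑ V (w I) ≤ 2 * q * (1 * W) + 2 * p * ∑ V (w I) → (½ - ε) Q.* s Q.≤ ℕtoℚ W
    easy W = [½-ε]*≤ ε s 1 (∑ V (w I)) W 0<ε (Sum3.sum3-nonNeg (G I) (w I)) (s≤s z≤n) s≤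

    module Coarse (q≤p : q ≤ p) where
      open Simulation width startNode program I (b I) []

      solution : Solves cId (7 * suc (bitsPer cId)) algorithm I bound Quality
      solution = solves cId (7 * suc (bitsPer cId)) bound Quality (λ v → ifLe-yes q≤p) (λ v → refl) (short-messages I)
        (λ hid hwt → (start-bounded I hid hwt , []) , z≤n , (λ u v ()) ,
          easy (wt (w I) (λ _ → false)) (≤-trans (*-monoˡ-≤ (∑ V (w I)) (≤-trans q≤p (m≤n*m p 2))) (m≤n+m _ _)))

    module Isolated (q≰p : q ≰ p) (Δ≡0 : Δ₀ ≡ 0) where
      open Simulation width startNode program I (b I) (join ∷ [])

      all-independent : Independent (G I) (λ _ → true)
      all-independent u v _ _ with adj (G I) u v in uv
      ... | false = refl
      ... | true  = ⊥-elim (<-irrefl refl (≤-trans (≤-trans (≤-trans (≤-reflexive (cong 𝟙ᵇ (≡-sym uv))) (∑-∈ (a u) (∈-allFin v))) (degree≤Δ I u)) (≤-reflexive Δ≡0)))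

      weight≡ : wt (w I) (λ _ → true) ≡ ∑ V (w I)
      weight≡ = trans (wt-∑ (w I) (λ _ → true) (λ _ → 1) (λ _ → refl)) (∑-cong V (λ v → *-identityʳ (w I v)))

      enough : q * ∑ V (w I) ≤ 2 * q * (1 * wt (w I) (λ _ → true)) + 2 * p * ∑ V (w I)
      enough = ≤-trans (*-mono-≤ (m≤n*m q 2) (≤-reflexive (trans (≡-sym weight≡) (≡-sym (*-identityˡ (wt (w I) (λ _ → true))))))) (m≤m+n _ _)

      solution : Solves cId (7 * suc (bitsPer cId)) algorithm I bound Quality
      solution = solves cId (7 * suc (bitsPer cId)) bound Quality (λ v → trans (ifLe-no q≰p) (ifEq-≡ Δ≡0)) (λ v → refl) (short-messages I)
        (λ hid hwt → (start-bounded I hid hwt , Keeping.keeps-mem (b I) (λ _ _ → 1) stack (λ _ _ _ → 0<2^ (b I)) ∷ []) , 1≤bound ,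
          all-independent , easy (wt (w I) (λ _ → true)) enough)

    module General (q≰p : q ≰ p) (Δ≢0 : Δ₀ ≢ 0) where
      module C = Chosen₃ (E (n I)) Δ₀ (0<E (n I))
      p₀ p₁ : List Instr
      p₀ = mainProgram Δ₀ (ξ I) (n I)
      p₁ = recolour Δ₀ (bits₀ I) (logStar (ξ I)) ++ C.body
      p₀≡p₁ : p₀ ≡ p₁
      p₀≡p₁ = mainProgram≡ Δ₀ (ξ I) (n I)
      open Simulation width startNode program I (b I) p₀ using (solves)

      E≤2^κ : E (n I) ≤ 2 ^ κ (n I)
      E≤2^κ = m⊓n≤n E′ (2 ^ κ (n I))

      Δ≤2^ℓ : Δ₀ ≤ 2 ^ ℓ I
      Δ≤2^ℓ = ≤-trans (Δ≤n I) (≤2^lg (n I))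

      K≤ : C.K ≤ 2 + κ (n I) + (1 + ℓ I)
      K≤ = fineness≤ (E (n I)) Δ₀ (κ (n I)) (1 + ℓ I) (≤2^⇒⌈log₂⌉≤ (E (n I)) (κ (n I)) E≤2^κ) (⌈log₂Δ+1⌉≤ Δ₀ (ℓ I) Δ≤2^ℓ)

      K≤b : C.K ≤ b I
      K≤b = ≤-trans K≤ (≤-trans (generic cId (ℓ I) (1≤ℓ I)) (scale I (6 + cId) (+-mono-≤ (m≤m+n 6 154) (m≤n*m cId 20))))
        where
        e₁ : ∀ c l → 2 + (c + 2) * l + (1 + l) ≡ 3 * 1 + (3 + c) * l
        e₁ = solve-∀
        e₂ : ∀ c l → 3 * l + (3 + c) * l ≡ (6 + c) * l
        e₂ = solve-∀
        generic : ∀ c l → 1 ≤ l → 2 + (c + 2) * l + (1 + l) ≤ (6 + c) * l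
        generic c l h = ≤-trans (≤-reflexive (e₁ c l)) (≤-trans (+-monoˡ-≤ ((3 + c) * l) (*-monoʳ-≤ 3 h)) (≤-reflexive (e₂ c l)))

      logH≤ : ⌈log₂ C.H ⌉ ≤ 2 + κ (n I) + (1 + ℓ I) + (2 + κ (n I))
      logH≤ = ≤-trans (⌈log₂*⌉≤ C.K (2 * E (n I) + 1)) (+-mono-≤ (≤-trans (⌈log₂⌉≤ C.K) K≤)
        (≤-trans (⌈log₂⌉-mono-≤ (generic (E (n I)) (2 ^ κ (n I)) (0<2^ (κ (n I))) E≤2^κ)) (≤-trans (⌈log₂*⌉≤ 4 (2 ^ κ (n I))) (+-monoʳ-≤ 2 (≤-reflexive (⌈log₂2^n⌉≡n (κ (n I))))))))
        where
        e₁ : ∀ x → 2 * x + x + x ≡ 4 * x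
        e₁ = solve-∀
        generic : ∀ e x → 0 < x → e ≤ x → 2 * e + 1 ≤ 4 * x
        generic e x 0<x h = ≤-trans (+-mono-≤ (*-monoʳ-≤ 2 h) 0<x) (≤-trans (m≤m+n (2 * x + x) x) (≤-reflexive (e₁ x)))

      fits : C.bitsNeeded ≤ b I
      fits = ≤-trans (+-monoʳ-≤ 47 (*-monoʳ-≤ 10 logH≤)) (≤-trans (generic cId (ℓ I) (1≤ℓ I)) (scale I (147 + 20 * cId) (+-monoˡ-≤ (20 * cId) (m≤m+n 147 13))))
        where
        e₁ : ∀ c l → 47 + 10 * (2 + (c + 2) * l + (1 + l) + (2 + (c + 2) * l)) ≡ 97 * 1 + (50 + 20 * c) * l
        e₁ = solve-∀
        e₂ : ∀ c l → 97 * l + (50 + 20 * c) * l ≡ (147 + 20 * c) * l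
        e₂ = solve-∀
        generic : ∀ c l → 1 ≤ l → 47 + 10 * (2 + (c + 2) * l + (1 + l) + (2 + (c + 2) * l)) ≤ (147 + 20 * c) * l
        generic c l h = ≤-trans (≤-reflexive (e₁ c l)) (≤-trans (+-monoˡ-≤ ((50 + 20 * c) * l) (*-monoʳ-≤ 97 h)) (≤-reflexive (e₂ c l)))

      module F = C.Fit (b I) fits

      Δ≤D′ : Δ₀ ≤ ceilDivQ Δ₀ ε
      Δ≤D′ = *-cancelʳ-≤ Δ₀ (ceilDivQ Δ₀ ε) q {{>-nonZero (denominator-pos ε)}} (≤-trans (≤*ceilDiv (Δ₀ * q) p (numerator-pos ε 0<ε))
        (≤-trans (*-monoˡ-≤ (ceilDivQ Δ₀ ε) (<⇒≤ (≰⇒> q≰p))) (≤-reflexive (*-comm q (ceilDivQ Δ₀ ε)))))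

      E≤D′ : E (n I) ≤ ceilDivQ Δ₀ ε
      E≤D′ = ≤-trans (m⊓n≤m E′ (2 ^ κ (n I))) (ceilDiv-mono p (*-monoˡ-≤ q (n≢0⇒n>0 Δ≢0)))

      K≤5l : C.K ≤ 5 * l
      K≤5l = ≤-trans (fineness≤ (E (n I)) Δ₀ l (1 + l) (⌈log₂⌉-mono-≤ (≤-trans E≤D′ (m≤m⊔n _ 2)))
          (⌈log₂Δ+1⌉≤ Δ₀ l (≤-trans Δ≤D′ (≤2^lg (ceilDivQ Δ₀ ε)))))
        (≤-trans (≤-reflexive (e₁ l)) (≤-trans (+-monoˡ-≤ (2 * l) (*-monoʳ-≤ 3 (1≤lg (ceilDivQ Δ₀ ε)))) (≤-reflexive (≡-sym (*-distribʳ-+ l 3 2)))))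
        where
        e₁ : ∀ l → 2 + l + (1 + l) ≡ 3 * 1 + 2 * l
        e₁ = solve-∀

      rounds : length p₀ ≤ bound
      rounds = ≤-trans (≤-reflexive (trans (cong length p₀≡p₁) (trans (length-++ (recolour Δ₀ (bits₀ I) (logStar (ξ I))))
          (cong₂ _+_ (length-recolour Δ₀ (bits₀ I) (logStar (ξ I))) C.length-body))))
        (rounds₃≤ C.phaseLength C.K l (E (n I)) E′ (logStar (ξ I)) C.phaseLength≤ K≤5l (m⊓n≤m E′ (2 ^ κ (n I))) 0<E′ (1≤lg (ceilDivQ Δ₀ ε)))

      keeps-spread : Keeps (b I) (spread (2 ^ C.K))
      keeps-spread = Keeping.keeps-frc (b I) _ (λ d ds _ → ≤-trans (quotient≤ (2 ^ C.K) (wgt d) (wgt d + ∑ ds wgt) (m≤m+n (wgt d) _)) (^-monoʳ-≤ 2 K≤b))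

      module _ (hid : ∀ v → ident I v < range I) (hwt : maxWt (w I) < range I) where

        keeps : All (Keeps (b I)) p₀
        keeps = subst (All (Keeps (b I))) (≡-sym p₀≡p₁) (++⁺ (keeps-reduction I hid hwt)
          (keeps-spread ∷ ++⁺ (F.keeps-rounding C.K) (Keeping.keeps-resolve (b I) ∷ [])))

        c₁ : Config (n I)
        c₁ = Recolour.recoloured (G I) Δ₀ (degree≤Δ I) (c₀ I hid hwt) (proj₁ (reduced I hid hwt)) (proj₁ (proj₂ (reduced I hid hwt)))

        proper₁ : Proper (colourBits Δ₀) c₁
        proper₁ = proj₂ (proj₂ (proj₂ (reduced I hid hwt)))

        module B = Body (G I) (E (n I)) Δ₀ (0<E (n I)) c₁
        module R = B.R proper₁ (degree≤Δ I)

        m : Fin (n I) → ℕ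
        m v = mem (exec (G I) p₀ (c₀ I hid hwt) v)

        m≡ : ∀ v → m v ≡ R.M v
        m≡ v = trans (cong (λ p → mem (exec (G I) p (c₀ I hid hwt) v)) p₀≡p₁)
          (trans (cong mem (exec-then (recolour Δ₀ (bits₀ I) (logStar (ξ I))) C.body {c₀ I hid hwt} {c₁} {exec (G I) C.body c₁} (proj₁ (proj₂ (proj₂ (reduced I hid hwt)))) (λ _ → refl) v))
            (B.mem≡ proper₁ (degree≤Δ I) v))

        independent : Independent (G I) (λ v → isOn (m v))
        independent = on-independent (G I) m (λ u v uv hu hv → B.independent proper₁ (degree≤Δ I) u v uv (subst (0 <_) (m≡ u) hu) (subst (0 <_) (m≡ v) hv))

        W : ℕ
        W = B.W proper₁ (degree≤Δ I)

        weight≡ : wt (w I) (λ v → isOn (m v)) ≡ W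
        weight≡ = on-weight (w I) m R.M m≡ R.M≤1

        -- At most Δ + 1 ≤ 2 · 2^ℓ weights of size at most 2^(`cId` ℓ) are added; this is the origin
        -- of `cId + 2` in `κ`.
        reach≤ : ∀ v → B.reach v ≤ 2 ^ κ (n I)
        reach≤ v = begin
          w I v + ∑ V (λ u → a v u * w I u)
            ≤⟨ +-mono-≤ (w≤ I hid hwt v) (∑-mono V (λ u → *-monoʳ-≤ (a v u) (w≤ I hid hwt u))) ⟩
          M + ∑ V (λ u → a v u * M)
            ≡⟨ cong (M +_) (trans (∑-cong V (λ u → *-comm (a v u) M)) (∑-*ˡ V M (a v))) ⟩
          M + M * ∑ V (a v)
            ≤⟨ +-mono-≤ (m≤m*n M (2 ^ ℓ I) {{2^-≢0 (ℓ I)}}) (*-monoʳ-≤ M (≤-trans (degree≤Δ I v) Δ≤2^ℓ)) ⟩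
          M * 2 ^ ℓ I + M * 2 ^ ℓ I
            ≡⟨ e₁ M (2 ^ ℓ I) ⟩
          2 * (M * 2 ^ ℓ I)
            ≡⟨ cong (2 *_) (^-distribˡ-+-* 2 (cId * ℓ I) (ℓ I)) ⟨
          2 ^ suc (cId * ℓ I + ℓ I)
            ≤⟨ ^-monoʳ-≤ 2 (≤-trans (+-monoˡ-≤ (cId * ℓ I + ℓ I) (1≤ℓ I)) (≤-reflexive (e₂ cId (ℓ I)))) ⟩
          2 ^ κ (n I) ∎
          where
          open ≤-Reasoning
          M : ℕ
          M = 2 ^ (cId * ℓ I)
          e₁ : ∀ m x → m * x + m * x ≡ 2 * (m * x)
          e₁ = solve-∀
          e₂ : ∀ c l → l + (c * l + l) ≡ (c + 2) * l
          e₂ = solve-∀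

        accurate : (q ≤ p * E (n I)) ⊎ (E (n I) ≡ 2 ^ κ (n I) × (∀ v → B.reach v ≤ E (n I)))
        accurate with ≤-total E′ (2 ^ κ (n I))
        ... | inj₁ h = inj₁ (≤-trans (↧≤↥*⌈1/ε⌉ ε 0<ε) (≤-reflexive (cong (p *_) (≡-sym (m≤n⇒m⊓n≡m h)))))
        ... | inj₂ h = inj₂ (m≥n⇒m⊓n≡n h , (λ v → ≤-trans (reach≤ v) (≤-reflexive (≡-sym (m≥n⇒m⊓n≡n h)))))

        quality : Quality (λ v → isOn (m v))
        quality = QP.≤-trans ([½-ε]*≤ ε s (2 ^ C.K) _ W 0<ε (Sum3.sum3-nonNeg (G I) (w I)) (0<2^ C.K) (B.sum3≤ proper₁ (degree≤Δ I))
            (B.quality proper₁ (degree≤Δ I) p q (κ (n I)) accurate))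
          (QP.≤-reflexive (cong ℕtoℚ (≡-sym weight≡)))

      solution : Solves cId (7 * suc (bitsPer cId)) algorithm I bound Quality
      solution = solves cId (7 * suc (bitsPer cId)) bound Quality (λ v → trans (ifLe-no q≰p) (ifEq-≢ Δ≢0)) (λ v → refl) (short-messages I)
        (λ hid hwt → (start-bounded I hid hwt , keeps hid hwt) , rounds , independent hid hwt , quality hid hwt)

    solution : Solves cId (7 * suc (bitsPer cId)) algorithm I bound Quality
    solution with q ≤? p
    ... | yes h = Coarse.solution h
    ... | no ¬h with maxDeg (G I) ≟ 0
    ...   | yes z = Isolated.solution ¬h z
    ...   | no ¬z = General.solution ¬h ¬z

part₃ : ∀ (cId : ℕ) → Σ ℕ λ cMsg → Σ ℕ λ C → ∀ (ε : ℚ) → 0ℚ Q.< ε → Σ Algorithm λ A →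
  ∀ (I : Instance) →
  Solves cId cMsg A I
    (C * (lg (ceilDivQ (maxDeg (G I)) ε) ^ 2 * ceilDivQ 1 ε + logStar (ξ I)))
    (λ S → (½ - ε) Q.* sum3 (G I) (w I) Q.≤ ℕtoℚ (wt (w I) S))
part₃ cId = 7 * suc (bitsPer cId) , roundFactor₃ , λ ε 0<ε → Caro.algorithm cId ε 0<ε , Caro.solution cId ε 0<ε

theorem1p3 : (∀ (cId : ℕ) → Σ ℕ λ cMsg → Σ ℕ λ C → ∀ (ε : ℚ) → 0ℚ Q.< ε → Σ Algorithm λ A →
    ∀ (I : Instance) (β OPT : ℕ) → IsNbhdIndep (G I) β → IsOPT (G I) (w I) OPT →
    Solves cId cMsg A I
    (C * (lg (maxDeg (G I) * maxWt (w I)) ^ 2 * lg (ceilDivQ 1 ε) + logStar (ξ I)))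
    (λ S → (1ℚ - ε) Q.* ℕtoℚ OPT Q.≤ ℕtoℚ (β ⊔ 1) Q.* ℕtoℚ (wt (w I) S)))
    ×
    (∀ (cId : ℕ) → Σ ℕ λ cMsg → Σ ℕ λ C → ∀ (ε : ℚ) → 0ℚ Q.< ε → Σ Algorithm λ A →
    ∀ (I : Instance) →
    Solves cId cMsg A I
    (C * (lg (maxDeg (G I)) ^ 2 * lg (ceilDivQ 1 ε) + logStar (ξ I)))
    (λ S → (1ℚ - ε) Q.* ℕtoℚ (wt (w I) (λ _ → Data.Bool.true))
    Q.≤ ℕtoℚ (maxDeg (G I) + 1) Q.* ℕtoℚ (wt (w I) S)))
    ×
    (∀ (cId : ℕ) → Σ ℕ λ cMsg → Σ ℕ λ C → ∀ (ε : ℚ) → 0ℚ Q.< ε → Σ Algorithm λ A →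
    ∀ (I : Instance) →
    Solves cId cMsg A I
    (C * (lg (ceilDivQ (maxDeg (G I)) ε) ^ 2 * ceilDivQ 1 ε + logStar (ξ I)))
    (λ S → (½ - ε) Q.* sum3 (G I) (w I) Q.≤ ℕtoℚ (wt (w I) S)))
theorem1p3 = part₁ , part₂ , part₃
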